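{- There is a one-to-one correspondence between the set $\mathfrak{c}_{prim}$ of primitive (directed) çarks, up to isomorphism, and the set of $\mathrm{PSL}_2(\mathbf{Z})$-classes of primitive indefinite binary quadratic forms having discriminant $\Delta\in\mathcal{D}$. It sends the çark $\langle M\rangle\backslash\mathcal{F}$ directed by $M$ to the class of $f_M$.
   Context: $\mathcal{D}=\{d\in\mathbf{Z}_{>0}: d\equiv 0,1 \pmod 4,\ d \text{ is not a square}\}$. Let $S(z)=-1/z$, $R(z)=(z-1)/z$. The bipartite Farey tree $\mathcal{F}$ has edges $\{W\}$, $\otimes$-vertices $\{W,WS\}$, $\bullet$-vertices $\{W,WR,WR^2\}$ ($W\in\mathrm{PSL}_2(\mathbf{Z})$); the edge $\{W\}$ joins $\{W,WS\}$ to $\{W,WR,WR^2\}$, and the edges at a $\bullet$-vertex are cyclically ordered as $(\{W\},\{WR\},\{WR^2\})$. $\mathrm{PSL}_2(\mathbf{Z})$ acts on $\mathcal{F}$ by left multiplication. A çark is the quotient ribbon graph $\langle M\rangle\backslash\mathcal{F}$ for a hyperbolic $M\in\mathrm{PSL}_2(\mathbf{Z})$ ($|\mathrm{tr}\,M|>2$). Its unique circuit, the image of the axis of $M$ in $\mathcal{F}$, is the spine. A çark is directed if an orientation of its spine is chosen; the direction given by $M$ is that in which $M$ translates its axis. Isomorphisms of directed çarks preserve the ribbon structure, the types of vertices and the direction. Going around the spine, at each $\bullet$-vertex there is one branch off the spine, on one of the two sides; this gives a cyclic binary word. A çark is primitive if its spine is not periodic, i.e. this cyclic word is aperiodic (not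 a proper power). Forms: $(A,B,C)$ denotes $Ax^2+Bxy+Cy^2$ with $A,B,C\in\mathbf{Z}$; its discriminant is $B^2-4AC$; it is primitive if $\gcd(A,B,C)=1$ and indefinite if its discriminant is positive. $\mathrm{PSL}_2(\mathbf{Z})$ acts by $(U\cdot f)(x,y)=f(U(x,y)^t)$; classes are orbits. For hyperbolic $M=\begin{pmatrix}p&q\\ r&s\end{pmatrix}$ put $f_M=\frac{\mathrm{sgn}(p+s)}{\gcd(q,s-p,r)}(r,s-p,-q)$. -}

module Defs where

open import Algebra.Bundles using (Group)
open import Data.Empty using (⊥)
open import Data.Integer.Base as ℤ
  using (ℤ; +_; -[1+_]; 0ℤ; 1ℤ; -1ℤ; _+_; _*_; _-_; -_; ∣_∣; sign; _◃_; _%ℕ_)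
open import Data.Integer.Divisibility using (_∣_)
open import Data.Integer.GCD using (gcd; gcd[i,j]≡0⇒i≡0; gcd[i,j]≡0⇒j≡0)
import Data.Integer.Properties as ℤₚ
open import Data.Integer.Tactic.RingSolver using (solve-∀)
open import Data.Nat.Base as ℕ using (ℕ; zero; suc)
open import Data.Nat.GeneralisedArithmetic using (fold)
import Data.Nat.Properties as ℕₚ
open import Data.Product.Base using (Σ; ∃; ∃-syntax; _×_; _,_; proj₁; proj₂)
open import Data.Sum.Base using (_⊎_; inj₁; inj₂)
open import Function.Base using (_on_)
open import Function.Bundles using (Func; Inverse; _⇔_; mk⇔; Equivalence)
import Function.Construct.Composition as Comp
import Function.Construct.Identity as Id
import Function.Construct.Symmetry as Symm
open import Level using (0ℓ)
open import Relation.Binary.Bundles using (Setoid)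
open import Relation.Binary.Structures using (IsEquivalence)
open import Relation.Binary.PropositionalEquality
  using (_≡_; refl; sym; trans; cong; cong₂; subst)
open import Relation.Nullary using (¬_)

------------------------------------------------------------------------
-- Bipartite ribbon graphs

record RibbonGraph : Set₁ where
  field
    edge ⊗-vertex •-vertex : Setoid 0ℓ 0ℓ

  open Setoid edge public
    using () renaming (Carrier to Edge; _≈_ to _≈ᵉ_)
  open Setoid ⊗-vertex public using () renaming (_≈_ to _≈⊗_)
  open Setoid •-vertex public using () renaming (_≈_ to _≈•_)

  field
    ⊗-end-func : Func edge ⊗-vertex
    •-end-func : Func edge •-vertex
    ⊗-next-func : Func edge edge
    •-next-func : Func edge edge

  open Func ⊗-end-func public using () renaming (to to ⊗-end; cong to ⊗-end-cong)
  open Func •-end-func public using () renaming (to to •-end; cong to •-end-cong)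
  open Func ⊗-next-func public using () renaming (to to ⊗-next; cong to ⊗-next-cong)
  open Func •-next-func public using () renaming (to to •-next; cong to •-next-cong)

  -- ⊗-next and •-next are the successors in the cyclic orders: the edges at a
  -- vertex form exactly one cycle.
  field
    ⊗-cyclic : ∀ e e′ → (⊗-end e ≈⊗ ⊗-end e′) ⇔ (∃ λ k → fold e ⊗-next k ≈ᵉ e′)
    •-cyclic : ∀ e e′ → (•-end e ≈• •-end e′) ⇔ (∃ λ k → fold e •-next k ≈ᵉ e′)

-- A bi-infinite path without backtracking: it enters its i-th •-vertex along
-- into i, leaves it along out i, and then crosses a ⊗-vertex to into (i + 1).
record Line (G : RibbonGraph) : Set where
  open RibbonGraph G
  field
    into out : ℤ → Edge
    at-•     : ∀ i → •-end (into i) ≈• •-end (out i)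
    turn     : ∀ i → ¬ into i ≈ᵉ out i
    at-⊗     : ∀ i → ⊗-end (out i) ≈⊗ ⊗-end (into (i + 1ℤ))
    cross    : ∀ i → ¬ out i ≈ᵉ into (i + 1ℤ)

-- A circuit with an orientation and a base point: a closed path meeting no
-- vertex twice, given as a periodic line. The period, size, is the number of
-- •-vertices on it.
record OrientedCircuit (G : RibbonGraph) : Set where
  open RibbonGraph G
  field
    line          : Line G
    size          : ℕ
    size>0        : size ℕ.> 0
  open Line line public
  field
    into-periodic : ∀ i → into (i + + size) ≈ᵉ into i
    out-periodic  : ∀ i → out (i + + size) ≈ᵉ out i
    •-simple      : ∀ i j → •-end (into i) ≈• •-end (into j) → + size ∣ i - j
    ⊗-simple      : ∀ i j → ⊗-end (out i) ≈⊗ ⊗-end (out j) → + size ∣ i - j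

------------------------------------------------------------------------
-- Isomorphisms of ribbon graphs

record RibbonIso (G H : RibbonGraph) : Set where
  private
    module G = RibbonGraph G
    module H = RibbonGraph H
  field
    edge-inverse : Inverse G.edge H.edge
    ⊗-inverse    : Inverse G.⊗-vertex H.⊗-vertex
    •-inverse    : Inverse G.•-vertex H.•-vertex

  open Inverse edge-inverse public
    using () renaming (to to onEdge; from to fromEdge)
  open Inverse ⊗-inverse public using () renaming (to to on⊗)
  open Inverse •-inverse public using () renaming (to to on•)

  field
    ⊗-end-comm  : ∀ e → H.⊗-end (onEdge e) H.≈⊗ on⊗ (G.⊗-end e)
    •-end-comm  : ∀ e → H.•-end (onEdge e) H.≈• on• (G.•-end e)
    ⊗-next-comm : ∀ e → H.⊗-next (onEdge e) H.≈ᵉ onEdge (G.⊗-next e)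
    •-next-comm : ∀ e → H.•-next (onEdge e) H.≈ᵉ onEdge (G.•-next e)

-- φ carries the circuit c to c′ with its orientation; the base points need not
-- correspond.
Carries : ∀ {G H} → RibbonIso G H → OrientedCircuit G → OrientedCircuit H → Set
Carries {H = H} φ c c′ =
  ∃ λ k → ∀ i → (onEdge (c.into i) ≈ᵉ c′.into (i + k)) ×
                (onEdge (c.out i) ≈ᵉ c′.out (i + k))
  where
  open RibbonIso φ
  open RibbonGraph H
  module c = OrientedCircuit c
  module c′ = OrientedCircuit c′

private
  idIso : ∀ G → RibbonIso G G
  idIso G = record
    { edge-inverse = Id.inverse edge
    ; ⊗-inverse    = Id.inverse ⊗-vertex
    ; •-inverse    = Id.inverse •-vertex
    ; ⊗-end-comm   = λ _ → Setoid.refl ⊗-vertex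
    ; •-end-comm   = λ _ → Setoid.refl •-vertex
    ; ⊗-next-comm  = λ _ → Setoid.refl edge
    ; •-next-comm  = λ _ → Setoid.refl edge
    }
    where open RibbonGraph G

  compIso : ∀ {G H K} → RibbonIso G H → RibbonIso H K → RibbonIso G K
  compIso {G} {H} {K} φ ψ = record
    { edge-inverse = Comp.inverse φ.edge-inverse ψ.edge-inverse
    ; ⊗-inverse    = Comp.inverse φ.⊗-inverse ψ.⊗-inverse
    ; •-inverse    = Comp.inverse φ.•-inverse ψ.•-inverse
    ; ⊗-end-comm   = λ e → Setoid.trans K.⊗-vertex (ψ.⊗-end-comm _)
                             (Inverse.to-cong ψ.⊗-inverse (φ.⊗-end-comm e))
    ; •-end-comm   = λ e → Setoid.trans K.•-vertex (ψ.•-end-comm _)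
                             (Inverse.to-cong ψ.•-inverse (φ.•-end-comm e))
    ; ⊗-next-comm  = λ e → Setoid.trans K.edge (ψ.⊗-next-comm _)
                             (Inverse.to-cong ψ.edge-inverse (φ.⊗-next-comm e))
    ; •-next-comm  = λ e → Setoid.trans K.edge (ψ.•-next-comm _)
                             (Inverse.to-cong ψ.edge-inverse (φ.•-next-comm e))
    }
    where
    module K = RibbonGraph K
    module φ = RibbonIso φ
    module ψ = RibbonIso ψ

  -- If f intertwines u (on X) with v (on Y), then f⁻¹ intertwines v with u.
  flipComm : ∀ {A B X Y : Setoid 0ℓ 0ℓ} (f : Inverse A B) (g : Inverse X Y)
    (u : Func A X) (v : Func B Y) →
    (∀ a → Setoid._≈_ Y (Func.to v (Inverse.to f a)) (Inverse.to g (Func.to u a))) →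
    ∀ b → Setoid._≈_ X (Func.to u (Inverse.from f b)) (Inverse.from g (Func.to v b))
  flipComm {A} {B} {X} {Y} f g u v h b =
    X.sym (X.trans
      (Inverse.from-cong g (Func.cong v (B.sym (Inverse.strictlyInverseˡ f b))))
      (X.trans (Inverse.from-cong g (h (Inverse.from f b)))
               (Inverse.strictlyInverseʳ g _)))
    where
    module X = Setoid X
    module B = Setoid B

  symIso : ∀ {G H} → RibbonIso G H → RibbonIso H G
  symIso {G} {H} φ = record
    { edge-inverse = Symm.inverse φ.edge-inverse
    ; ⊗-inverse    = Symm.inverse φ.⊗-inverse
    ; •-inverse    = Symm.inverse φ.•-inverse
    ; ⊗-end-comm   = flipComm φ.edge-inverse φ.⊗-inverse
                       G.⊗-end-func H.⊗-end-func φ.⊗-end-comm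
    ; •-end-comm   = flipComm φ.edge-inverse φ.•-inverse
                       G.•-end-func H.•-end-func φ.•-end-comm
    ; ⊗-next-comm  = flipComm φ.edge-inverse φ.edge-inverse
                       G.⊗-next-func H.⊗-next-func φ.⊗-next-comm
    ; •-next-comm  = flipComm φ.edge-inverse φ.edge-inverse
                       G.•-next-func H.•-next-func φ.•-next-comm
    }
    where
    module G = RibbonGraph G
    module H = RibbonGraph H
    module φ = RibbonIso φ

------------------------------------------------------------------------
-- The Farey tree and its quotients

-- Edges, vertices and the left action only involve the group generated by S
-- and R, so the construction is made for any group Γ with S² = R³ = 1.
module FareyTree (Γ : Group 0ℓ 0ℓ) (S R : Group.Carrier Γ)
  (S² : Group._≈_ Γ (Group._∙_ Γ S S) (Group.ε Γ))
  (R³ : Group._≈_ Γ (Group._∙_ Γ R (Group._∙_ Γ R R)) (Group.ε Γ)) where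

  open Group Γ using (Carrier; _≈_; _∙_; ε; _⁻¹)
  private module Γ = Group Γ

  infixr 8 _^_
  _^_ : Carrier → ℤ → Carrier
  M ^ (+ zero)      = ε
  M ^ (+ suc n)     = M ∙ M ^ (+ n)
  M ^ -[1+ zero ]   = M ⁻¹
  M ^ -[1+ suc n ]  = M ⁻¹ ∙ M ^ -[1+ n ]

  private
    cancelˡ : ∀ A B → A ∙ (A ⁻¹ ∙ B) ≈ B
    cancelˡ A B =
      Γ.trans (Γ.sym (Γ.assoc A (A ⁻¹) B))
      (Γ.trans (Γ.∙-congʳ (Γ.inverseʳ A)) (Γ.identityˡ B))

    cancelˡ′ : ∀ A B → A ⁻¹ ∙ (A ∙ B) ≈ B
    cancelˡ′ A B =
      Γ.trans (Γ.sym (Γ.assoc (A ⁻¹) A B))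
      (Γ.trans (Γ.∙-congʳ (Γ.inverseˡ A)) (Γ.identityˡ B))

    ^-suc : ∀ M i → M ^ (1ℤ + i) ≈ M ∙ M ^ i
    ^-suc M (+ n)          = Γ.refl
    ^-suc M -[1+ zero ]    = Γ.sym (Γ.inverseʳ M)
    ^-suc M -[1+ suc n ]   = Γ.sym (cancelˡ M _)

    ^-pred : ∀ M i → M ^ (-1ℤ + i) ≈ M ⁻¹ ∙ M ^ i
    ^-pred M (+ zero)      = Γ.sym (Γ.identityʳ (M ⁻¹))
    ^-pred M (+ suc n)     = Γ.sym (cancelˡ′ M _)
    ^-pred M -[1+ n ]      = Γ.refl

  ^-+ : ∀ M i j → M ^ (i + j) ≈ M ^ i ∙ M ^ j
  ^-+ M (+ zero) j =
    Γ.trans (Γ.reflexive (cong (M ^_) (ℤₚ.+-identityˡ j))) (Γ.sym (Γ.identityˡ _))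
  ^-+ M (+ suc n) j =
    Γ.trans (Γ.reflexive (cong (M ^_) (ℤₚ.+-assoc 1ℤ (+ n) j)))
    (Γ.trans (^-suc M (+ n + j))
    (Γ.trans (Γ.∙-congˡ (^-+ M (+ n) j)) (Γ.sym (Γ.assoc M _ _))))
  ^-+ M -[1+ zero ] j = ^-pred M j
  ^-+ M -[1+ suc n ] j =
    Γ.trans (Γ.reflexive (cong (M ^_) (ℤₚ.+-assoc -1ℤ -[1+ n ] j)))
    (Γ.trans (^-pred M (-[1+ n ] + j))
    (Γ.trans (Γ.∙-congˡ (^-+ M -[1+ n ] j)) (Γ.sym (Γ.assoc (M ⁻¹) _ _))))

  -- An edge {W}, a ⊗-vertex {W, WS} and a •-vertex {W, WR, WR²} are all
  -- represented by an element W. Since S² = R³ = 1, two such sets coincide as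
  -- soon as one contains the chosen element of the other.
  infix 4 _≈ˢ_ _≈ᴿ_
  _≈ˢ_ _≈ᴿ_ : Carrier → Carrier → Set
  V ≈ˢ W = W ≈ V ⊎ W ≈ V ∙ S
  V ≈ᴿ W = W ≈ V ⊎ W ≈ V ∙ R ⊎ W ≈ V ∙ R ∙ R

  private
    SS : ∀ V → V ∙ S ∙ S ≈ V
    SS V = Γ.trans (Γ.assoc V S S)
      (Γ.trans (Γ.∙-congˡ S²)
               (Γ.identityʳ V))

    RRR : ∀ V → V ∙ R ∙ R ∙ R ≈ V
    RRR V = Γ.trans (Γ.assoc (V ∙ R) R R)
      (Γ.trans (Γ.assoc V R (R ∙ R))
      (Γ.trans (Γ.∙-congˡ R³)
               (Γ.identityʳ V)))

    -- iterated right multiplication by A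
    times : Carrier → Carrier → ℕ → Carrier
    times A V k = fold V (_∙ A) k

    ≈ˢ⇒iterate : ∀ V W → V ≈ˢ W → ∃ λ k → times S V k ≈ W
    ≈ˢ⇒iterate V W (inj₁ e) = 0 , Γ.sym e
    ≈ˢ⇒iterate V W (inj₂ e) = 1 , Γ.sym e

    iterate⇒≈ˢ : ∀ V W k → times S V k ≈ W → V ≈ˢ W
    iterate⇒≈ˢ V W zero          e = inj₁ (Γ.sym e)
    iterate⇒≈ˢ V W (suc zero)    e = inj₂ (Γ.sym e)
    iterate⇒≈ˢ V W (suc (suc k)) e =
      iterate⇒≈ˢ V W k (Γ.trans (Γ.sym (SS (times S V k))) e)

    ≈ᴿ⇒iterate : ∀ V W → V ≈ᴿ W → ∃ λ k → times R V k ≈ W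
    ≈ᴿ⇒iterate V W (inj₁ e)        = 0 , Γ.sym e
    ≈ᴿ⇒iterate V W (inj₂ (inj₁ e)) = 1 , Γ.sym e
    ≈ᴿ⇒iterate V W (inj₂ (inj₂ e)) = 2 , Γ.sym e

    iterate⇒≈ᴿ : ∀ V W k → times R V k ≈ W → V ≈ᴿ W
    iterate⇒≈ᴿ V W zero                e = inj₁ (Γ.sym e)
    iterate⇒≈ᴿ V W (suc zero)          e = inj₂ (inj₁ (Γ.sym e))
    iterate⇒≈ᴿ V W (suc (suc zero))    e = inj₂ (inj₂ (Γ.sym e))
    iterate⇒≈ᴿ V W (suc (suc (suc k))) e =
      iterate⇒≈ᴿ V W k (Γ.trans (Γ.sym (RRR (times R V k))) e)

    ≈ˢ-refl : ∀ {V} → V ≈ˢ V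
    ≈ˢ-refl = inj₁ Γ.refl

    ≈ˢ-sym : ∀ {V W} → V ≈ˢ W → W ≈ˢ V
    ≈ˢ-sym (inj₁ e) = inj₁ (Γ.sym e)
    ≈ˢ-sym {V} {W} (inj₂ e) = inj₂ (Γ.sym (Γ.trans (Γ.∙-congʳ e) (SS V)))

    ≈ˢ-trans : ∀ {U V W} → U ≈ˢ V → V ≈ˢ W → U ≈ˢ W
    ≈ˢ-trans (inj₁ e) (inj₁ f) = inj₁ (Γ.trans f e)
    ≈ˢ-trans (inj₁ e) (inj₂ f) = inj₂ (Γ.trans f (Γ.∙-congʳ e))
    ≈ˢ-trans (inj₂ e) (inj₁ f) = inj₂ (Γ.trans f e)
    ≈ˢ-trans {U} (inj₂ e) (inj₂ f) = inj₁ (Γ.trans f (Γ.trans (Γ.∙-congʳ e) (SS U)))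

    ≈ᴿ-refl : ∀ {V} → V ≈ᴿ V
    ≈ᴿ-refl = inj₁ Γ.refl

    ≈ᴿ-sym : ∀ {V W} → V ≈ᴿ W → W ≈ᴿ V
    ≈ᴿ-sym (inj₁ e) = inj₁ (Γ.sym e)
    ≈ᴿ-sym {V} (inj₂ (inj₁ e)) =
      inj₂ (inj₂ (Γ.sym (Γ.trans (Γ.∙-congʳ (Γ.∙-congʳ e)) (RRR V))))
    ≈ᴿ-sym {V} (inj₂ (inj₂ e)) = inj₂ (inj₁ (Γ.sym (Γ.trans (Γ.∙-congʳ e) (RRR V))))

    ≈ᴿ-trans : ∀ {U V W} → U ≈ᴿ V → V ≈ᴿ W → U ≈ᴿ W
    ≈ᴿ-trans (inj₁ e) (inj₁ f) = inj₁ (Γ.trans f e)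
    ≈ᴿ-trans (inj₁ e) (inj₂ (inj₁ f)) = inj₂ (inj₁ (Γ.trans f (Γ.∙-congʳ e)))
    ≈ᴿ-trans (inj₁ e) (inj₂ (inj₂ f)) =
      inj₂ (inj₂ (Γ.trans f (Γ.∙-congʳ (Γ.∙-congʳ e))))
    ≈ᴿ-trans (inj₂ (inj₁ e)) (inj₁ f) = inj₂ (inj₁ (Γ.trans f e))
    ≈ᴿ-trans (inj₂ (inj₁ e)) (inj₂ (inj₁ f)) =
      inj₂ (inj₂ (Γ.trans f (Γ.∙-congʳ e)))
    ≈ᴿ-trans {U} (inj₂ (inj₁ e)) (inj₂ (inj₂ f)) =
      inj₁ (Γ.trans f (Γ.trans (Γ.∙-congʳ (Γ.∙-congʳ e)) (RRR U)))
    ≈ᴿ-trans (inj₂ (inj₂ e)) (inj₁ f) = inj₂ (inj₂ (Γ.trans f e))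
    ≈ᴿ-trans {U} (inj₂ (inj₂ e)) (inj₂ (inj₁ f)) =
      inj₁ (Γ.trans f (Γ.trans (Γ.∙-congʳ e) (RRR U)))
    ≈ᴿ-trans {U} (inj₂ (inj₂ e)) (inj₂ (inj₂ f)) =
      inj₂ (inj₁ (Γ.trans f (Γ.∙-congʳ (Γ.trans (Γ.∙-congʳ e) (RRR U)))))

    ≈ˢ-left : ∀ A {V W} → V ≈ˢ W → A ∙ V ≈ˢ A ∙ W
    ≈ˢ-left A (inj₁ e) = inj₁ (Γ.∙-congˡ e)
    ≈ˢ-left A {V} (inj₂ e) = inj₂ (Γ.trans (Γ.∙-congˡ e) (Γ.sym (Γ.assoc A V S)))

    ≈ᴿ-left : ∀ A {V W} → V ≈ᴿ W → A ∙ V ≈ᴿ A ∙ W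
    ≈ᴿ-left A (inj₁ e) = inj₁ (Γ.∙-congˡ e)
    ≈ᴿ-left A {V} (inj₂ (inj₁ e)) =
      inj₂ (inj₁ (Γ.trans (Γ.∙-congˡ e) (Γ.sym (Γ.assoc A V R))))
    ≈ᴿ-left A {V} (inj₂ (inj₂ e)) =
      inj₂ (inj₂ (Γ.trans (Γ.∙-congˡ e)
        (Γ.trans (Γ.sym (Γ.assoc A (V ∙ R) R)) (Γ.∙-congʳ (Γ.sym (Γ.assoc A V R))))))

  Farey : RibbonGraph
  Farey = record
    { edge        = Γ.setoid
    ; ⊗-vertex    = record { Carrier = Carrier ; _≈_ = _≈ˢ_ ; isEquivalence = record
        { refl  = λ {V} → ≈ˢ-refl {V}
        ; sym   = λ {V} {W} → ≈ˢ-sym {V} {W}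
        ; trans = λ {U} {V} {W} → ≈ˢ-trans {U} {V} {W} } }
    ; •-vertex    = record { Carrier = Carrier ; _≈_ = _≈ᴿ_ ; isEquivalence = record
        { refl  = λ {V} → ≈ᴿ-refl {V}
        ; sym   = λ {V} {W} → ≈ᴿ-sym {V} {W}
        ; trans = λ {U} {V} {W} → ≈ᴿ-trans {U} {V} {W} } }
    ; ⊗-end-func  = record { to = λ W → W ; cong = λ e → inj₁ (Γ.sym e) }
    ; •-end-func  = record { to = λ W → W ; cong = λ e → inj₁ (Γ.sym e) }
    ; ⊗-next-func = record { to = _∙ S ; cong = Γ.∙-congʳ }
    ; •-next-func = record { to = _∙ R ; cong = Γ.∙-congʳ }
    ; ⊗-cyclic    = λ V W → mk⇔ (≈ˢ⇒iterate V W) (λ (k , e) → iterate⇒≈ˢ V W k e)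
    ; •-cyclic    = λ V W → mk⇔ (≈ᴿ⇒iterate V W) (λ (k , e) → iterate⇒≈ᴿ V W k e)
    }

  module Quotient (M : Carrier) where

    -- ⟨M⟩-orbits of the classes of a relation on Γ
    Orbit : (Carrier → Carrier → Set) → Carrier → Carrier → Set
    Orbit _~_ V W = ∃ λ k → (M ^ k ∙ V) ~ W

    private
      module OrbitEquivalence
        {_~_ : Carrier → Carrier → Set} (eq : IsEquivalence _~_)
        (reflexive : ∀ {V W} → V ≈ W → V ~ W)
        (left : ∀ A {V W} → V ~ W → (A ∙ V) ~ (A ∙ W)) where

        private module E = IsEquivalence eq

        isEquivalence : IsEquivalence (Orbit _~_)
        isEquivalence = record
          { refl  = λ {V} → 0ℤ , reflexive (Γ.identityˡ V)
          ; sym   = λ {V} {W} (k , e) → - k ,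
              E.trans (left (M ^ (- k)) (E.sym e))
                      (reflexive (Γ.trans (Γ.sym (Γ.assoc (M ^ (- k)) (M ^ k) V))
                      (Γ.trans (Γ.∙-congʳ
                        (Γ.trans (Γ.sym (^-+ M (- k) k))
                        (Γ.reflexive (cong (M ^_) (ℤₚ.+-inverseˡ k)))))
                      (Γ.identityˡ V))))
          ; trans = λ {U} {V} {W} (k , e) (l , f) → l + k ,
              E.trans (reflexive (Γ.trans (Γ.∙-congʳ (^-+ M l k))
                                          (Γ.assoc (M ^ l) (M ^ k) U)))
              (E.trans (left (M ^ l) e) f)
          }

      times-left : ∀ A B V k → times B (A ∙ V) k ≈ A ∙ times B V k
      times-left A B V zero    = Γ.refl
      times-left A B V (suc k) =
        Γ.trans (Γ.∙-congʳ (times-left A B V k)) (Γ.assoc A (times B V k) B)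

      ∙ʳ-func : ∀ A {V W} → Orbit _≈_ V W → Orbit _≈_ (V ∙ A) (W ∙ A)
      ∙ʳ-func A {V} (k , e) =
        k , Γ.trans (Γ.sym (Γ.assoc (M ^ k) V A)) (Γ.∙-congʳ e)

      module F = RibbonGraph Farey

      orbit-cyclic : ∀ {_~_ : Carrier → Carrier → Set} A →
        (∀ V W → (V ~ W) ⇔ (∃ λ j → times A V j ≈ W)) → ∀ V W →
        Orbit _~_ V W ⇔ (∃ λ j → Orbit _≈_ (times A V j) W)
      orbit-cyclic A cyc V W = mk⇔
        (λ (k , e) → let (j , f) = Equivalence.to (cyc (M ^ k ∙ V) W) e in
          j , k , Γ.trans (Γ.sym (times-left (M ^ k) A V j)) f)
        (λ (j , k , f) → k , Equivalence.from (cyc (M ^ k ∙ V) W)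
          (j , Γ.trans (times-left (M ^ k) A V j) f))

    quotient : RibbonGraph
    quotient = record
      { edge        = record
          { Carrier = Carrier ; _≈_ = Orbit _≈_
          ; isEquivalence = OrbitEquivalence.isEquivalence Γ.isEquivalence
              (λ e → e) (λ A → Γ.∙-congˡ) }
      ; ⊗-vertex    = record
          { Carrier = Carrier ; _≈_ = Orbit _≈ˢ_
          ; isEquivalence = OrbitEquivalence.isEquivalence
              (Setoid.isEquivalence F.⊗-vertex) F.⊗-end-cong ≈ˢ-left }
      ; •-vertex    = record
          { Carrier = Carrier ; _≈_ = Orbit _≈ᴿ_
          ; isEquivalence = OrbitEquivalence.isEquivalence
              (Setoid.isEquivalence F.•-vertex) F.•-end-cong ≈ᴿ-left }
      ; ⊗-end-func  = record { to = λ W → W ; cong = λ (k , e) → k , F.⊗-end-cong e }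
      ; •-end-func  = record { to = λ W → W ; cong = λ (k , e) → k , F.•-end-cong e }
      ; ⊗-next-func = record { to = _∙ S ; cong = ∙ʳ-func S }
      ; •-next-func = record { to = _∙ R ; cong = ∙ʳ-func R }
      ; ⊗-cyclic    = orbit-cyclic S F.⊗-cyclic
      ; •-cyclic    = orbit-cyclic R F.•-cyclic
      }

------------------------------------------------------------------------
-- PSL₂(ℤ)

record SL₂ℤ : Set where
  no-eta-equality
  pattern
  constructor mat
  field
    p q r s : ℤ
    det     : p * s - q * r ≡ 1ℤ

SameEntries : SL₂ℤ → SL₂ℤ → Set
SameEntries (mat p q r s _) (mat p′ q′ r′ s′ _) =
  p ≡ p′ × q ≡ q′ × r ≡ r′ × s ≡ s′

OppositeEntries : SL₂ℤ → SL₂ℤ → Set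
OppositeEntries (mat p q r s _) (mat p′ q′ r′ s′ _) =
  p ≡ - p′ × q ≡ - q′ × r ≡ - r′ × s ≡ - s′

-- Equality in PSL₂(ℤ): matrices up to sign.
infix 4 _≈_
data _≈_ (M N : SL₂ℤ) : Set where
  same     : SameEntries M N → M ≈ N
  opposite : OppositeEntries M N → M ≈ N

private
  det-∙ : ∀ p q r s p′ q′ r′ s′ →
    (p * p′ + q * r′) * (r * q′ + s * s′) - (p * q′ + q * s′) * (r * p′ + s * r′)
    ≡ (p * s - q * r) * (p′ * s′ - q′ * r′)
  det-∙ = solve-∀

  det-⁻¹ : ∀ p q r s → s * p - (- q) * (- r) ≡ p * s - q * r
  det-⁻¹ = solve-∀

infixl 7 _∙_
_∙_ : SL₂ℤ → SL₂ℤ → SL₂ℤ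
mat p q r s d ∙ mat p′ q′ r′ s′ d′ =
  mat (p * p′ + q * r′) (p * q′ + q * s′) (r * p′ + s * r′) (r * q′ + s * s′)
      (trans (det-∙ p q r s p′ q′ r′ s′) (cong₂ _*_ d d′))

ε : SL₂ℤ
ε = mat 1ℤ 0ℤ 0ℤ 1ℤ refl

infix 8 _⁻¹
_⁻¹ : SL₂ℤ → SL₂ℤ
mat p q r s d ⁻¹ = mat s (- q) (- r) p (trans (det-⁻¹ p q r s) d)

private
  ≈-refl : ∀ {M} → M ≈ M
  ≈-refl {mat _ _ _ _ _} = same (refl , refl , refl , refl)

  ≈-sym : ∀ {M N} → M ≈ N → N ≈ M
  ≈-sym {mat _ _ _ _ _} {mat _ _ _ _ _} (same (refl , refl , refl , refl)) =
    same (refl , refl , refl , refl)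
  ≈-sym {mat _ _ _ _ _} {mat p q r s _} (opposite (refl , refl , refl , refl)) =
    opposite (dn p , dn q , dn r , dn s)
    where dn : ∀ i → i ≡ - - i
          dn i = sym (ℤₚ.neg-involutive i)

  ≈-trans : ∀ {L M N} → L ≈ M → M ≈ N → L ≈ N
  ≈-trans {mat _ _ _ _ _} {mat _ _ _ _ _} {mat _ _ _ _ _}
    (same (refl , refl , refl , refl)) (same y) = same y
  ≈-trans {mat _ _ _ _ _} {mat _ _ _ _ _} {mat _ _ _ _ _}
    (same (refl , refl , refl , refl)) (opposite y) = opposite y
  ≈-trans {mat _ _ _ _ _} {mat _ _ _ _ _} {mat _ _ _ _ _}
    (opposite x) (same (refl , refl , refl , refl)) = opposite x
  ≈-trans {mat _ _ _ _ _} {mat _ _ _ _ _} {mat p q r s _}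
    (opposite (refl , refl , refl , refl)) (opposite (refl , refl , refl , refl)) =
    same (dn p , dn q , dn r , dn s)
    where dn : ∀ i → - - i ≡ i
          dn = ℤₚ.neg-involutive

  ∙-cong : ∀ {M M′ N N′} → M ≈ M′ → N ≈ N′ → M ∙ N ≈ M′ ∙ N′
  ∙-cong {mat _ _ _ _ _} {mat p q r s _} {mat _ _ _ _ _} {mat p′ q′ r′ s′ _}
    (same (refl , refl , refl , refl)) (same (refl , refl , refl , refl)) =
    same (refl , refl , refl , refl)
  ∙-cong {mat _ _ _ _ _} {mat p q r s _} {mat _ _ _ _ _} {mat p′ q′ r′ s′ _}
    (same (refl , refl , refl , refl)) (opposite (refl , refl , refl , refl)) =
    opposite (lem p q p′ r′ , lem p q q′ s′ , lem r s p′ r′ , lem r s q′ s′)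
    where lem : ∀ a b c d → a * - c + b * - d ≡ - (a * c + b * d)
          lem = solve-∀
  ∙-cong {mat _ _ _ _ _} {mat p q r s _} {mat _ _ _ _ _} {mat p′ q′ r′ s′ _}
    (opposite (refl , refl , refl , refl)) (same (refl , refl , refl , refl)) =
    opposite (lem p q p′ r′ , lem p q q′ s′ , lem r s p′ r′ , lem r s q′ s′)
    where lem : ∀ a b c d → - a * c + - b * d ≡ - (a * c + b * d)
          lem = solve-∀
  ∙-cong {mat _ _ _ _ _} {mat p q r s _} {mat _ _ _ _ _} {mat p′ q′ r′ s′ _}
    (opposite (refl , refl , refl , refl)) (opposite (refl , refl , refl , refl)) =
    same (lem p q p′ r′ , lem p q q′ s′ , lem r s p′ r′ , lem r s q′ s′)
    where lem : ∀ a b c d → - a * - c + - b * - d ≡ a * c + b * d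
          lem = solve-∀

  ⁻¹-cong : ∀ {M N} → M ≈ N → M ⁻¹ ≈ N ⁻¹
  ⁻¹-cong {mat _ _ _ _ _} {mat _ _ _ _ _} (same (refl , refl , refl , refl)) =
    same (refl , refl , refl , refl)
  ⁻¹-cong {mat _ _ _ _ _} {mat _ _ _ _ _} (opposite (refl , refl , refl , refl)) =
    opposite (refl , refl , refl , refl)

  ∙-assoc : ∀ L M N → (L ∙ M) ∙ N ≈ L ∙ (M ∙ N)
  ∙-assoc (mat p q r s _) (mat p′ q′ r′ s′ _) (mat p″ q″ r″ s″ _) =
    same ( lem p q p′ q′ r′ s′ p″ r″ , lem p q p′ q′ r′ s′ q″ s″
         , lem r s p′ q′ r′ s′ p″ r″ , lem r s p′ q′ r′ s′ q″ s″ )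
    where lem : ∀ p q p′ q′ r′ s′ x y →
                (p * p′ + q * r′) * x + (p * q′ + q * s′) * y ≡
                p * (p′ * x + q′ * y) + q * (r′ * x + s′ * y)
          lem = solve-∀

  ∙-identityˡ : ∀ M → ε ∙ M ≈ M
  ∙-identityˡ (mat p q r s _) = same (one p r , one q s , two p r , two q s)
    where one : ∀ x y → 1ℤ * x + 0ℤ * y ≡ x
          one = solve-∀
          two : ∀ x y → 0ℤ * x + 1ℤ * y ≡ y
          two = solve-∀

  ∙-identityʳ : ∀ M → M ∙ ε ≈ M
  ∙-identityʳ (mat p q r s _) = same (one p q , two p q , one r s , two r s)
    where one : ∀ x y → x * 1ℤ + y * 0ℤ ≡ x
          one = solve-∀
          two : ∀ x y → x * 0ℤ + y * 1ℤ ≡ y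
          two = solve-∀

  ∙-inverseˡ : ∀ M → M ⁻¹ ∙ M ≈ ε
  ∙-inverseˡ (mat p q r s d) =
    same (trans (e₁ p q r s) d , e₂ s q , e₃ p r , trans (e₄ p q r s) d)
    where e₁ : ∀ p q r s → s * p + (- q) * r ≡ p * s - q * r
          e₁ = solve-∀
          e₂ : ∀ s q → s * q + (- q) * s ≡ 0ℤ
          e₂ = solve-∀
          e₃ : ∀ p r → (- r) * p + p * r ≡ 0ℤ
          e₃ = solve-∀
          e₄ : ∀ p q r s → (- r) * q + p * s ≡ p * s - q * r
          e₄ = solve-∀

  ∙-inverseʳ : ∀ M → M ∙ M ⁻¹ ≈ ε
  ∙-inverseʳ (mat p q r s d) =
    same (trans (e₁ p q r s) d , e₂ p q , e₃ r s , trans (e₄ p q r s) d)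
    where e₁ : ∀ p q r s → p * s + q * (- r) ≡ p * s - q * r
          e₁ = solve-∀
          e₂ : ∀ p q → p * (- q) + q * p ≡ 0ℤ
          e₂ = solve-∀
          e₃ : ∀ r s → r * s + s * (- r) ≡ 0ℤ
          e₃ = solve-∀
          e₄ : ∀ p q r s → r * (- q) + s * p ≡ p * s - q * r
          e₄ = solve-∀

PSL₂ℤ : Group 0ℓ 0ℓ
PSL₂ℤ = record
  { Carrier = SL₂ℤ
  ; _≈_     = _≈_
  ; _∙_     = _∙_
  ; ε       = ε
  ; _⁻¹     = _⁻¹
  ; isGroup = record
    { isMonoid = record
      { isSemigroup = record
        { isMagma = record
          { isEquivalence = record
            { refl  = λ {M} → ≈-refl {M}
            ; sym   = λ {M} {N} → ≈-sym {M} {N}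
            ; trans = λ {L} {M} {N} → ≈-trans {L} {M} {N}
            }
          ; ∙-cong = λ {M} {M′} {N} {N′} → ∙-cong {M} {M′} {N} {N′}
          }
        ; assoc = ∙-assoc
        }
      ; identity = ∙-identityˡ , ∙-identityʳ
      }
    ; inverse = ∙-inverseˡ , ∙-inverseʳ
    ; ⁻¹-cong = λ {M} {N} → ⁻¹-cong {M} {N}
    }
  }

private module P = Group PSL₂ℤ

S R : SL₂ℤ
S = mat 0ℤ -1ℤ 1ℤ 0ℤ refl
R = mat 1ℤ -1ℤ 1ℤ 0ℤ refl

trace : SL₂ℤ → ℤ
trace M = SL₂ℤ.p M + SL₂ℤ.s M

Hyperbolic : SL₂ℤ → Set
Hyperbolic M = ∣ trace M ∣ ℕ.> 2

private
  SS≈ε : S ∙ S ≈ ε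
  SS≈ε = opposite (refl , refl , refl , refl)

  RRR≈ε : R ∙ (R ∙ R) ≈ ε
  RRR≈ε = opposite (refl , refl , refl , refl)

open FareyTree PSL₂ℤ S R SS≈ε RRR≈ε
  using (_^_; ^-+; Farey; module Quotient) public

⟨_⟩\F : SL₂ℤ → RibbonGraph
⟨ M ⟩\F = Quotient.quotient M

------------------------------------------------------------------------
-- Çarks

-- The spine, i.e. the image of the axis of M, is the only circuit of ⟨M⟩\F, so
-- to choose an orientation of it is to give an oriented circuit.
record DirectedÇark : Set where
  field
    M          : SL₂ℤ
    hyperbolic : Hyperbolic M
    spine      : OrientedCircuit ⟨ M ⟩\F

-- The axis of M, oriented in the direction in which M translates it.
record Axis (M : SL₂ℤ) : Set where
  field
    line           : Line Farey
    shift          : ℕ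
    shift>0        : shift ℕ.> 0
  open Line line public
  field
    into-translate : ∀ i → M ∙ into i ≈ into (i + + shift)
    out-translate  : ∀ i → M ∙ out i ≈ out (i + + shift)

-- The spine is the oriented image of the axis. The image in ⟨M⟩\F of the edge
-- represented by W is again represented by W.
DirectedByM : DirectedÇark → Set
DirectedByM ç =
  Σ (Axis M) λ a → ∀ i → (Axis.into a i ≈ᵉ into i) × (Axis.out a i ≈ᵉ out i)
  where
  open DirectedÇark ç
  open OrientedCircuit spine
  open RibbonGraph ⟨ M ⟩\F

data Side : Set where
  left right : Side

module _ {G : RibbonGraph} (c : OrientedCircuit G) where
  open RibbonGraph G
  open OrientedCircuit c

  -- e₁, e₂, e₃ are the edges at a trivalent •-vertex in their cyclic order
  CyclicTriple : Edge → Edge → Edge → Set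
  CyclicTriple e₁ e₂ e₃ = •-next e₁ ≈ᵉ e₂ × •-next e₂ ≈ᵉ e₃ × •-next e₃ ≈ᵉ e₁

  Branch : ℤ → Side → Set
  Branch i left  = ∃ λ b → CyclicTriple (into i) b (out i)
  Branch i right = ∃ λ b → CyclicTriple (into i) (out i) b

-- A cyclic word of the given length, as a periodic function.
record CyclicWord : Set where
  field
    length   : ℕ
    letter   : ℤ → Side
    periodic : ∀ i → letter (i + + length) ≡ letter i

-- w is the k-th power of u: both unroll to the same bi-infinite word.
IsPower : CyclicWord → ℕ → CyclicWord → Set
IsPower w k u =
  (length w ≡ k ℕ.* length u) × (∀ i → letter w i ≡ letter u i)
  where open CyclicWord

Aperiodic : CyclicWord → Set
Aperiodic w = ¬ (∃ λ k → ∃ λ u → k ℕ.≥ 2 × IsPower w k u)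

SpineWord : ∀ {G} → OrientedCircuit G → CyclicWord → Set
SpineWord c w =
  (CyclicWord.length w ≡ OrientedCircuit.size c) ×
  (∀ i → Branch c i (CyclicWord.letter w i))

PrimitiveÇark : DirectedÇark → Set
PrimitiveÇark ç = ∃ λ w → SpineWord (DirectedÇark.spine ç) w × Aperiodic w

infix 4 _≅_
_≅_ : DirectedÇark → DirectedÇark → Set
ç ≅ ç′ = Σ (RibbonIso ⟨ ç.M ⟩\F ⟨ ç′.M ⟩\F) λ φ → Carries φ ç.spine ç′.spine
  where
  module ç = DirectedÇark ç
  module ç′ = DirectedÇark ç′

private
  Carries-id : ∀ {G} (c : OrientedCircuit G) → Carries (idIso G) c c
  Carries-id {G} c = 0ℤ , λ i →
      reflexive (cong into (sym (ℤₚ.+-identityʳ i)))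
    , reflexive (cong out (sym (ℤₚ.+-identityʳ i)))
    where
    open OrientedCircuit c
    open Setoid (RibbonGraph.edge G) using (reflexive)

  Carries-comp : ∀ {G H K} (φ : RibbonIso G H) (ψ : RibbonIso H K) {c d e} →
    Carries φ c d → Carries ψ d e → Carries (compIso φ ψ) c e
  Carries-comp {K = K} φ ψ {e = e} (k , f) (l , g) = k + l , λ i →
      K.trans (cong-ψ (proj₁ (f i))) (K.trans (proj₁ (g (i + k)))
        (K.reflexive (cong into (ℤₚ.+-assoc i k l))))
    , K.trans (cong-ψ (proj₂ (f i))) (K.trans (proj₂ (g (i + k)))
        (K.reflexive (cong out (ℤₚ.+-assoc i k l))))
    where
    module K = Setoid (RibbonGraph.edge K)
    open OrientedCircuit e
    cong-ψ = Inverse.to-cong (RibbonIso.edge-inverse ψ)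

  Carries-sym : ∀ {G H} (φ : RibbonIso G H) {c d} →
    Carries φ c d → Carries (symIso φ) d c
  Carries-sym {G} {H} φ {c} {d} (k , f) = - k , λ i →
      go i c.into d.into (λ j → proj₁ (f j))
    , go i c.out d.out (λ j → proj₂ (f j))
    where
    module c = OrientedCircuit c
    module d = OrientedCircuit d
    module G = Setoid (RibbonGraph.edge G)
    module H = Setoid (RibbonGraph.edge H)
    open Inverse (RibbonIso.edge-inverse φ)
    shift : ∀ i k → i ≡ i + (- k) + k
    shift = solve-∀
    go : ∀ i (x : ℤ → G.Carrier) (y : ℤ → H.Carrier) →
         (∀ j → to (x j) H.≈ y (j + k)) → from (y i) G.≈ x (i + (- k))
    go i x y h = G.trans
      (from-cong (H.trans (H.reflexive (cong y (shift i k)))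
                          (H.sym (h (i + (- k))))))
      (strictlyInverseʳ _)

PrimitiveDirectedÇarks : Setoid 0ℓ 0ℓ
PrimitiveDirectedÇarks = record
  { Carrier       = Σ DirectedÇark PrimitiveÇark
  ; _≈_           = _≅_ on proj₁
  ; isEquivalence = record
    { refl  = λ {(ç , _)} → idIso _ , Carries-id (DirectedÇark.spine ç)
    ; sym   = λ {(ç , _)} {(ç′ , _)} (φ , h) →
        symIso φ , Carries-sym φ {DirectedÇark.spine ç} {DirectedÇark.spine ç′} h
    ; trans = λ {(ç , _)} {(ç′ , _)} {(ç″ , _)} (φ , h) (ψ , h′) →
        compIso φ ψ , Carries-comp φ ψ {DirectedÇark.spine ç} {DirectedÇark.spine ç′}
                        {DirectedÇark.spine ç″} h h′
    }
  }

------------------------------------------------------------------------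
-- Binary quadratic forms

-- A x² + B x y + C y²
record Form : Set where
  no-eta-equality
  pattern
  constructor form
  field
    A B C : ℤ

eval : Form → ℤ → ℤ → ℤ
eval (form A B C) x y = A * x * x + B * x * y + C * y * y

disc : Form → ℤ
disc (form A B C) = B * B - + 4 * A * C

PrimitiveForm : Form → Set
PrimitiveForm (form A B C) = gcd A (gcd B C) ≡ 1ℤ

Indefinite : Form → Set
Indefinite f = disc f ℤ.> 0ℤ

𝒟 : ℤ → Set
𝒟 d = d ℤ.> 0ℤ × (d %ℕ 4 ≡ 0 ⊎ d %ℕ 4 ≡ 1) × ¬ (∃ λ m → d ≡ m * m)

-- The coefficient of t u in f (t x + u x′ , t y + u y′).
polar : Form → ℤ → ℤ → ℤ → ℤ → ℤ
polar (form A B C) x y x′ y′ =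
  + 2 * A * x * x′ + B * (x * y′ + x′ * y) + + 2 * C * y * y′

-- The coefficients of the form (x , y) ↦ f (p x + q y , r x + s y);
-- eval-· confirms that these are the right ones.
infixr 7 _·_
_·_ : SL₂ℤ → Form → Form
mat p q r s _ · f = form (eval f p r) (polar f p r q s) (eval f q s)

eval-· : ∀ p q r s d f x y →
  eval (mat p q r s d · f) x y ≡ eval f (p * x + q * y) (r * x + s * y)
eval-· p q r s _ (form A B C) = lem A B C p q r s
  where
  lem : ∀ A B C p q r s x y →
    (A * p * p + B * p * r + C * r * r) * x * x +
    (+ 2 * A * p * q + B * (p * s + q * r) + + 2 * C * r * s) * x * y +
    (A * q * q + B * q * s + C * s * s) * y * y ≡
    A * (p * x + q * y) * (p * x + q * y) +
    B * (p * x + q * y) * (r * x + s * y) + C * (r * x + s * y) * (r * x + s * y)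
  lem = solve-∀

private
  polar-· : ∀ p q r s d f x y x′ y′ →
    polar (mat p q r s d · f) x y x′ y′ ≡
    polar f (p * x + q * y) (r * x + s * y) (p * x′ + q * y′) (r * x′ + s * y′)
  polar-· p q r s _ (form A B C) = lem A B C p q r s
    where
    lem : ∀ A B C p q r s x y x′ y′ →
      + 2 * (A * p * p + B * p * r + C * r * r) * x * x′ +
      (+ 2 * A * p * q + B * (p * s + q * r) + + 2 * C * r * s) * (x * y′ + x′ * y) +
      + 2 * (A * q * q + B * q * s + C * s * s) * y * y′ ≡
      + 2 * A * (p * x + q * y) * (p * x′ + q * y′) +
      B * ((p * x + q * y) * (r * x′ + s * y′) + (p * x′ + q * y′) * (r * x + s * y)) +
      + 2 * C * (r * x + s * y) * (r * x′ + s * y′)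
    lem = solve-∀

  eval-neg : ∀ f x y → eval f (- x) (- y) ≡ eval f x y
  eval-neg (form A B C) = lem A B C
    where
    lem : ∀ A B C x y → A * - x * - x + B * - x * - y + C * - y * - y ≡
                        A * x * x + B * x * y + C * y * y
    lem = solve-∀

  polar-neg : ∀ f x y x′ y′ → polar f (- x) (- y) (- x′) (- y′) ≡ polar f x y x′ y′
  polar-neg (form A B C) = lem A B C
    where
    lem : ∀ A B C x y x′ y′ →
      + 2 * A * - x * - x′ + B * (- x * - y′ + - x′ * - y) + + 2 * C * - y * - y′ ≡
      + 2 * A * x * x′ + B * (x * y′ + x′ * y) + + 2 * C * y * y′
    lem = solve-∀

  form-≡ : ∀ {A B C A′ B′ C′} → A ≡ A′ → B ≡ B′ → C ≡ C′ →
           form A B C ≡ form A′ B′ C′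
  form-≡ refl refl refl = refl

  cong₄ : ∀ (g : ℤ → ℤ → ℤ → ℤ → ℤ) {a b c d a′ b′ c′ d′} →
          a ≡ a′ → b ≡ b′ → c ≡ c′ → d ≡ d′ → g a b c d ≡ g a′ b′ c′ d′
  cong₄ g refl refl refl refl = refl

·-cong : ∀ {U V} → U ≈ V → ∀ f → U · f ≡ V · f
·-cong {mat p q r s _} {mat p′ q′ r′ s′ _} (same (a , b , c , d)) f =
  form-≡ (cong₂ (eval f) a c) (cong₄ (polar f) a c b d) (cong₂ (eval f) b d)
·-cong {mat p q r s _} {mat p′ q′ r′ s′ _} (opposite (a , b , c , d)) f =
  form-≡ (trans (cong₂ (eval f) a c) (eval-neg f p′ r′))
         (trans (cong₄ (polar f) a c b d) (polar-neg f p′ r′ q′ s′))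
         (trans (cong₂ (eval f) b d) (eval-neg f q′ s′))

private
  ·-ε : ∀ f → ε · f ≡ f
  ·-ε (form A B C) = form-≡ (e₁ A B C) (e₂ A B C) (e₃ A B C)
    where
    e₁ : ∀ A B C → A * 1ℤ * 1ℤ + B * 1ℤ * 0ℤ + C * 0ℤ * 0ℤ ≡ A
    e₁ = solve-∀
    e₂ : ∀ A B C → + 2 * A * 1ℤ * 0ℤ + B * (1ℤ * 1ℤ + 0ℤ * 0ℤ) + + 2 * C * 0ℤ * 1ℤ ≡ B
    e₂ = solve-∀
    e₃ : ∀ A B C → A * 0ℤ * 0ℤ + B * 0ℤ * 1ℤ + C * 1ℤ * 1ℤ ≡ C
    e₃ = solve-∀

  ·-∙ : ∀ U V f → V · U · f ≡ (U ∙ V) · f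
  ·-∙ (mat p q r s d) (mat p′ q′ r′ s′ _) f =
    form-≡ (eval-· p q r s d f p′ r′) (polar-· p q r s d f p′ r′ q′ s′)
           (eval-· p q r s d f q′ s′)

infix 4 _∼_
_∼_ : Form → Form → Set
f ∼ g = ∃ λ U → U · f ≡ g

private
  ∼-refl : ∀ {f} → f ∼ f
  ∼-refl {f} = ε , ·-ε f

  ∼-sym : ∀ {f g} → f ∼ g → g ∼ f
  ∼-sym {f} (U , refl) = U ⁻¹ ,
    trans (·-∙ U (U ⁻¹) f)
    (trans (·-cong {U ∙ U ⁻¹} {ε} (P.inverseʳ U) f) (·-ε f))

  ∼-trans : ∀ {f g h} → f ∼ g → g ∼ h → f ∼ h
  ∼-trans {f} (U , refl) (V , refl) = U ∙ V , sym (·-∙ U V f)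

PrimitiveIndefiniteFormClasses : Setoid 0ℓ 0ℓ
PrimitiveIndefiniteFormClasses = record
  { Carrier       = Σ Form λ f → PrimitiveForm f × Indefinite f × 𝒟 (disc f)
  ; _≈_           = _∼_ on proj₁
  ; isEquivalence = record
    { refl  = λ {(f , _)} → ∼-refl {f}
    ; sym   = λ {(f , _)} {(g , _)} → ∼-sym {f} {g}
    ; trans = λ {(f , _)} {(g , _)} {(h , _)} → ∼-trans {f} {g} {h}
    }
  }

-- gcd (q , s - p , r)
content : SL₂ℤ → ℤ
content (mat p q r s _) = gcd q (gcd (s - p) r)

content-nonZero : ∀ M → Hyperbolic M → ℤ.NonZero (content M)
content-nonZero M@(mat p q r s d) h = ℤ.≢-nonZero λ c≡0 → absurd
  (gcd[i,j]≡0⇒i≡0 q (gcd (s - p) r) c≡0)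
  (gcd[i,j]≡0⇒i≡0 (s - p) r (gcd[i,j]≡0⇒j≡0 {q} {gcd (s - p) r} c≡0))
  where
  s≡p : s - p ≡ 0ℤ → s ≡ p
  s≡p e = ℤₚ.i-j≡0⇒i≡j s p e
  small : ∣ p ∣ ≡ 1 → ¬ (∣ p + p ∣ ℕ.> 2)
  small e g = ℕₚ.<⇒≱ g
    (ℕₚ.≤-trans (ℤₚ.∣i+j∣≤∣i∣+∣j∣ p p) (ℕₚ.≤-reflexive (cong₂ ℕ._+_ e e)))
  unit : q ≡ 0ℤ → s ≡ p → p * p ≡ 1ℤ
  unit refl refl = trans (sym (lem p r)) d
    where lem : ∀ p r → p * p - 0ℤ * r ≡ p * p
          lem = solve-∀
  absurd : q ≡ 0ℤ → s - p ≡ 0ℤ → ⊥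
  absurd q≡0 e = small
    (ℕₚ.m*n≡1⇒m≡1 ∣ p ∣ ∣ p ∣
      (trans (sym (ℤₚ.abs-* p p)) (cong ∣_∣ (unit q≡0 (s≡p e)))))
    (subst (λ x → ∣ p + x ∣ ℕ.> 2) (s≡p e) h)

-- sgn (p + s) / gcd (q , s - p , r) · (r , s - p , - q); the divisions are exact.
formOf : (M : SL₂ℤ) → Hyperbolic M → Form
formOf M h = form (σ * (r ℤ./ content M)) (σ * ((s - p) ℤ./ content M))
                  (σ * ((- q) ℤ./ content M))
  where
  open SL₂ℤ M
  σ = sign (p + s) ◃ 1
  instance _ = content-nonZero M h

{-# OPTIONS --safe #-}
-- Let F be the form of M, so that M · F = F. Sending an edge {V} of the Farey
-- tree to the form V · F is well defined on ⟨M⟩\F. Along the spine consecutive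
-- edges differ by the letters L = R²S and U = RS, so the values of F there are
-- linked by L and U; by periodicity they are, up to one sign, reduced in the
-- sense A > 0 > C: they form Conway's river. The çark is sent to the value at
-- the base point, with the sign that makes it reduced.
--
-- A reduced form f has exactly one reduced successor among L · f and U · f, and
-- one predecessor, so a river is determined by any of its forms; conversely the
-- turns over a period determine the form, as the primitive form fixed by their
-- product. A matrix between reduced forms is, up to sign and inversion, a
-- nonnegative matrix, hence a word in L and U running along the river. Therefore
-- equivalent reduced forms lie on the same river, and if the word of the spine
-- is aperiodic then M generates the stabiliser of F, so that the edges of ⟨M⟩\F
-- are separated by their forms. This gives injectivity. For surjectivity, every
-- form is equivalent to a reduced one, whose river is periodic since there are
-- only finitely many reduced forms of given discriminant; the product of the
-- turns over a minimal period is the required M.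
module Submission where

open import Defs
open import Data.Product.Base using (Σ; _,_; proj₁)
open import Function.Bundles using (Bijection)
open import Algebra.Bundles using (Group)
import Algebra.Properties.Group as GroupProperties
open import Data.Empty using (⊥; ⊥-elim)
open import Data.Fin.Base using (Fin; fromℕ<; combine; toℕ) renaming (zero to fzero; suc to fsuc)
import Data.Fin.Properties as Finₚ
open import Data.Integer.Base as ℤ
  using (ℤ; +_; -[1+_]; 0ℤ; 1ℤ; -1ℤ; _+_; _*_; _-_; -_; ∣_∣; sign; _◃_; _%ℕ_; _/ℕ_; _<_; _≤_; +<+; +≤+)
open import Data.Integer.DivMod using (n%ℕd<d; n%d<d; a≡a%n+[a/n]*n; a≡a%ℕn+[a/ℕn]*n)
import Data.Integer.Divisibility as ℤ∣
import Data.Integer.Divisibility.Signed as Signed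
open import Data.Integer.GCD using (gcd; gcd[i,j]∣i; gcd[i,j]∣j)
import Data.Integer.Properties as ℤₚ
open import Data.Integer.Tactic.RingSolver using (solve-∀)
open import Data.List.Base using (List; []; _∷_; length)
open import Data.Nat.Base as ℕ using (ℕ; zero; suc)
import Data.Nat.Divisibility as ℕ∣
open import Data.Nat.GCD using (module Bézout; gcd-GCD)
open import Data.Nat.GeneralisedArithmetic using (fold)
open import Data.Nat.Induction using (<-rec)
import Data.Nat.Properties as ℕₚ
open import Data.Nat.Tactic.RingSolver using () renaming (solve-∀ to ℕ-solve-∀)
open import Data.Product.Base using (∃; ∃₂; _×_; proj₂)
open import Data.Sum.Base using (_⊎_; inj₁; inj₂)
open import Function.Bundles using (Inverse; Equivalence)
open import Level using (0ℓ)
open import Relation.Binary.Bundles using (Setoid)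
open import Relation.Binary.Structures using (IsEquivalence)
open import Relation.Binary.PropositionalEquality
  using (_≡_; refl; sym; trans; cong; cong₂; subst; setoid)
open import Relation.Nullary using (¬_; Dec; yes; no)
open import Relation.Nullary.Decidable using (_×-dec_; map′; from-no)

-- Ordered ring arithmetic of ℤ

-- Forms take over the role of the geometry of the tree. The circuit of a çark is not identified
-- with the image of the axis; what is used is that the forms along it are reduced. A çark may be
-- oriented against the translation of M, so its form is F only up to sign. An isomorphism of çarks
-- is a map on orbits and supplies no matrix conjugating one M into the other. It is therefore not
-- lifted to the tree: it transports the turns, and the turns give the form back. Conversely an
-- isomorphism has to be built from an equivalence of forms. It is left multiplication by a matrix,
-- and the obstacle is that this must respect the orbits of both groups; here the separation of
-- edges by their forms, and with it aperiodicity, enters.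

>0-resp : ∀ {x y} → x ≡ y → 0ℤ < x → 0ℤ < y
>0-resp = subst (0ℤ <_)

≥0-resp : ∀ {x y} → x ≡ y → 0ℤ ≤ x → 0ℤ ≤ y
≥0-resp = subst (0ℤ ≤_)

infixl 6 _⟨+⟩_ _⟨+⟩₀_
infixl 7 _⟨*⟩_ _⟨*⟩₀_

_⟨+⟩_ : ∀ {x y} → 0ℤ < x → 0ℤ < y → 0ℤ < x + y
_⟨+⟩_ = ℤₚ.+-mono-<

_⟨+⟩₀_ : ∀ {x y} → 0ℤ < x → 0ℤ ≤ y → 0ℤ < x + y
_⟨+⟩₀_ = ℤₚ.+-mono-<-≤

+-≥0 : ∀ {x y} → 0ℤ ≤ x → 0ℤ ≤ y → 0ℤ ≤ x + y
+-≥0 = ℤₚ.+-mono-≤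

_⟨*⟩_ : ∀ {x y} → 0ℤ < x → 0ℤ < y → 0ℤ < x * y
_⟨*⟩_ {+ suc _} {+ suc _} _ _ = +<+ (ℕ.s≤s ℕ.z≤n)
_⟨*⟩_ {+ 0} (+<+ ())
_⟨*⟩_ {+ suc _} {+ 0} _ (+<+ ())

_⟨*⟩₀_ : ∀ {x y} → 0ℤ ≤ x → 0ℤ ≤ y → 0ℤ ≤ x * y
_⟨*⟩₀_ {+ m} {+ n} _ _ = ≥0-resp (ℤₚ.pos-* m n) (+≤+ ℕ.z≤n)

square-≥0 : ∀ x → 0ℤ ≤ x * x
square-≥0 (+ n)    = ≥0-resp (ℤₚ.pos-* n n) (+≤+ ℕ.z≤n)
square-≥0 -[1+ n ] = +≤+ ℕ.z≤n

>0⇒≢0 : ∀ {x} → 0ℤ < x → ¬ x ≡ 0ℤ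
>0⇒≢0 p refl = ℤₚ.<-irrefl refl p

>0∧neg>0 : ∀ {x} → 0ℤ < x → ¬ 0ℤ < - x
>0∧neg>0 {+ 0} (+<+ ())
>0∧neg>0 {+ suc _} _ ()

≥0∧neg>0 : ∀ {x} → 0ℤ ≤ x → ¬ 0ℤ < - x
≥0∧neg>0 {+ 0} _ (+<+ ())
≥0∧neg>0 {+ suc _} _ ()

≤⇒diff≥0 : ∀ {x y} → x ≤ y → 0ℤ ≤ y - x
≤⇒diff≥0 = ℤₚ.i≤j⇒0≤j-i

data Trichotomy (x : ℤ) : Set where
  pos : 0ℤ < x → Trichotomy x
  nul : x ≡ 0ℤ → Trichotomy x
  neg : 0ℤ < - x → Trichotomy x

trichotomy : ∀ x → Trichotomy x
trichotomy (+ 0)     = nul refl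
trichotomy (+ suc _) = pos (+<+ (ℕ.s≤s ℕ.z≤n))
trichotomy -[1+ _ ]  = neg (+<+ (ℕ.s≤s ℕ.z≤n))

>0-cancelˡ : ∀ {x y} → 0ℤ ≤ x → 0ℤ < x * y → 0ℤ < y
>0-cancelˡ {x} {y} h k with trichotomy y
... | pos p    = p
... | nul refl = ⊥-elim (>0⇒≢0 k (ℤₚ.*-zeroʳ x))
... | neg q    = ⊥-elim (≥0∧neg>0 {x * - y} (h ⟨*⟩₀ ℤₚ.<⇒≤ q)
  (>0-resp (lem x y) k))
  where lem : ∀ x y → x * y ≡ - (x * - y)
        lem = solve-∀

*-cancel : ∀ k {i j} → ¬ k ≡ 0ℤ → k * i ≡ k * j → i ≡ j
*-cancel k {i} {j} h = ℤₚ.*-cancelˡ-≡ k i j {{ℤ.≢-nonZero h}}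

ℤ-induction : ∀ {ℓ} (P : ℤ → Set ℓ) → P 0ℤ → (∀ i → P i → P (i + 1ℤ)) →
  (∀ i → P (i + 1ℤ) → P i) → ∀ i → P i
ℤ-induction P base up down = go
  where
  go : ∀ i → P i
  go (+ 0)          = base
  go (+ suc n)      = subst P (ℤₚ.+-comm (+ n) 1ℤ) (up (+ n) (go (+ n)))
  go -[1+ 0 ]       = down -[1+ 0 ] base
  go -[1+ suc n ]   = down -[1+ suc n ] (go -[1+ n ])

-- The group PSL₂(ℤ) and its action on forms

module P = Group PSL₂ℤ
module G = GroupProperties PSL₂ℤ

-- Opaque, as are the ring identities below, because unfolding the proofs found
-- by the ring solver makes type checking very slow.
opaque
  form-cong : ∀ {A B C A′ B′ C′} → A ≡ A′ → B ≡ B′ → C ≡ C′ →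
              form A B C ≡ form A′ B′ C′
  form-cong refl refl refl = refl

form-injective : ∀ {A B C A′ B′ C′} → form A B C ≡ form A′ B′ C′ →
                 A ≡ A′ × B ≡ B′ × C ≡ C′
form-injective refl = refl , refl , refl

·-ε : ∀ f → ε · f ≡ f
·-ε (form A B C) = form-cong (e₁ A B C) (e₂ A B C) (e₃ A B C)
  where
  e₁ : ∀ A B C → A * 1ℤ * 1ℤ + B * 1ℤ * 0ℤ + C * 0ℤ * 0ℤ ≡ A
  e₁ = solve-∀
  e₂ : ∀ A B C → + 2 * A * 1ℤ * 0ℤ + B * (1ℤ * 1ℤ + 0ℤ * 0ℤ) + + 2 * C * 0ℤ * 1ℤ ≡ B
  e₂ = solve-∀
  e₃ : ∀ A B C → A * 0ℤ * 0ℤ + B * 0ℤ * 1ℤ + C * 1ℤ * 1ℤ ≡ C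
  e₃ = solve-∀

·-∙ : ∀ U V f → (U ∙ V) · f ≡ V · U · f
·-∙ (mat p q r s d) (mat p′ q′ r′ s′ _) f@(form A B C) = sym
  (form-cong (eval-· p q r s d f p′ r′) (lem A B C p q r s p′ r′ q′ s′)
             (eval-· p q r s d f q′ s′))
  where
  lem : ∀ A B C p q r s x y x′ y′ →
    + 2 * (A * p * p + B * p * r + C * r * r) * x * x′ +
    (+ 2 * A * p * q + B * (p * s + q * r) + + 2 * C * r * s) * (x * y′ + x′ * y) +
    + 2 * (A * q * q + B * q * s + C * s * s) * y * y′ ≡
    + 2 * A * (p * x + q * y) * (p * x′ + q * y′) +
    B * ((p * x + q * y) * (r * x′ + s * y′) + (p * x′ + q * y′) * (r * x + s * y)) +
    + 2 * C * (r * x + s * y) * (r * x′ + s * y′)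
  lem = solve-∀

·-⁻¹ˡ : ∀ U f → U ⁻¹ · U · f ≡ f
·-⁻¹ˡ U f = trans (sym (·-∙ U (U ⁻¹) f)) (trans (·-cong (P.inverseʳ U) f) (·-ε f))

·-transpose : ∀ U {f g} → U · f ≡ g → U ⁻¹ · g ≡ f
·-transpose U refl = ·-⁻¹ˡ U _

·-fixed-⁻¹ : ∀ {U f} → U · f ≡ f → U ⁻¹ · f ≡ f
·-fixed-⁻¹ {U} = ·-transpose U

·-fixed-^ : ∀ {U f} → U · f ≡ f → ∀ k → (U ^ k) · f ≡ f
·-fixed-^ {U} {f} h (+ 0)        = ·-ε f
·-fixed-^ {U} {f} h (+ suc n)    =
  trans (·-∙ U _ f) (trans (cong (_ ·_) h) (·-fixed-^ h (+ n)))
·-fixed-^ {U} {f} h -[1+ 0 ]     = ·-fixed-⁻¹ h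
·-fixed-^ {U} {f} h -[1+ suc n ] =
  trans (·-∙ (U ⁻¹) _ f) (trans (cong (_ ·_) (·-fixed-⁻¹ h)) (·-fixed-^ h -[1+ n ]))

∼-sym : ∀ {f g} → f ∼ g → g ∼ f
∼-sym (U , e) = U ⁻¹ , ·-transpose U e

∼-trans : ∀ {f g h} → f ∼ g → g ∼ h → f ∼ h
∼-trans {f} (U , refl) (V , refl) = U ∙ V , ·-∙ U V f

scale : ℤ → Form → Form
scale u (form A B C) = form (u * A) (u * B) (u * C)

·-scale : ∀ U u f → U · scale u f ≡ scale u (U · f)
·-scale (mat p q r s _) u (form A B C) =
  form-cong (ev u A B C p r) (pl u A B C p q r s) (ev u A B C q s)
  where
  ev : ∀ u A B C x y → u * A * x * x + u * B * x * y + u * C * y * y ≡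
                       u * (A * x * x + B * x * y + C * y * y)
  ev = solve-∀
  pl : ∀ u A B C p q r s →
    + 2 * (u * A) * p * q + u * B * (p * s + q * r) + + 2 * (u * C) * r * s ≡
    u * (+ 2 * A * p * q + B * (p * s + q * r) + + 2 * C * r * s)
  pl = solve-∀

scale-scale : ∀ u v f → scale u (scale v f) ≡ scale (u * v) f
scale-scale u v (form A B C) = form-cong (lem u v A) (lem u v B) (lem u v C)
  where lem : ∀ u v a → u * (v * a) ≡ u * v * a
        lem = solve-∀

scale-1 : ∀ f → scale 1ℤ f ≡ f
scale-1 (form A B C) =
  form-cong (ℤₚ.*-identityˡ A) (ℤₚ.*-identityˡ B) (ℤₚ.*-identityˡ C)

scale-cancel : ∀ u {f g} → ¬ u ≡ 0ℤ → scale u f ≡ scale u g → f ≡ g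
scale-cancel u {form _ _ _} {form _ _ _} h e with form-injective e
... | a , b , c = form-cong (*-cancel u h a) (*-cancel u h b) (*-cancel u h c)

disc-· : ∀ U f → disc (U · f) ≡ disc f
disc-· (mat p q r s d) (form A B C) =
  trans (lem A B C p q r s)
  (trans (cong (λ x → x * x * (B * B - + 4 * A * C)) d) (ℤₚ.*-identityˡ _))
  where
  opaque
    lem : ∀ A B C p q r s →
      (+ 2 * A * p * q + B * (p * s + q * r) + + 2 * C * r * s) *
      (+ 2 * A * p * q + B * (p * s + q * r) + + 2 * C * r * s) -
      + 4 * (A * p * p + B * p * r + C * r * r) * (A * q * q + B * q * s + C * s * s) ≡
      (p * s - q * r) * (p * s - q * r) * (B * B - + 4 * A * C)
    lem = solve-∀

disc-scale : ∀ u f → disc (scale u f) ≡ u * u * disc f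
disc-scale u (form A B C) = lem u A B C
  where
  opaque
    lem : ∀ u A B C → u * B * (u * B) - + 4 * (u * A) * (u * C) ≡
                      u * u * (B * B - + 4 * A * C)
    lem = solve-∀

-- Unimodular forms: primitivity in Bézout form

∣∣-multiple : ∀ i → ∃ λ a → a * i ≡ + ∣ i ∣
∣∣-multiple (+ n)    = 1ℤ , ℤₚ.*-identityˡ (+ n)
∣∣-multiple -[1+ n ] = -1ℤ , ℤₚ.-1*i≡-i -[1+ n ]

bézout : ∀ i j → ∃₂ λ x y → x * i + y * j ≡ gcd i j
bézout i j with ∣∣-multiple i | ∣∣-multiple j | Bézout.identity (gcd-GCD ∣ i ∣ ∣ j ∣)
... | a , α | b , β | Bézout.+- x y eq = + x * a , - + y * b ,
  trans (lem₁ (+ x) a i (+ y) b j) (trans (cong₂ (λ m n → + x * m - + y * n) α β)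
    (trans (cong (_- + y * + ∣ j ∣) eq′) (lem₂ (gcd i j) (+ y) (+ ∣ j ∣))))
  where
  opaque
    lem₁ : ∀ x a i y b j → x * a * i + - y * b * j ≡ x * (a * i) - y * (b * j)
    lem₁ = solve-∀
    lem₂ : ∀ d y n → d + y * n - y * n ≡ d
    lem₂ = solve-∀
  eq′ : + x * + ∣ i ∣ ≡ gcd i j + + y * + ∣ j ∣
  eq′ = trans (sym (ℤₚ.pos-* x _)) (trans (cong +_ (sym eq))
          (cong (λ w → gcd i j + w) (ℤₚ.pos-* y _)))
... | a , α | b , β | Bézout.-+ x y eq = - + x * a , + y * b ,
  trans (lem₁ (+ x) a i (+ y) b j) (trans (cong₂ (λ m n → + y * n - + x * m) α β)
    (trans (cong (_- + x * + ∣ i ∣) eq′) (lem₂ (gcd i j) (+ x) (+ ∣ i ∣))))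
  where
  opaque
    lem₁ : ∀ x a i y b j → - x * a * i + y * b * j ≡ y * (b * j) - x * (a * i)
    lem₁ = solve-∀
    lem₂ : ∀ d y n → d + y * n - y * n ≡ d
    lem₂ = solve-∀
  eq′ : + y * + ∣ j ∣ ≡ gcd i j + + x * + ∣ i ∣
  eq′ = trans (sym (ℤₚ.pos-* y _)) (trans (cong +_ (sym eq))
          (cong (λ w → gcd i j + w) (ℤₚ.pos-* x _)))

bézout₃ : ∀ i j k → ∃ λ x → ∃ λ y → ∃ λ z → x * i + y * j + z * k ≡ gcd i (gcd j k)
bézout₃ i j k =
  let (x , y , e) = bézout i (gcd j k) ; (y′ , z′ , e′) = bézout j k in
  x , y * y′ , y * z′ ,
  trans (lem x y y′ z′ i j k) (trans (cong (λ g → x * i + y * g) e′) e)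
  where
  opaque
    lem : ∀ x y y′ z′ i j k → x * i + y * y′ * j + y * z′ * k ≡ x * i + y * (y′ * j + z′ * k)
    lem = solve-∀

Unimodular : Form → Set
Unimodular (form A B C) = ∃ λ x → ∃ λ y → ∃ λ z → x * A + y * B + z * C ≡ 1ℤ

primitive⇒unimodular : ∀ f → PrimitiveForm f → Unimodular f
primitive⇒unimodular (form A B C) h =
  let (x , y , z , e) = bézout₃ A B C in x , y , z , trans e h

unimodular⇒primitive : ∀ f → Unimodular f → PrimitiveForm f
unimodular⇒primitive (form A B C) (x , y , z , e) =
  cong +_ (ℕ∣.∣1⇒≡1 (Signed.∣⇒∣ᵤ (subst (g Signed.∣_) e
    (Signed.∣m∣n⇒∣m+n (Signed.∣m∣n⇒∣m+n (Signed.∣n⇒∣m*n x g∣A) (Signed.∣n⇒∣m*n y g∣B))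
      (Signed.∣n⇒∣m*n z g∣C)))))
  where
  g = gcd A (gcd B C)
  g∣A : g Signed.∣ A
  g∣A = Signed.∣ᵤ⇒∣ (gcd[i,j]∣i A (gcd B C))
  g∣h : g Signed.∣ gcd B C
  g∣h = Signed.∣ᵤ⇒∣ (gcd[i,j]∣j A (gcd B C))
  g∣B : g Signed.∣ B
  g∣B = Signed.∣-trans g∣h (Signed.∣ᵤ⇒∣ (gcd[i,j]∣i B C))
  g∣C : g Signed.∣ C
  g∣C = Signed.∣-trans g∣h (Signed.∣ᵤ⇒∣ (gcd[i,j]∣j B C))

-- The coefficients of `U · f` are integral combinations of those of `f`, so Bézout coefficients
-- transform by the transpose of the symmetric square of `U`.
unimodular-pullback : ∀ U f → Unimodular (U · f) → Unimodular f
unimodular-pullback (mat p q r s _) (form A B C) (x , y , z , e) =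
  x * p * p + + 2 * y * p * q + z * q * q ,
  x * p * r + y * (p * s + q * r) + z * q * s ,
  x * r * r + + 2 * y * r * s + z * s * s ,
  trans (lem A B C p q r s x y z) e
  where
  opaque
    lem : ∀ A B C p q r s x y z →
      (x * p * p + + 2 * y * p * q + z * q * q) * A +
      (x * p * r + y * (p * s + q * r) + z * q * s) * B +
      (x * r * r + + 2 * y * r * s + z * s * s) * C ≡
      x * (A * p * p + B * p * r + C * r * r) +
      y * (+ 2 * A * p * q + B * (p * s + q * r) + + 2 * C * r * s) +
      z * (A * q * q + B * q * s + C * s * s)
    lem = solve-∀

unimodular-· : ∀ U f → Unimodular f → Unimodular (U · f)
unimodular-· U f h = unimodular-pullback (U ⁻¹) (U · f) (subst Unimodular (sym (·-⁻¹ˡ U f)) h)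

-- The three equations are vanishing 2 × 2 minors. Pairing (x, y, z) with the Bézout coefficients of
-- (a, b, c) gives the integral factor without any division.
parallel : ∀ {a b c x y z} → Unimodular (form a b c) →
  a * y ≡ b * x → a * z ≡ c * x → b * z ≡ c * y →
  ∃ λ u → form x y z ≡ scale u (form a b c)
parallel {a} {b} {c} {x} {y} {z} (l , m , n , e) ay az bz =
  l * x + m * y + n * z , form-cong
    (go a x refl ay az)
    (go b y (sym ay) refl bz)
    (go c z (sym az) (sym bz) refl)
  where
  opaque
    lem₁ : ∀ l m n x y z a → (l * x + m * y + n * z) * a ≡ l * (a * x) + m * (a * y) + n * (a * z)
    lem₁ = solve-∀
    lem₂ : ∀ l m n a b c x → l * (a * x) + m * (b * x) + n * (c * x) ≡ (l * a + m * b + n * c) * x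
    lem₂ = solve-∀
    lem₃ : ∀ l m n a b c x → l * a + m * b + n * c ≡ 1ℤ →
           l * (a * x) + m * (b * x) + n * (c * x) ≡ x
    lem₃ l m n a b c x e = trans (lem₂ l m n a b c x) (trans (cong (_* x) e) (ℤₚ.*-identityˡ x))
    go : ∀ a′ x′ → a′ * x ≡ a * x′ → a′ * y ≡ b * x′ → a′ * z ≡ c * x′ →
         x′ ≡ (l * x + m * y + n * z) * a′
    go a′ x′ p q r = sym (trans (lem₁ l m n x y z a′)
      (trans (cong₂ _+_ (cong₂ _+_ (cong (l *_) p) (cong (m *_) q)) (cong (n *_) r))
             (lem₃ l m n a b c x′ e)))

-- Multiplying the Bézout relation of f by u and substituting u f = v g shows that v divides u. By
-- symmetry u divides v, and positivity gives u = v.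
proportional-unimodular-≡ : ∀ {u v f g} → Unimodular f → Unimodular g →
  0ℤ < u → 0ℤ < v → scale u f ≡ scale v g → f ≡ g
proportional-unimodular-≡ {u} {v} {form a b c} {form a′ b′ c′} (x , y , z , e) (x′ , y′ , z′ , e′) hu hv eq =
  scale-cancel u (>0⇒≢0 hu) (trans eq (cong (λ w → scale w (form a′ b′ c′)) (sym u≡v)))
  where
  opaque
    divides : ∀ {u v x y z a b c a′ b′ c′} → x * a + y * b + z * c ≡ 1ℤ →
      u * a ≡ v * a′ → u * b ≡ v * b′ → u * c ≡ v * c′ → v Signed.∣ u
    divides {u} {v} {x} {y} {z} {a} {b} {c} {a′} {b′} {c′} e ea eb ec =
      Signed.divides (x * a′ + y * b′ + z * c′)
        (trans (sym (trans (cong (u *_) e) (ℤₚ.*-identityʳ u)))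
        (trans (lem u x y z a b c)
        (trans (cong₂ _+_ (cong₂ _+_ (cong (x *_) ea) (cong (y *_) eb)) (cong (z *_) ec))
               (lem′ v x y z a′ b′ c′))))
      where
      opaque
        lem : ∀ u x y z a b c → u * (x * a + y * b + z * c) ≡ x * (u * a) + y * (u * b) + z * (u * c)
        lem = solve-∀
        lem′ : ∀ v x y z a b c → x * (v * a) + y * (v * b) + z * (v * c) ≡ (x * a + y * b + z * c) * v
        lem′ = solve-∀
  abs-≡ : ∀ {u v} → 0ℤ < u → 0ℤ < v → ∣ u ∣ ≡ ∣ v ∣ → u ≡ v
  abs-≡ {+ _} {+ _} _ _ e = cong +_ e
  u≡v : u ≡ v
  u≡v = let (ea , eb , ec) = form-injective eq in abs-≡ hu hv (ℕ∣.∣-antisym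
    (Signed.∣⇒∣ᵤ (divides {v} {u} {x′} {y′} {z′} {a′} {b′} {c′} {a} {b} {c} e′ (sym ea) (sym eb) (sym ec)))
    (Signed.∣⇒∣ᵤ (divides {u} {v} {x} {y} {z} {a} {b} {c} {a′} {b′} {c′} e ea eb ec)))

-- The form of a matrix

-- Its value at a vector v is det(v, Mv). This explains its invariance under M and its behaviour
-- under conjugation; its roots are the fixed points of M.
vec : SL₂ℤ → Form
vec (mat p q r s _) = form r (s - p) (- q)

·-vec : ∀ M → M · vec M ≡ vec M
·-vec (mat p q r s d) = form-cong
  (trans (e₁ p q r s) (scaled r))
  (trans (e₂ p q r s) (scaled (s - p)))
  (trans (e₃ p q r s) (scaled (- q)))
  where
  scaled : ∀ x → (p * s - q * r) * x ≡ x
  scaled x = trans (cong (_* x) d) (ℤₚ.*-identityˡ x)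
  opaque
    e₁ : ∀ p q r s → r * p * p + (s - p) * p * r + - q * r * r ≡ (p * s - q * r) * r
    e₁ = solve-∀
    e₂ : ∀ p q r s → + 2 * r * p * q + (s - p) * (p * s + q * r) + + 2 * - q * r * s ≡
                     (p * s - q * r) * (s - p)
    e₂ = solve-∀
    e₃ : ∀ p q r s → r * q * q + (s - p) * q * s + - q * s * s ≡ (p * s - q * r) * - q
    e₃ = solve-∀

vec-conj : ∀ V N → vec (V ⁻¹ ∙ (N ∙ V)) ≡ V · vec N
vec-conj (mat p q r s _) (mat p′ q′ r′ s′ _) = form-cong
  (e₁ p r p′ q′ r′ s′) (e₂ p q r s p′ q′ r′ s′) (e₃ q s p′ q′ r′ s′)
  where
  opaque
    e₁ : ∀ p r p′ q′ r′ s′ →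
      - r * (p′ * p + q′ * r) + p * (r′ * p + s′ * r) ≡
      r′ * p * p + (s′ - p′) * p * r + - q′ * r * r
    e₁ = solve-∀
    e₂ : ∀ p q r s p′ q′ r′ s′ →
      - r * (p′ * q + q′ * s) + p * (r′ * q + s′ * s) -
      (s * (p′ * p + q′ * r) + - q * (r′ * p + s′ * r)) ≡
      + 2 * r′ * p * q + (s′ - p′) * (p * s + q * r) + + 2 * - q′ * r * s
    e₂ = solve-∀
    e₃ : ∀ q s p′ q′ r′ s′ →
      - (s * (p′ * q + q′ * s) + - q * (r′ * q + s′ * s)) ≡
      r′ * q * q + (s′ - p′) * q * s + - q′ * s * s
    e₃ = solve-∀

trace-conj : ∀ V N → trace (V ⁻¹ ∙ (N ∙ V)) ≡ trace N
trace-conj (mat p q r s d) (mat p′ q′ r′ s′ _) =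
  trans (lem p q r s p′ q′ r′ s′) (trans (cong (_* (p′ + s′)) d) (ℤₚ.*-identityˡ _))
  where
  opaque
    lem : ∀ p q r s p′ q′ r′ s′ →
      s * (p′ * p + q′ * r) + - q * (r′ * p + s′ * r) +
      (- r * (p′ * q + q′ * s) + p * (r′ * q + s′ * s)) ≡ (p * s - q * r) * (p′ + s′)
    lem = solve-∀

-- XᵀQX = Q and det X = 1 give QX = X⁻ᵀQ for the Gram matrix Q of f, which is
-- linear in the entries of X.
·-fixed⇒vec : ∀ X f → Unimodular f → X · f ≡ f → ∃ λ u → vec X ≡ scale u f
·-fixed⇒vec (mat p q r s d) (form a b c) h e = let (e₁ , e₂ , e₃) = form-injective e in parallel h
  (halve (k₁ a b c p q r s (sym e₁) (sym e₂) d) (t₁ a b p r s))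
  (halve (k₂ a b c p q r s (sym e₂) (sym e₃) d) (t₂ a b c q r s))
  (halve (k₃ a b c p q r s (sym e₂) (sym e₃) d) (t₃ b c p q s))
  where
  halve : ∀ {x y A B} → x ≡ y → + 2 * A ≡ x - y + + 2 * B → A ≡ B
  halve {x} refl k = *-cancel (+ 2) (λ ())
    (trans k (trans (cong (_+ _) (ℤₚ.+-inverseʳ x)) (ℤₚ.+-identityˡ _)))
  unit : ∀ {D x y} → x ≡ D * y → D ≡ 1ℤ → x ≡ y
  unit {_} {_} {y} k refl = trans k (ℤₚ.*-identityˡ y)
  opaque
    i₁ : ∀ a b c p q r s →
      + 2 * s * (a * p * p + b * p * r + c * r * r) -
      r * (+ 2 * a * p * q + b * (p * s + q * r) + + 2 * c * r * s) ≡
      (p * s - q * r) * (+ 2 * a * p + b * r)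
    i₁ = solve-∀
    i₂ : ∀ a b c p q r s →
      s * (+ 2 * a * p * q + b * (p * s + q * r) + + 2 * c * r * s) -
      + 2 * r * (a * q * q + b * q * s + c * s * s) ≡
      (p * s - q * r) * (+ 2 * a * q + b * s)
    i₂ = solve-∀
    i₃ : ∀ a b c p q r s →
      + 2 * p * (a * q * q + b * q * s + c * s * s) -
      q * (+ 2 * a * p * q + b * (p * s + q * r) + + 2 * c * r * s) ≡
      (p * s - q * r) * (b * q + + 2 * c * s)
    i₃ = solve-∀
  k₁ : ∀ a b c p q r s {α β} → α ≡ a * p * p + b * p * r + c * r * r →
    β ≡ + 2 * a * p * q + b * (p * s + q * r) + + 2 * c * r * s → p * s - q * r ≡ 1ℤ →
    + 2 * s * α - r * β ≡ + 2 * a * p + b * r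
  k₁ a b c p q r s refl refl = unit (i₁ a b c p q r s)
  k₂ : ∀ a b c p q r s {β γ} →
    β ≡ + 2 * a * p * q + b * (p * s + q * r) + + 2 * c * r * s →
    γ ≡ a * q * q + b * q * s + c * s * s → p * s - q * r ≡ 1ℤ →
    s * β - + 2 * r * γ ≡ + 2 * a * q + b * s
  k₂ a b c p q r s refl refl = unit (i₂ a b c p q r s)
  k₃ : ∀ a b c p q r s {β γ} →
    β ≡ + 2 * a * p * q + b * (p * s + q * r) + + 2 * c * r * s →
    γ ≡ a * q * q + b * q * s + c * s * s → p * s - q * r ≡ 1ℤ →
    + 2 * p * γ - q * β ≡ b * q + + 2 * c * s
  k₃ a b c p q r s refl refl = unit (i₃ a b c p q r s)
  opaque
    t₁ : ∀ a b p r s → + 2 * (a * (s - p)) ≡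
      + 2 * s * a - r * b - (+ 2 * a * p + b * r) + + 2 * (b * r)
    t₁ = solve-∀
    t₂ : ∀ a b c q r s → + 2 * (a * - q) ≡
      s * b - + 2 * r * c - (+ 2 * a * q + b * s) + + 2 * (c * r)
    t₂ = solve-∀
    t₃ : ∀ b c p q s → + 2 * (b * - q) ≡
      + 2 * p * c - q * b - (b * q + + 2 * c * s) + + 2 * (c * (s - p))
    t₃ = solve-∀

scale-fixed : ∀ {M F u} → ¬ u ≡ 0ℤ → vec M ≡ scale u F → M · F ≡ F
scale-fixed {M} {F} {u} h e = scale-cancel u h
  (trans (sym (·-scale M u F)) (trans (cong (M ·_) (sym e)) (trans (·-vec M) e)))

-- N fixes f with positive multiplier: up to sign N = pI + uK with u and the
-- trace of the same sign, where K is the matrix with vec K = f and corner 0.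
Translates : Form → SL₂ℤ → Set
Translates f N = ∃ λ u → (vec N ≡ scale u f) × 0ℤ < trace N * u

translates-resp : ∀ {f M N} → M ≈ N → Translates f M → Translates f N
translates-resp {f} {mat _ _ _ _ _} {mat _ _ _ _ _} (same (refl , refl , refl , refl)) (u , e , h) = u , e , h
translates-resp {f@(form a b c)} {mat _ _ _ _ _} {mat p q r s _} (opposite (refl , refl , refl , refl)) (u , e , h)
  = let (e₁ , e₂ , e₃) = form-injective e in - u ,
  form-cong (trans (l₁ r) (trans (cong -_ e₁) (ℤₚ.neg-distribˡ-* u a)))
            (trans (l₂ s p) (trans (cong -_ e₂) (ℤₚ.neg-distribˡ-* u b)))
            (trans (l₁ (- q)) (trans (cong -_ e₃) (ℤₚ.neg-distribˡ-* u c))) ,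
  >0-resp (lem p s u) h
  where
  opaque
    l₁ : ∀ r → r ≡ - - r
    l₁ = solve-∀
    l₂ : ∀ s p → s - p ≡ - (- s - - p)
    l₂ = solve-∀
    lem : ∀ p s u → (- p + - s) * u ≡ (p + s) * - u
    lem = solve-∀

translates-conj : ∀ {f N} V → Translates f N → Translates (V · f) (V ⁻¹ ∙ (N ∙ V))
translates-conj {f} {N} V (u , e , h) = u ,
  trans (vec-conj V N) (trans (cong (V ·_) e) (·-scale V u f)) ,
  >0-resp (cong (_* u) (sym (trace-conj V N))) h

-- Forms of positive non-square discriminant

-- A nonsquare discriminant means that there is no nontrivial rational zero. This is used through
-- the outer coefficients, the values at (1, 0) and (0, 1), which stay nonzero under every change of
-- variables.
record Anisotropic (f : Form) : Set where
  field
    unimodular : Unimodular f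
    disc>0     : 0ℤ < disc f
    nonsquare  : ¬ (∃ λ m → disc f ≡ m * m)

anisotropic-· : ∀ U f → Anisotropic f → Anisotropic (U · f)
anisotropic-· U f h = record
  { unimodular = unimodular-· U f (Anisotropic.unimodular h)
  ; disc>0     = >0-resp (sym (disc-· U f)) (Anisotropic.disc>0 h)
  ; nonsquare  = λ (m , e) → Anisotropic.nonsquare h (m , trans (sym (disc-· U f)) e)
  }

anisotropic-neg : ∀ f → Anisotropic f → Anisotropic (scale -1ℤ f)
anisotropic-neg f@(form a b c) h = record
  { unimodular = let (x , y , z , e) = Anisotropic.unimodular h in - x , - y , - z , trans (lem a b c x y z) e
  ; disc>0     = >0-resp (sym eq) (Anisotropic.disc>0 h)
  ; nonsquare  = λ (m , e) → Anisotropic.nonsquare h (m , trans (sym eq) e)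
  }
  where
  eq : disc (scale -1ℤ f) ≡ disc f
  eq = trans (disc-scale -1ℤ f) (ℤₚ.*-identityˡ _)
  opaque
    lem : ∀ a b c x y z → - x * (-1ℤ * a) + - y * (-1ℤ * b) + - z * (-1ℤ * c) ≡ x * a + y * b + z * c
    lem = solve-∀

anisotropic-A≢0 : ∀ {a b c} → Anisotropic (form a b c) → ¬ a ≡ 0ℤ
anisotropic-A≢0 {_} {b} {c} h refl = Anisotropic.nonsquare h (b , lem b c)
  where
  opaque
    lem : ∀ b c → b * b - + 4 * 0ℤ * c ≡ b * b
    lem = solve-∀

anisotropic-C≢0 : ∀ {a b c} → Anisotropic (form a b c) → ¬ c ≡ 0ℤ
anisotropic-C≢0 {a} {b} h refl = Anisotropic.nonsquare h (b , lem a b)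
  where
  opaque
    lem : ∀ a b → b * b - + 4 * a * 0ℤ ≡ b * b
    lem = solve-∀

-- Words in the generators of the positive monoid

-- The edges after a left or a right turn: R² S and R S in PSL₂(ℤ).
letter : Side → SL₂ℤ
letter left  = mat 1ℤ 0ℤ 1ℤ 1ℤ refl
letter right = mat 1ℤ 1ℤ 0ℤ 1ℤ refl

word : List Side → SL₂ℤ
word []       = ε
word (x ∷ xs) = letter x ∙ word xs

Nonneg : SL₂ℤ → Set
Nonneg (mat p q r s _) = 0ℤ < p × 0ℤ ≤ q × 0ℤ ≤ r × 0ℤ < s

opaque
  first-row : ∀ x y → x ≡ 1ℤ * x + 0ℤ * y
  first-row = solve-∀
  second-row : ∀ x y → y ≡ 0ℤ * x + 1ℤ * y
  second-row = solve-∀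
  row-sum : ∀ x y → x + y ≡ 1ℤ * x + 1ℤ * y
  row-sum = solve-∀

nonneg-letter : ∀ x M → Nonneg M → Nonneg (letter x ∙ M)
nonneg-letter left (mat p q r s _) (hp , hq , hr , hs) =
  >0-resp (first-row p r) hp , ≥0-resp (first-row q s) hq ,
  ≥0-resp (row-sum p r) (+-≥0 (ℤₚ.<⇒≤ hp) hr) ,
  >0-resp (trans (ℤₚ.+-comm s q) (row-sum q s)) (hs ⟨+⟩₀ hq)
nonneg-letter right (mat p q r s _) (hp , hq , hr , hs) =
  >0-resp (row-sum p r) (hp ⟨+⟩₀ hr) , ≥0-resp (row-sum q s) (+-≥0 hq (ℤₚ.<⇒≤ hs)) ,
  ≥0-resp (second-row p r) hr , >0-resp (second-row q s) hs

nonneg-word : ∀ xs → Nonneg (word xs)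
nonneg-word []       = +<+ (ℕ.s≤s ℕ.z≤n) , ℤₚ.≤-refl , ℤₚ.≤-refl , +<+ (ℕ.s≤s ℕ.z≤n)
nonneg-word (x ∷ xs) = nonneg-letter x (word xs) (nonneg-word xs)

nonneg-trace>0 : ∀ M → Nonneg M → 0ℤ < trace M
nonneg-trace>0 (mat _ _ _ _ _) (hp , _ , _ , hs) = hp ⟨+⟩ hs

-- q + r is the difference of the outer coefficients of `vec`. It vanishes for the identity and is
-- positive for nonempty words, which fixes the sign of the factor between `vec` and a reduced form.
OffDiagonal>0 : SL₂ℤ → Set
OffDiagonal>0 (mat p q r s _) = 0ℤ < q + r

letter-offDiagonal>0 : ∀ x M → Nonneg M → OffDiagonal>0 (letter x ∙ M)
letter-offDiagonal>0 left (mat p q r s _) (hp , hq , hr , hs) =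
  >0-resp (trans (cong₂ _+_ (row-sum p r) (first-row q s))
    (ℤₚ.+-comm (1ℤ * p + 1ℤ * r) (1ℤ * q + 0ℤ * s))) (hp ⟨+⟩₀ hr ⟨+⟩₀ hq)
letter-offDiagonal>0 right (mat p q r s _) (hp , hq , hr , hs) =
  >0-resp (cong₂ _+_ (trans (ℤₚ.+-comm s q) (row-sum q s)) (second-row p r))
    (hs ⟨+⟩₀ hq ⟨+⟩₀ hr)

word-offDiagonal>0 : ∀ x xs → OffDiagonal>0 (word (x ∷ xs))
word-offDiagonal>0 x xs = letter-offDiagonal>0 x (word xs) (nonneg-word xs)

>0⇒pred≥0 : ∀ {x} → 0ℤ < x → 0ℤ ≤ x - 1ℤ
>0⇒pred≥0 {x} h = ≤⇒diff≥0 {1ℤ} {x} (ℤₚ.i<j⇒suc[i]≤j h)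

diff>0 : ∀ {x y} → x < y → 0ℤ < y - x
diff>0 {x} {y} h = >0-resp (ℤₚ.+-comm (- x) y)
  (subst (_< - x + y) (ℤₚ.+-inverseˡ x) (ℤₚ.+-monoʳ-< (- x) h))

sum≡0⇒≡0 : ∀ {x y} → 0ℤ ≤ x → 0ℤ ≤ y → x + y ≡ 0ℤ → x ≡ 0ℤ × y ≡ 0ℤ
sum≡0⇒≡0 {+ 0} {+ 0} _ _ _ = refl , refl

≤⊎> : ∀ x y → x ≤ y ⊎ y < x
≤⊎> x y with x ℤₚ.≤? y
... | yes p = inj₁ p
... | no ¬p = inj₂ (ℤₚ.≰⇒> ¬p)

private
  -- The measure for Euclid's algorithm on the rows: removing a letter subtracts one row from the
  -- other.
  entrySum : SL₂ℤ → ℤ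
  entrySum (mat p q r s _) = p + q + r + s

  unletter : Side → SL₂ℤ → SL₂ℤ
  unletter x M = letter x ⁻¹ ∙ M

  relettered : ∀ x M → letter x ∙ unletter x M ≈ M
  relettered x M = P.trans (P.sym (P.assoc (letter x) (letter x ⁻¹) M))
    (P.trans (P.∙-congʳ (P.inverseʳ (letter x))) (P.identityˡ M))

  peelLeft : ∀ {p q r s d} → Nonneg (mat p q r s d) → p ≤ r → q < s →
    Nonneg (unletter left (mat p q r s d))
  peelLeft {p} {q} {r} {s} (hp , hq , hr , hs) h k =
    >0-resp (e₁ p r) hp , ≥0-resp (e₁ q s) hq ,
    ≥0-resp (e₂ p r) (≤⇒diff≥0 h) , >0-resp (e₂ q s) (diff>0 k)
    where
    opaque
      e₁ : ∀ x y → x ≡ 1ℤ * x + - 0ℤ * y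
      e₁ = solve-∀
      e₂ : ∀ x y → y - x ≡ - 1ℤ * x + 1ℤ * y
      e₂ = solve-∀

  peelRight : ∀ {p q r s d} → Nonneg (mat p q r s d) → r < p → s ≤ q →
    Nonneg (unletter right (mat p q r s d))
  peelRight {p} {q} {r} {s} (hp , hq , hr , hs) h k =
    >0-resp (e₁ p r) (diff>0 h) , ≥0-resp (e₁ q s) (≤⇒diff≥0 k) ,
    ≥0-resp (e₂ p r) hr , >0-resp (e₂ q s) hs
    where
    opaque
      e₁ : ∀ x y → x - y ≡ 1ℤ * x + - 1ℤ * y
      e₁ = solve-∀
      e₂ : ∀ x y → y ≡ - 0ℤ * x + 1ℤ * y
      e₂ = solve-∀

  peelLeft-size : ∀ n p q r s d → Nonneg (mat p q r s d) →
    0ℤ ≤ + suc n - entrySum (mat p q r s d) →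
    0ℤ ≤ + n - entrySum (unletter left (mat p q r s d))
  peelLeft-size n p q r s _ (hp , hq , _ , _) h =
    ≥0-resp (e (+ n) p q r s) (+-≥0 h (+-≥0 (>0⇒pred≥0 hp) hq))
    where
    opaque
      e : ∀ n p q r s → 1ℤ + n - (p + q + r + s) + (p - 1ℤ + q) ≡
        n - (1ℤ * p + - 0ℤ * r + (1ℤ * q + - 0ℤ * s) +
             (- 1ℤ * p + 1ℤ * r) + (- 1ℤ * q + 1ℤ * s))
      e = solve-∀

  peelRight-size : ∀ n p q r s d → Nonneg (mat p q r s d) →
    0ℤ ≤ + suc n - entrySum (mat p q r s d) →
    0ℤ ≤ + n - entrySum (unletter right (mat p q r s d))
  peelRight-size n p q r s _ (_ , _ , hr , hs) h =
    ≥0-resp (e (+ n) p q r s) (+-≥0 h (+-≥0 (>0⇒pred≥0 hs) hr))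
    where
    opaque
      e : ∀ n p q r s → 1ℤ + n - (p + q + r + s) + (s - 1ℤ + r) ≡
        n - (1ℤ * p + - 1ℤ * r + (1ℤ * q + - 1ℤ * s) +
             (- 0ℤ * p + 1ℤ * r) + (- 0ℤ * q + 1ℤ * s))
      e = solve-∀

  -- The determinant equals -(q(r - p) + p(q - s)), which is at most 0.
  crossed : ∀ {p q r s} → 0ℤ < p → 0ℤ ≤ q → p * s - q * r ≡ 1ℤ → p ≤ r → s ≤ q → ⊥
  crossed {p} {q} {r} {s} hp hq d h k = ≥0∧neg>0 { - (p * s - q * r)}
    (≥0-resp (e p q r s) (+-≥0 (hq ⟨*⟩₀ ≤⇒diff≥0 h) (ℤₚ.<⇒≤ hp ⟨*⟩₀ ≤⇒diff≥0 k)))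
    (>0-resp (trans (sym d) (sym (ℤₚ.neg-involutive _))) (+<+ (ℕ.s≤s ℕ.z≤n)))
    where
    opaque
      e : ∀ p q r s → q * (r - p) + p * (q - s) ≡ - (p * s - q * r)
      e = solve-∀

  -- With α = p - r - 1 and β = s - q - 1, both nonnegative, ps - qr - 1 becomes q + r + αs + β(r +
  -- 1), so every term vanishes.
  dominant⇒ε : ∀ {p q r s d} → Nonneg (mat p q r s d) → r < p → q < s → mat p q r s d ≈ ε
  dominant⇒ε {p} {q} {r} {s} {d} (hp , hq , hr , hs) h k =
    let α≥0 = >0⇒pred≥0 (diff>0 h)
        β≥0 = >0⇒pred≥0 (diff>0 k)
        q+r , rest = sum≡0⇒≡0 (+-≥0 hq hr)
          (+-≥0 (α≥0 ⟨*⟩₀ ℤₚ.<⇒≤ hs) (β≥0 ⟨*⟩₀ +-≥0 hr (+≤+ {0} {1} ℕ.z≤n)))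
          (trans (e p q r s) (cong (_- 1ℤ) d))
        q≡0 , r≡0 = sum≡0⇒≡0 hq hr q+r
        αs , βr = sum≡0⇒≡0 (α≥0 ⟨*⟩₀ ℤₚ.<⇒≤ hs) (β≥0 ⟨*⟩₀ +-≥0 hr (+≤+ {0} {1} ℕ.z≤n)) rest
        α≡0 = *-cancel s (>0⇒≢0 hs) (trans (ℤₚ.*-comm s _) (trans αs (sym (ℤₚ.*-zeroʳ s))))
        β≡0 = *-cancel (r + 1ℤ) (>0⇒≢0 (>0-resp (ℤₚ.+-comm 1ℤ r)
                (_⟨+⟩₀_ {1ℤ} (+<+ (ℕ.s≤s ℕ.z≤n)) hr)))
                (trans (ℤₚ.*-comm (r + 1ℤ) _) (trans βr (sym (ℤₚ.*-zeroʳ (r + 1ℤ)))))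
    in same (one p r α≡0 r≡0 , q≡0 , r≡0 , one s q β≡0 q≡0)
    where
    opaque
      e : ∀ p q r s → q + r + ((p - r - 1ℤ) * s + (s - q - 1ℤ) * (r + 1ℤ)) ≡ p * s - q * r - 1ℤ
      e = solve-∀
      e′ : ∀ p r → p ≡ p - r - 1ℤ + r + 1ℤ
      e′ = solve-∀
    one : ∀ p r → p - r - 1ℤ ≡ 0ℤ → r ≡ 0ℤ → p ≡ 1ℤ
    one p r a b = trans (e′ p r) (cong₂ (λ x y → x + y + 1ℤ) a b)

  -- Comparing the rows in each column decides the first letter: a dominant bottom row calls for
  -- `left`, a dominant top row for `right`. In the mixed cases the matrix is the identity or has
  -- the wrong determinant. The recursion runs on the bound `n` for the entry sum.
  factor : ∀ n M → 0ℤ ≤ + n - entrySum M → Nonneg M → ∃ λ xs → M ≈ word xs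
  factor zero (mat p q r s d) size h@(hp , hq , hr , hs) =
    ⊥-elim (≥0∧neg>0 size (>0-resp (lem p q r s)
      (hp ⟨+⟩₀ hq ⟨+⟩₀ hr ⟨+⟩ hs)))
    where
    opaque
      lem : ∀ p q r s → p + q + r + s ≡ - (0ℤ - (p + q + r + s))
      lem = solve-∀
  factor (suc n) M@(mat p q r s d) size h@(hp , hq , hr , hs) with ≤⊎> p r | ≤⊎> s q
  ... | inj₁ a | inj₁ b = ⊥-elim (crossed hp hq d a b)
  ... | inj₂ a | inj₂ b = [] , dominant⇒ε {p} {q} {r} {s} {d} h a b
  ... | inj₁ a | inj₂ b =
    let xs , e = factor n (unletter left M) (peelLeft-size n p q r s d h size) (peelLeft {d = d} h a b)
    in left ∷ xs , P.trans (P.sym (relettered left M)) (P.∙-congˡ {letter left} e)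
  ... | inj₂ a | inj₁ b =
    let xs , e = factor n (unletter right M) (peelRight-size n p q r s d h size) (peelRight {d = d} h a b)
    in right ∷ xs , P.trans (P.sym (relettered right M)) (P.∙-congˡ {letter right} e)

nonneg⇒word : ∀ M → Nonneg M → ∃ λ xs → M ≈ word xs
nonneg⇒word M@(mat p q r s _) h@(hp , hq , hr , hs) = factor ∣ entrySum M ∣ M
  (≥0-resp (sym (trans (cong (_- entrySum M) (ℤₚ.0≤i⇒+∣i∣≡i (ℤₚ.<⇒≤ (hp ⟨+⟩₀ hq ⟨+⟩₀ hr ⟨+⟩ hs))))
    (ℤₚ.+-inverseʳ (entrySum M)))) ℤₚ.≤-refl) h

-- Reduced forms and rivers

Reduced : Form → Set
Reduced (form A B C) = 0ℤ < A × 0ℤ < - C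

AllPositive AllNegative : Form → Set
AllPositive (form A B C) = 0ℤ < A × 0ℤ < B × 0ℤ < C
AllNegative (form A B C) = 0ℤ < - A × 0ℤ < - B × 0ℤ < - C

opaque
  left-· : ∀ a b c → letter left · form a b c ≡ form (a + b + c) (b + + 2 * c) c
  left-· a b c = form-cong (e₁ a b c) (e₂ a b c) (e₃ a b c)
    where
    e₁ : ∀ a b c → a * 1ℤ * 1ℤ + b * 1ℤ * 1ℤ + c * 1ℤ * 1ℤ ≡ a + b + c
    e₁ = solve-∀
    e₂ : ∀ a b c → + 2 * a * 1ℤ * 0ℤ + b * (1ℤ * 1ℤ + 0ℤ * 1ℤ) + + 2 * c * 1ℤ * 1ℤ ≡ b + + 2 * c
    e₂ = solve-∀
    e₃ : ∀ a b c → a * 0ℤ * 0ℤ + b * 0ℤ * 1ℤ + c * 1ℤ * 1ℤ ≡ c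
    e₃ = solve-∀

  right-· : ∀ a b c → letter right · form a b c ≡ form a (+ 2 * a + b) (a + b + c)
  right-· a b c = form-cong (e₁ a b c) (e₂ a b c) (e₃ a b c)
    where
    e₁ : ∀ a b c → a * 1ℤ * 1ℤ + b * 1ℤ * 0ℤ + c * 0ℤ * 0ℤ ≡ a
    e₁ = solve-∀
    e₂ : ∀ a b c → + 2 * a * 1ℤ * 1ℤ + b * (1ℤ * 1ℤ + 1ℤ * 0ℤ) + + 2 * c * 0ℤ * 1ℤ ≡ + 2 * a + b
    e₂ = solve-∀
    e₃ : ∀ a b c → a * 1ℤ * 1ℤ + b * 1ℤ * 1ℤ + c * 1ℤ * 1ℤ ≡ a + b + c
    e₃ = solve-∀

  left⁻¹-· : ∀ a b c → letter left ⁻¹ · form a b c ≡ form (a - b + c) (b - + 2 * c) c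
  left⁻¹-· a b c = form-cong (e₁ a b c) (e₂ a b c) (e₃ a b c)
    where
    e₁ : ∀ a b c → a * 1ℤ * 1ℤ + b * 1ℤ * - 1ℤ + c * - 1ℤ * - 1ℤ ≡ a - b + c
    e₁ = solve-∀
    e₂ : ∀ a b c → + 2 * a * 1ℤ * - 0ℤ + b * (1ℤ * 1ℤ + - 0ℤ * - 1ℤ) + + 2 * c * - 1ℤ * 1ℤ ≡ b - + 2 * c
    e₂ = solve-∀
    e₃ : ∀ a b c → a * - 0ℤ * - 0ℤ + b * - 0ℤ * 1ℤ + c * 1ℤ * 1ℤ ≡ c
    e₃ = solve-∀

  right⁻¹-· : ∀ a b c → letter right ⁻¹ · form a b c ≡ form a (b - + 2 * a) (a - b + c)
  right⁻¹-· a b c = form-cong (e₁ a b c) (e₂ a b c) (e₃ a b c)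
    where
    e₁ : ∀ a b c → a * 1ℤ * 1ℤ + b * 1ℤ * - 0ℤ + c * - 0ℤ * - 0ℤ ≡ a
    e₁ = solve-∀
    e₂ : ∀ a b c → + 2 * a * 1ℤ * - 1ℤ + b * (1ℤ * 1ℤ + - 1ℤ * - 0ℤ) + + 2 * c * - 0ℤ * 1ℤ ≡ b - + 2 * a
    e₂ = solve-∀
    e₃ : ∀ a b c → a * - 1ℤ * - 1ℤ + b * - 1ℤ * 1ℤ + c * 1ℤ * 1ℤ ≡ a - b + c
    e₃ = solve-∀

2*>0 : ∀ {x} → 0ℤ < x → 0ℤ < + 2 * x
2*>0 = _⟨*⟩_ {+ 2} (+<+ (ℕ.s≤s ℕ.z≤n))

allPositive-letter : ∀ x f → AllPositive f → AllPositive (letter x · f)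
allPositive-letter left (form a b c) (ha , hb , hc) = subst AllPositive (sym (left-· a b c))
  (ha ⟨+⟩ hb ⟨+⟩ hc , hb ⟨+⟩ 2*>0 hc , hc)
allPositive-letter right (form a b c) (ha , hb , hc) = subst AllPositive (sym (right-· a b c))
  (ha , 2*>0 ha ⟨+⟩ hb , ha ⟨+⟩ hb ⟨+⟩ hc)

opaque
  neg-sum : ∀ a b c → - a + - b + - c ≡ - (a + b + c)
  neg-sum = solve-∀
  neg-2* : ∀ a b → + 2 * - a + - b ≡ - (+ 2 * a + b)
  neg-2* = solve-∀
  neg-2*′ : ∀ a b → - b + + 2 * - a ≡ - (b + + 2 * a)
  neg-2*′ = solve-∀

allNegative-letter : ∀ x f → AllNegative f → AllNegative (letter x · f)
allNegative-letter left (form a b c) (ha , hb , hc) = subst AllNegative (sym (left-· a b c))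
  (>0-resp (neg-sum a b c) (ha ⟨+⟩ hb ⟨+⟩ hc) , >0-resp (neg-2*′ c b) (hb ⟨+⟩ 2*>0 hc) , hc)
allNegative-letter right (form a b c) (ha , hb , hc) = subst AllNegative (sym (right-· a b c))
  (ha , >0-resp (neg-2* a b) (2*>0 ha ⟨+⟩ hb) , >0-resp (neg-sum a b c) (ha ⟨+⟩ hb ⟨+⟩ hc))

word-∷-· : ∀ x xs f → word (x ∷ xs) · f ≡ word xs · letter x · f
word-∷-· x xs f = ·-∙ (letter x) (word xs) f

allPositive-word : ∀ xs f → AllPositive f → AllPositive (word xs · f)
allPositive-word [] f h = subst AllPositive (sym (·-ε f)) h
allPositive-word (x ∷ xs) f h = subst AllPositive (sym (word-∷-· x xs f))
  (allPositive-word xs (letter x · f) (allPositive-letter x f h))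

allNegative-word : ∀ xs f → AllNegative f → AllNegative (word xs · f)
allNegative-word [] f h = subst AllNegative (sym (·-ε f)) h
allNegative-word (x ∷ xs) f h = subst AllNegative (sym (word-∷-· x xs f))
  (allNegative-word xs (letter x · f) (allNegative-letter x f h))

reduced⇒¬allPositive : ∀ f → Reduced f → ¬ AllPositive f
reduced⇒¬allPositive (form _ _ _) (_ , hC) (_ , _ , kC) = >0∧neg>0 kC hC

reduced⇒¬allNegative : ∀ f → Reduced f → ¬ AllNegative f
reduced⇒¬allNegative (form _ _ _) (hA , _) (kA , _) = >0∧neg>0 hA kA

-- The other letter makes all coefficients of one sign, and no later letter
-- undoes that.
letter-unique : ∀ x y ys f → Reduced f → Reduced (letter x · f) →
  Reduced (word (y ∷ ys) · f) → y ≡ x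
letter-unique left  left  _ _ _ _ _ = refl
letter-unique right right _ _ _ _ _ = refl
letter-unique left right ys f@(form a b c) (ha , hc) h k =
  ⊥-elim (reduced⇒¬allPositive _ (subst Reduced (word-∷-· right ys f) k)
    (allPositive-word ys _ (subst AllPositive (sym (right-· a b c))
      (ha , >0-resp (e a b c) (ha ⟨+⟩ s ⟨+⟩ hc) , s))))
  where
  s : 0ℤ < a + b + c
  s = proj₁ (subst Reduced (left-· a b c) h)
  opaque
    e : ∀ a b c → a + (a + b + c) + - c ≡ + 2 * a + b
    e = solve-∀
letter-unique right left ys f@(form a b c) (ha , hc) h k =
  ⊥-elim (reduced⇒¬allNegative _ (subst Reduced (word-∷-· left ys f) k)
    (allNegative-word ys _ (subst AllNegative (sym (left-· a b c))
      (s , >0-resp (e a b c) (hc ⟨+⟩ s ⟨+⟩ ha) , hc))))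
  where
  s : 0ℤ < - (a + b + c)
  s = proj₂ (subst Reduced (right-· a b c) h)
  opaque
    e : ∀ a b c → - c + - (a + b + c) + a ≡ - (b + + 2 * c)
    e = solve-∀

-- The number a - b + c becomes the leading coefficient for `left` and the trailing one for `right`,
-- so reducedness asks for opposite signs.
predecessor-letter-unique : ∀ x y f → Reduced (letter x ⁻¹ · f) → Reduced (letter y ⁻¹ · f) → x ≡ y
predecessor-letter-unique left  left  _ _ _ = refl
predecessor-letter-unique right right _ _ _ = refl
predecessor-letter-unique left right (form a b c) h k = ⊥-elim (>0∧neg>0
  (proj₁ (subst Reduced (left⁻¹-· a b c) h)) (proj₂ (subst Reduced (right⁻¹-· a b c) k)))
predecessor-letter-unique right left (form a b c) h k = ⊥-elim (>0∧neg>0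
  (proj₁ (subst Reduced (left⁻¹-· a b c) k)) (proj₂ (subst Reduced (right⁻¹-· a b c) h)))

letter-unique-pre : ∀ x y {f g h} → Reduced f → Reduced g →
  letter x · f ≡ h → letter y · g ≡ h → x ≡ y × f ≡ g
letter-unique-pre x y {f} {g} {h} hf hg ef eg
  with refl ← predecessor-letter-unique x y h (subst Reduced (sym (·-transpose (letter x) ef)) hf)
                              (subst Reduced (sym (·-transpose (letter y) eg)) hg)
  = refl , trans (sym (·-transpose (letter x) ef)) (·-transpose (letter x) eg)

-- Both letters create the coefficient a + b + c = f(1, 1), leading for `left` and trailing for
-- `right`. Its sign picks the letter, and anisotropy excludes zero.
next-reduced : ∀ f → Anisotropic f → Reduced f → ∃ λ x → Reduced (letter x · f)
next-reduced f@(form a b c) h (ha , hc) with trichotomy (a + b + c)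
... | pos s = left , subst Reduced (sym (left-· a b c)) (s , hc)
... | neg s = right , subst Reduced (sym (right-· a b c)) (ha , s)
... | nul s = ⊥-elim (anisotropic-C≢0
  (subst Anisotropic (right-· a b c) (anisotropic-· (letter right) f h)) s)

previous-reduced : ∀ f → Anisotropic f → Reduced f → ∃ λ x → Reduced (letter x ⁻¹ · f)
previous-reduced f@(form a b c) h (ha , hc) with trichotomy (a - b + c)
... | pos s = left , subst Reduced (sym (left⁻¹-· a b c)) (s , hc)
... | neg s = right , subst Reduced (sym (right⁻¹-· a b c)) (ha , s)
... | nul s = ⊥-elim (anisotropic-C≢0
  (subst Anisotropic (right⁻¹-· a b c) (anisotropic-· (letter right ⁻¹) f h)) s)

-- Subtracting the outer coefficients gives q + r = (a - c) u, where q + r and a - c are positive.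
multiplier>0 : ∀ x xs {f u} → Reduced f → vec (word (x ∷ xs)) ≡ scale u f → 0ℤ < u
multiplier>0 x xs {f} {u} h e = go (word (x ∷ xs)) f (word-offDiagonal>0 x xs) h e
  where
  go : ∀ M f → OffDiagonal>0 M → Reduced f → vec M ≡ scale u f → 0ℤ < u
  go (mat p q r s _) (form a b c) o (ha , hc) e = let (er , _ , eq) = form-injective e in
    >0-cancelˡ (ℤₚ.<⇒≤ (ha ⟨+⟩ hc)) (>0-resp (trans (lem q r)
      (trans (cong₂ _-_ er eq) (lem′ u a c))) o)
    where
    opaque
      lem : ∀ q r → q + r ≡ r - - q
      lem = solve-∀
      lem′ : ∀ u a c → u * a - u * c ≡ (a + - c) * u
      lem′ = solve-∀

-- The classification of matrices between reduced forms

data UpToSign (P : SL₂ℤ → Set) (U : SL₂ℤ) : Set where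
  _,_ : ∀ {V} → U ≈ V → P V → UpToSign P U

private
  negate : SL₂ℤ → SL₂ℤ
  negate (mat p q r s d) = mat (- p) (- q) (- r) (- s) (trans (lem p q r s) d)
    where
    opaque
      lem : ∀ p q r s → - p * - s - - q * - r ≡ p * s - q * r
      lem = solve-∀

  ≈-negate : ∀ U → U ≈ negate U
  ≈-negate (mat p q r s _) =
    opposite (nn p , nn q , nn r , nn s)
    where
    nn : ∀ i → i ≡ - - i
    nn i = sym (ℤₚ.neg-involutive i)

-- If qr < 0, the values f(p,r) > 0 > f(q,s) force bpq < 0 < brs, although
-- ps = 1 + qr ≤ 0 makes the product of these two nonnegative.
crossing-impossible : ∀ U f → Reduced f → Reduced (U · f) → ¬ 0ℤ < - (SL₂ℤ.q U * SL₂ℤ.r U)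
crossing-impossible (mat p q r s d) (form a b c) (ha , hc) (f₁>0 , f₂<0) qr<0 =
  ≥0∧neg>0 nonneg (>0-resp (e₃ b p q r s) (bpq<0 ⟨*⟩ brs>0))
  where
  ps≤0 : 0ℤ ≤ - (p * s)
  ps≤0 = ≥0-resp (trans (cong (λ D → - (q * r) - D) (sym d)) (lem p q r s)) (>0⇒pred≥0 qr<0)
    where
    opaque
      lem : ∀ p q r s → - (q * r) - (p * s - q * r) ≡ - (p * s)
      lem = solve-∀
  sum<0 : 0ℤ < - (q * r + p * s)
  sum<0 = >0-resp (sym (ℤₚ.neg-distrib-+ (q * r) (p * s))) (qr<0 ⟨+⟩₀ ps≤0)
  opaque
    e₁ : ∀ a b c p q r s →
      q * q * (a * p * p + b * p * r + c * r * r) + p * p * - (a * q * q + b * q * s + c * s * s)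
      + - c * - (q * r + p * s) * (p * s - q * r) ≡ - (b * p * q) * (p * s - q * r)
    e₁ = solve-∀
    e₂ : ∀ a b c p q r s →
      s * s * (a * p * p + b * p * r + c * r * r) + r * r * - (a * q * q + b * q * s + c * s * s)
      + a * - (q * r + p * s) * (p * s - q * r) ≡ b * r * s * (p * s - q * r)
    e₂ = solve-∀
    e₃ : ∀ b p q r s → - (b * p * q) * (b * r * s) ≡ - (b * b * (- (p * s) * - (q * r)))
    e₃ = solve-∀
  unit : ∀ {x y} → x ≡ y * (p * s - q * r) → x ≡ y
  unit {_} {y} e = trans e (trans (cong (y *_) d) (ℤₚ.*-identityʳ y))
  det>0 : 0ℤ < p * s - q * r
  det>0 = >0-resp (sym d) (+<+ (ℕ.s≤s ℕ.z≤n))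
  bpq<0 : 0ℤ < - (b * p * q)
  bpq<0 = >0-resp (trans (ℤₚ.+-comm (- c * - (q * r + p * s) * (p * s - q * r)) _) (unit (e₁ a b c p q r s)))
    (hc ⟨*⟩ sum<0 ⟨*⟩ det>0 ⟨+⟩₀
      +-≥0 (square-≥0 q ⟨*⟩₀ ℤₚ.<⇒≤ f₁>0) (square-≥0 p ⟨*⟩₀ ℤₚ.<⇒≤ f₂<0))
  brs>0 : 0ℤ < b * r * s
  brs>0 = >0-resp (trans (ℤₚ.+-comm (a * - (q * r + p * s) * (p * s - q * r)) _) (unit (e₂ a b c p q r s)))
    (ha ⟨*⟩ sum<0 ⟨*⟩ det>0 ⟨+⟩₀
      +-≥0 (square-≥0 s ⟨*⟩₀ ℤₚ.<⇒≤ f₁>0) (square-≥0 r ⟨*⟩₀ ℤₚ.<⇒≤ f₂<0))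
  nonneg : 0ℤ ≤ b * b * (- (p * s) * - (q * r))
  nonneg = square-≥0 b ⟨*⟩₀ (ps≤0 ⟨*⟩₀ ℤₚ.<⇒≤ qr<0)

-- By `crossing-impossible` q and r do not have opposite signs; then ps = 1 + qr > 0 gives p and s a
-- common sign. Inversion exchanges p and s and negates q and r, so an inversion and a change of
-- sign, where necessary, make all entries nonnegative.
reduced-classification : ∀ U f → Reduced f → Reduced (U · f) →
  UpToSign Nonneg U ⊎ UpToSign Nonneg (U ⁻¹)
reduced-classification U@(mat p q r s d) f hf hg = split (trichotomy q) (trichotomy r)
  where
  diagonal : ∀ {x y} → 0ℤ ≤ x * y → q * r ≡ x * y → 0ℤ < p * s
  diagonal h e = >0-resp (trans (cong (λ t → 1ℤ + t) (sym e)) (trans (cong (_+ q * r) (sym d)) (lem p q r s)))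
    (_⟨+⟩₀_ {1ℤ} (+<+ (ℕ.s≤s ℕ.z≤n)) h)
    where
    opaque
      lem : ∀ p q r s → p * s - q * r + q * r ≡ p * s
      lem = solve-∀
  opaque
    neg*neg : ∀ x y → x * y ≡ - x * - y
    neg*neg = solve-∀
  same-sign : 0ℤ < p * s → (0ℤ < p × 0ℤ < s) ⊎ (0ℤ < - p × 0ℤ < - s)
  same-sign h with trichotomy p
  ... | pos k = inj₁ (k , >0-cancelˡ (ℤₚ.<⇒≤ k) h)
  ... | neg k = inj₂ (k , >0-cancelˡ (ℤₚ.<⇒≤ k) (>0-resp (neg*neg p s) h))
  ... | nul k = ⊥-elim (>0⇒≢0 h (trans (cong (_* s) k) refl))
  nonneg : 0ℤ ≤ q → 0ℤ ≤ r → UpToSign Nonneg U ⊎ UpToSign Nonneg (U ⁻¹)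
  nonneg hq hr with same-sign (diagonal {q} {r} (hq ⟨*⟩₀ hr) refl)
  ... | inj₁ (hp , hs) = inj₁ (P.refl {U} , (hp , hq , hr , hs))
  ... | inj₂ (hp , hs) = inj₂ (≈-negate (U ⁻¹) ,
    (hs , ≥0-resp (sym (ℤₚ.neg-involutive q)) hq , ≥0-resp (sym (ℤₚ.neg-involutive r)) hr , hp))
  nonpos : 0ℤ ≤ - q → 0ℤ ≤ - r → UpToSign Nonneg U ⊎ UpToSign Nonneg (U ⁻¹)
  nonpos hq hr with same-sign (diagonal { - q} { - r} (hq ⟨*⟩₀ hr) (neg*neg q r))
  ... | inj₁ (hp , hs) = inj₂ (P.refl {U ⁻¹} , (hs , hq , hr , hp))
  ... | inj₂ (hp , hs) = inj₁ (≈-negate U , (hp , hq , hr , hs))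
  impossible : 0ℤ < - (q * r) → UpToSign Nonneg U ⊎ UpToSign Nonneg (U ⁻¹)
  impossible h = ⊥-elim (crossing-impossible U f hf hg h)
  split : Trichotomy q → Trichotomy r → UpToSign Nonneg U ⊎ UpToSign Nonneg (U ⁻¹)
  split (pos a) (pos b) = nonneg (ℤₚ.<⇒≤ a) (ℤₚ.<⇒≤ b)
  split (pos a) (nul b) = nonneg (ℤₚ.<⇒≤ a) (ℤₚ.≤-reflexive (sym b))
  split (pos a) (neg b) = impossible (>0-resp (sym (ℤₚ.neg-distribʳ-* q r)) (a ⟨*⟩ b))
  split (nul a) (pos b) = nonneg (ℤₚ.≤-reflexive (sym a)) (ℤₚ.<⇒≤ b)
  split (nul a) (nul b) = nonneg (ℤₚ.≤-reflexive (sym a)) (ℤₚ.≤-reflexive (sym b))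
  split (nul a) (neg b) = nonpos (ℤₚ.≤-reflexive (cong -_ (sym a))) (ℤₚ.<⇒≤ b)
  split (neg a) (pos b) = impossible (>0-resp (sym (ℤₚ.neg-distribˡ-* q r)) (a ⟨*⟩ b))
  split (neg a) (nul b) = nonpos (ℤₚ.<⇒≤ a) (ℤₚ.≤-reflexive (cong -_ (sym b)))
  split (neg a) (neg b) = nonpos (ℤₚ.<⇒≤ a) (ℤₚ.<⇒≤ b)

reduced-word : ∀ U f → Reduced f → Reduced (U · f) →
  (∃ λ xs → U ≈ word xs) ⊎ (∃ λ xs → U ⁻¹ ≈ word xs)
reduced-word U f hf hg with reduced-classification U f hf hg
... | inj₁ (e , h) = let xs , k = nonneg⇒word _ h in inj₁ (xs , P.trans e k)
... | inj₂ (e , h) = let xs , k = nonneg⇒word _ h in inj₂ (xs , P.trans e k)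

-- Periodic functions and words read off along a sequence of turns

opaque
  +-swap : ∀ i j k → i + j + k ≡ i + k + j
  +-swap = solve-∀

module _ (A : Setoid 0ℓ 0ℓ) where
  open Setoid A using () renaming (Carrier to Carrierᴬ; _≈_ to _≈ᴬ_; sym to symᴬ; trans to transᴬ; reflexive to reflexiveᴬ)

  period-multiple : (f : ℤ → Carrierᴬ) (n : ℤ) → (∀ i → f (i + n) ≈ᴬ f i) →
                    ∀ k i → f (i + k * n) ≈ᴬ f i
  period-multiple f n h = ℤ-induction _
    (λ i → reflexiveᴬ (cong f (ℤₚ.+-identityʳ i)))
    (λ k ih i → transᴬ (reflexiveᴬ (cong f (e k n i))) (transᴬ (h _) (ih i)))
    (λ k ih i → transᴬ (symᴬ (h _)) (transᴬ (reflexiveᴬ (cong f (sym (e k n i)))) (ih i)))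
    where
    opaque
      e : ∀ k n i → i + (k + 1ℤ) * n ≡ i + k * n + n
      e = solve-∀

period-multiple-≡ : ∀ {A : Set} (f : ℤ → A) (n : ℤ) → (∀ i → f (i + n) ≡ f i) →
                    ∀ k i → f (i + k * n) ≡ f i
period-multiple-≡ {A} = period-multiple (setoid A)

segment : (ℤ → Side) → ℤ → ℕ → List Side
segment w i zero    = []
segment w i (suc m) = w i ∷ segment w (i + 1ℤ) m

segment-shift : ∀ {v w} j → (∀ i → v i ≡ w (i + j)) → ∀ m i → segment v i m ≡ segment w (i + j) m
segment-shift j h zero    i = refl
segment-shift {v} {w} j h (suc m) i = cong₂ _∷_ (h i)
  (trans (segment-shift j h m (i + 1ℤ)) (cong (λ k → segment w k m) (+-swap i 1ℤ j)))

segment-· : (at : ℤ → Form) (turn : ℤ → Side) → (∀ i → letter (turn i) · at i ≡ at (i + 1ℤ)) →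
  ∀ m i → word (segment turn i m) · at i ≡ at (i + + m)
segment-· at turn step zero    i = trans (·-ε (at i)) (cong at (sym (ℤₚ.+-identityʳ i)))
segment-· at turn step (suc m) i = trans (word-∷-· (turn i) (segment turn (i + 1ℤ) m) (at i))
  (trans (cong (_ ·_) (step i)) (trans (segment-· at turn step m (i + 1ℤ))
    (cong at (ℤₚ.+-assoc i 1ℤ (+ m)))))

-- Rivers: bi-infinite sequences of reduced forms

record River : Set where
  field
    at          : ℤ → Form
    turn        : ℤ → Side
    step        : ∀ i → letter (turn i) · at i ≡ at (i + 1ℤ)
    reduced     : ∀ i → Reduced (at i)
    anisotropic : ∀ i → Anisotropic (at i)

open River

record Periodic (ρ : River) : Set where
  field
    period   : ℕ
    period>0 : 0 ℕ.< period
    periodic : ∀ i → at ρ (i + + period) ≡ at ρ i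

open Periodic

letter-unique′ : ∀ x y f → Reduced f → Reduced (letter x · f) → Reduced (letter y · f) → x ≡ y
letter-unique′ x y f h k l = sym (letter-unique x y [] f h k
  (subst Reduced (sym (trans (word-∷-· y [] f) (·-ε _))) l))

turn-unique : ∀ ρ σ i j → at ρ i ≡ at σ j → turn ρ i ≡ turn σ j
turn-unique ρ σ i j e = letter-unique′ (turn ρ i) (turn σ j) (at ρ i) (reduced ρ i)
  (subst Reduced (sym (step ρ i)) (reduced ρ _))
  (subst Reduced (trans (sym (step σ j)) (cong (_ ·_) (sym e))) (reduced σ _))

rivers-agree-from : ∀ ρ σ k j → at ρ k ≡ at σ j → ∀ i → at ρ (i + k) ≡ at σ (i + j)
rivers-agree-from ρ σ k j h = ℤ-induction _
  (trans (cong (at ρ) (ℤₚ.+-identityˡ k)) (trans h (cong (at σ) (sym (ℤₚ.+-identityˡ j)))))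
  (λ i e → trans (sym (step′ ρ i k)) (trans
    (cong₂ (λ x f → letter x · f) (turn-unique ρ σ (i + k) (i + j) e) e) (step′ σ i j)))
  (λ i e → proj₂ (letter-unique-pre (turn ρ (i + k)) (turn σ (i + j)) (reduced ρ (i + k)) (reduced σ (i + j))
    (step′ ρ i k) (trans (step′ σ i j) (sym e))))
  where
  step′ : ∀ ρ i k → letter (turn ρ (i + k)) · at ρ (i + k) ≡ at ρ (i + 1ℤ + k)
  step′ ρ i k = trans (step ρ (i + k)) (cong (at ρ) (+-swap i k 1ℤ))

rivers-agree : ∀ ρ σ j → at ρ 0ℤ ≡ at σ j → ∀ i → at ρ i ≡ at σ (i + j)
rivers-agree ρ σ j h i = trans (cong (at ρ) (sym (ℤₚ.+-identityʳ i))) (rivers-agree-from ρ σ 0ℤ j h i)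

rivers-turns-agree : ∀ ρ σ j → at ρ 0ℤ ≡ at σ j → ∀ i → turn ρ i ≡ turn σ (i + j)
rivers-turns-agree ρ σ j h i = turn-unique ρ σ i (i + j) (rivers-agree ρ σ j h i)

-- Both forms are proportional to `vec` of the word, and reducedness makes both factors positive.
-- Without it the forms could still differ in sign.
fixed-nonempty-unique : ∀ xs {f g} → 0 ℕ.< length xs → Unimodular f → Unimodular g → Reduced f → Reduced g →
  word xs · f ≡ f → word xs · g ≡ g → f ≡ g
fixed-nonempty-unique (x ∷ xs) {f} {g} _ uf ug rf rg ef eg =
  let u , hu = ·-fixed⇒vec (word (x ∷ xs)) f uf ef
      v , hv = ·-fixed⇒vec (word (x ∷ xs)) g ug eg
  in proportional-unimodular-≡ uf ug (multiplier>0 x xs rf hu) (multiplier>0 x xs rg hv) (trans (sym hu) hv)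

length-segment : ∀ w i m → length (segment w i m) ≡ m
length-segment w i zero    = refl
length-segment w i (suc m) = cong suc (length-segment w (i + 1ℤ) m)

-- The periods may differ; over their product one and the same word fixes both forms.
turns-determine : ∀ ρ σ → Periodic ρ → Periodic σ → ∀ j → (∀ i → turn ρ i ≡ turn σ (i + j)) → at ρ 0ℤ ≡ at σ j
turns-determine ρ σ ρᵖ σᵖ j h = fixed-nonempty-unique xs
  (subst (0 ℕ.<_) (sym (length-segment (turn ρ) 0ℤ N)) (ℕₚ.*-mono-< (period>0 ρᵖ) (period>0 σᵖ)))
  (Anisotropic.unimodular (anisotropic ρ 0ℤ)) (Anisotropic.unimodular (anisotropic σ j))
  (reduced ρ 0ℤ) (reduced σ j)
  (trans (segment-· (at ρ) (turn ρ) (step ρ) N 0ℤ)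
    (trans (cong (λ n → at ρ (0ℤ + n)) (trans (ℤₚ.pos-* (period ρᵖ) (period σᵖ)) (ℤₚ.*-comm (+ period ρᵖ) (+ period σᵖ))))
           (period-multiple-≡ (at ρ) (+ period ρᵖ) (periodic ρᵖ) (+ period σᵖ) 0ℤ)))
  (trans (cong (λ ys → word ys · at σ j) shifted)
    (trans (segment-· (at σ) (turn σ) (step σ) N j)
    (trans (cong (λ n → at σ (j + n)) (ℤₚ.pos-* (period ρᵖ) (period σᵖ)))
           (period-multiple-≡ (at σ) (+ period σᵖ) (periodic σᵖ) (+ period ρᵖ) j))))
  where
  N = period ρᵖ ℕ.* period σᵖ
  xs = segment (turn ρ) 0ℤ N
  shifted : xs ≡ segment (turn σ) j N
  shifted = trans (segment-shift j h N 0ℤ) (cong (λ k → segment (turn σ) k N) (ℤₚ.+-identityˡ j))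

-- By `letter-unique` no later letter makes up for one that leaves the river, so a word ending at a
-- reduced form follows the turns letter by letter.
reduced-word⇒segment : ∀ ρ xs i → Reduced (word xs · at ρ i) → xs ≡ segment (turn ρ) i (length xs)
reduced-word⇒segment ρ []       i h = refl
reduced-word⇒segment ρ (x ∷ xs) i h
  with refl ← letter-unique (turn ρ i) x xs (at ρ i) (reduced ρ i)
                (subst Reduced (sym (step ρ i)) (reduced ρ _)) h
  = cong (x ∷_) (reduced-word⇒segment ρ xs (i + 1ℤ)
      (subst Reduced (trans (word-∷-· x xs (at ρ i)) (cong (_ ·_) (step ρ i))) h))

private
  word⇒segment : ∀ ρ σ U → (∃ λ xs → U ≈ word xs) → U · at ρ 0ℤ ≡ at σ 0ℤ →
    ∃ λ m → (U ≈ word (segment (turn ρ) 0ℤ m)) × at ρ (+ m) ≡ at σ 0ℤ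
  word⇒segment ρ σ U (xs , e) h = length xs , subst (λ ys → U ≈ word ys) eq e ,
    trans (sym (segment-· (at ρ) (turn ρ) (step ρ) (length xs) 0ℤ))
          (trans (cong (λ ys → word ys · at ρ 0ℤ) (sym eq)) h′)
    where
    h′ : word xs · at ρ 0ℤ ≡ at σ 0ℤ
    h′ = trans (sym (·-cong e (at ρ 0ℤ))) h
    eq : xs ≡ segment (turn ρ) 0ℤ (length xs)
    eq = reduced-word⇒segment ρ xs 0ℤ (subst Reduced (sym h′) (reduced σ 0ℤ))

equivalence-segment : ∀ ρ σ U → U · at ρ 0ℤ ≡ at σ 0ℤ →
  (∃ λ m → (U ≈ word (segment (turn ρ) 0ℤ m)) × at ρ (+ m) ≡ at σ 0ℤ) ⊎
  (∃ λ m → (U ⁻¹ ≈ word (segment (turn σ) 0ℤ m)) × at σ (+ m) ≡ at ρ 0ℤ)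
equivalence-segment ρ σ U h
  with reduced-word U (at ρ 0ℤ) (reduced ρ 0ℤ) (subst Reduced (sym h) (reduced σ 0ℤ))
... | inj₁ w = inj₁ (word⇒segment ρ σ U w h)
... | inj₂ w = inj₂ (word⇒segment σ ρ (U ⁻¹) w (·-transpose U h))

equivalent⇒shift : ∀ ρ σ U → U · at ρ 0ℤ ≡ at σ 0ℤ → ∃ λ j → at ρ 0ℤ ≡ at σ j
equivalent⇒shift ρ σ U h with equivalence-segment ρ σ U h
... | inj₁ (m , _ , e) = - + m , trans (sym (cong (at ρ) (ℤₚ.+-inverseˡ (+ m))))
  (sym (rivers-agree σ ρ (+ m) (sym e) (- + m)))
... | inj₂ (m , _ , e) = + m , sym e

-- By Bézout the gcd g of the length and m is again a period. The word is then a power of one of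
-- length g, so aperiodicity forces g to be the whole length.
aperiodic⇒∣ : ∀ w → 0 ℕ.< CyclicWord.length w → Aperiodic w →
  ∀ m → (∀ i → CyclicWord.letter w (i + + m) ≡ CyclicWord.letter w i) → CyclicWord.length w ℕ∣.∣ m
aperiodic⇒∣ w n>0 ap m per = go (gcd[i,j]∣i (+ n) (+ m))
  where
  open CyclicWord w using () renaming (length to n; letter to l; periodic to l-periodic)
  g = ∣ gcd (+ n) (+ m) ∣
  g-period : ∀ i → l (i + + g) ≡ l i
  g-period i = let x , y , e = bézout (+ n) (+ m) in
    trans (cong (λ k → l (i + k)) (sym e)) (trans (cong l (sym (ℤₚ.+-assoc i (x * + n) (y * + m))))
    (trans (period-multiple-≡ l (+ m) per y _) (period-multiple-≡ l (+ n) l-periodic x i)))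
  go : g ℕ∣.∣ n → n ℕ∣.∣ m
  go (ℕ∣.divides zero          e) = ⊥-elim (ℕₚ.<-irrefl (sym e) n>0)
  go (ℕ∣.divides (suc zero)    e) =
    subst (ℕ∣._∣ m) (sym (trans e (ℕₚ.*-identityˡ g))) (gcd[i,j]∣j (+ n) (+ m))
  go (ℕ∣.divides (suc (suc k)) e) = ⊥-elim (ap (suc (suc k) ,
    record { length = g ; letter = l ; periodic = g-period } , ℕ.s≤s (ℕ.s≤s ℕ.z≤n) , e , λ _ → refl))

-- The form attached to a hyperbolic matrix

exact-division : ∀ g .{{_ : ℤ.NonZero g}} i → g Signed.∣ i → g * (i ℤ./ g) ≡ i
exact-division g i h = trans (ℤₚ.*-comm g (i ℤ./ g)) (sym (trans (a≡a%n+[a/n]*n i g)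
  (trans (cong (λ n → + n + (i ℤ./ g) * g) (small (i ℤ.% g) (n%d<d i g) divides))
         (ℤₚ.+-identityˡ ((i ℤ./ g) * g)))))
  where
  divides : ∣ g ∣ ℕ∣.∣ (i ℤ.% g)
  divides = Signed.∣⇒∣ᵤ (Signed.∣m+n∣n⇒∣m {g} {+ (i ℤ.% g)} {(i ℤ./ g) * g}
    (subst (g Signed.∣_) (a≡a%n+[a/n]*n i g) h) (Signed.∣n⇒∣m*n (i ℤ./ g) (Signed.∣-refl {g})))
  small : ∀ n → n ℕ.< ∣ g ∣ → ∣ g ∣ ℕ∣.∣ n → n ≡ 0
  small zero    _ _ = refl
  small (suc n) k d = ⊥-elim (ℕₚ.<⇒≱ k (ℕ∣.∣⇒≤ d))

sign*self>0 : ∀ t → ¬ t ≡ 0ℤ → 0ℤ < t * (sign t ◃ 1)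
sign*self>0 (+ 0)     h = ⊥-elim (h refl)
sign*self>0 (+ suc n) _ = _⟨*⟩_ {+ suc n} (+<+ (ℕ.s≤s ℕ.z≤n)) (+<+ (ℕ.s≤s ℕ.z≤n))
sign*self>0 -[1+ n ]  _ = +<+ (ℕ.s≤s ℕ.z≤n)

sign²≡1 : ∀ t → (sign t ◃ 1) * (sign t ◃ 1) ≡ 1ℤ
sign²≡1 (+ _)    = refl
sign²≡1 -[1+ _ ] = refl

nonZero⇒≢0 : ∀ g .{{_ : ℤ.NonZero g}} → ¬ g ≡ 0ℤ
nonZero⇒≢0 g e = ℕ.≢-nonZero⁻¹ ∣ g ∣ (cong ∣_∣ e)

module _ (M : SL₂ℤ) (h : Hyperbolic M) where
  private
    σ g : ℤ
    σ = sign (trace M) ◃ 1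
    g = content M
    instance _ = content-nonZero M h

    trace≢0 : ¬ trace M ≡ 0ℤ
    trace≢0 e = ℕₚ.<⇒≱ h (subst (λ t → ∣ t ∣ ℕ.≤ 2) (sym e) ℕ.z≤n)

    ∣∣>0 : ∀ n → ¬ + n ≡ 0ℤ → 0ℤ < + n
    ∣∣>0 zero    k = ⊥-elim (k refl)
    ∣∣>0 (suc n) _ = +<+ (ℕ.s≤s ℕ.z≤n)

    g>0 : 0ℤ < g
    g>0 = >0-resp e (∣∣>0 ∣ g ∣ λ k → nonZero⇒≢0 g (trans (sym e) k))
      where
      nonneg : ∀ M → + ∣ content M ∣ ≡ content M
      nonneg (mat _ _ _ _ _) = refl
      e : + ∣ g ∣ ≡ g
      e = nonneg M

  multiplier : ℤ
  multiplier = σ * g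

  opaque
    multiplier-quotient : ∀ x → content M Signed.∣ x → x ≡ multiplier * (σ * (x ℤ./ g))
    multiplier-quotient x k = sym (trans (lem σ g (x ℤ./ g)) (trans (cong₂ _*_ (sign²≡1 (trace M)) (exact-division g x k))
      (ℤₚ.*-identityˡ x)))
      where
      opaque
        lem : ∀ σ g y → σ * g * (σ * y) ≡ σ * σ * (g * y)
        lem = solve-∀

  trace-multiplier>0 : 0ℤ < trace M * multiplier
  trace-multiplier>0 = >0-resp (ℤₚ.*-assoc (trace M) σ g) (sign*self>0 (trace M) trace≢0 ⟨*⟩ g>0)

vec-formOf : ∀ M h → vec M ≡ scale (multiplier M h) (formOf M h)
vec-formOf M@(mat p q r s d) h = form-cong
  (multiplier-quotient M h r (Signed.∣ᵤ⇒∣ (ℕ∣.∣-trans (gcd[i,j]∣j q (gcd (s - p) r)) (gcd[i,j]∣j (s - p) r))))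
  (multiplier-quotient M h (s - p) (Signed.∣ᵤ⇒∣ (ℕ∣.∣-trans (gcd[i,j]∣j q (gcd (s - p) r)) (gcd[i,j]∣i (s - p) r))))
  (multiplier-quotient M h (- q) (Signed.∣m⇒∣-m (Signed.∣ᵤ⇒∣ {content M} {q} (gcd[i,j]∣i q (gcd (s - p) r)))))

translates-formOf : ∀ M h → Translates (formOf M h) M
translates-formOf M h = multiplier M h , vec-formOf M h , trace-multiplier>0 M h

multiplier≢0 : ∀ M h → ¬ multiplier M h ≡ 0ℤ
multiplier≢0 M h e = >0⇒≢0 (trace-multiplier>0 M h)
  (trans (cong (trace M *_) e) (ℤₚ.*-zeroʳ (trace M)))

formOf-fixed : ∀ M h → M · formOf M h ≡ formOf M h
formOf-fixed M h = scale-fixed (multiplier≢0 M h) (vec-formOf M h)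

private
  -- The content lists q, s - p, r while the form is r, s - p, -q; hence the exchange of x and z and
  -- the sign at the last coefficient.
  bézout-quotient : ∀ f g σ {a b c x y z} → ¬ g ≡ 0ℤ →
    form a b (- c) ≡ scale (σ * g) f → x * c + y * b + z * a ≡ g → Unimodular f
  bézout-quotient (form A B C) g σ {a} {b} {c} {x} {y} {z} g≢0 ef e =
    let ea , eb , ec = form-injective ef in
    σ * z , σ * y , - (σ * x) , *-cancel g g≢0
      (trans (lem g σ A B C x y z)
      (trans (cong₂ _+_ (cong₂ _+_ (cong (λ v → - (x * v)) (sym ec)) (cong (y *_) (sym eb)))
                        (cong (z *_) (sym ea)))
      (trans (lem′ x c (y * b) (z * a)) (trans e (sym (ℤₚ.*-identityʳ g))))))
    where
    opaque
      lem : ∀ g σ A B C x y z → g * (σ * z * A + σ * y * B + - (σ * x) * C) ≡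
            - (x * (σ * g * C)) + y * (σ * g * B) + z * (σ * g * A)
      lem = solve-∀
      lem′ : ∀ x c v w → - (x * - c) + v + w ≡ x * c + v + w
      lem′ = solve-∀

formOf-unimodular : ∀ M h → Unimodular (formOf M h)
formOf-unimodular M@(mat p q r s _) h =
  let x , y , z , e = bézout₃ q (s - p) r
  in bézout-quotient (formOf M h) (content M) (sign (p + s) ◃ 1) {r} {s - p} {q} {x} {y} {z}
       (nonZero⇒≢0 (content M) {{content-nonZero M h}}) (vec-formOf M h) e

disc-vec : ∀ M → disc (vec M) ≡ trace M * trace M - + 4
disc-vec (mat p q r s d) = trans (lem p q r s) (cong (λ D → (p + s) * (p + s) - + 4 * D) d)
  where
  opaque
    lem : ∀ p q r s → (s - p) * (s - p) - + 4 * r * - q ≡ (p + s) * (p + s) - + 4 * (p * s - q * r)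
    lem = solve-∀

-- With t = x + k the equation reads 4 = k(2x + k). The right-hand side is 0 for k = 0, and t > 2
-- makes it at least 5 otherwise.
square≢square-4 : ∀ t x → 2 ℕ.< t → ¬ x ℕ.* x ℕ.+ 4 ≡ t ℕ.* t
square≢square-4 t x t>2 e with ℕₚ.≤-total t x
... | inj₁ t≤x = ℕₚ.<-irrefl (sym e) (ℕₚ.≤-<-trans (ℕₚ.*-mono-≤ t≤x t≤x) (ℕₚ.m<m+n (x ℕ.* x) (ℕ.s≤s ℕ.z≤n)))
... | inj₂ x≤t = go (t ℕ.∸ x) (ℕₚ.m+[n∸m]≡n x≤t)
  where
  go : ∀ k → x ℕ.+ k ≡ t → ⊥
  go k refl = factors k (ℕₚ.+-cancelˡ-≡ (x ℕ.* x) 4 _ (trans e (expand x k))) t>2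
    where
    opaque
      expand : ∀ x k → (x ℕ.+ k) ℕ.* (x ℕ.+ k) ≡ x ℕ.* x ℕ.+ k ℕ.* (x ℕ.+ x ℕ.+ k)
      expand = ℕ-solve-∀
    factors : ∀ k → 4 ≡ k ℕ.* (x ℕ.+ x ℕ.+ k) → 2 ℕ.< x ℕ.+ k → ⊥
    factors zero          () _
    factors (suc zero)    f h = ℕₚ.<-irrefl
      (trans f (trans (ℕₚ.*-identityˡ (x ℕ.+ x ℕ.+ 1)) (ℕₚ.+-assoc x x 1)))
      (ℕₚ.+-mono-≤ (ℕₚ.+-cancelʳ-≤ 1 2 x h) h)
    factors (suc (suc k)) f h = ℕₚ.<⇒≢
      (ℕₚ.<-≤-trans (ℕ.s≤s (ℕ.s≤s (ℕ.s≤s (ℕ.s≤s (ℕ.s≤s (ℕ.z≤n {1}))))))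
        (ℕₚ.*-mono-≤ {2} {suc (suc k)} {3} (ℕ.s≤s (ℕ.s≤s ℕ.z≤n))
          (ℕₚ.≤-trans h (ℕₚ.+-monoˡ-≤ (suc (suc k)) (ℕₚ.m≤m+n x x))))) f

square-∣∣ : ∀ x → x * x ≡ + (∣ x ∣ ℕ.* ∣ x ∣)
square-∣∣ (+ n)    = sym (ℤₚ.pos-* n n)
square-∣∣ -[1+ n ] = refl

-- Let u be the multiplier, t the trace and D the discriminant, so that u²D = t² - 4. Then D > 0
-- comes from |t| > 2, and D = m² would give (um)² + 4 = t².
formOf-anisotropic : ∀ M h → Anisotropic (formOf M h)
formOf-anisotropic M h = record
  { unimodular = formOf-unimodular M h
  ; disc>0     = >0-cancelˡ (square-≥0 u) (>0-resp (sym eq) (>0-resp (cong (_- + 4) (sym (square-∣∣ t)))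
      (diff>0 {+ 4} (+<+ (ℕₚ.<-≤-trans (ℕ.s≤s (ℕ.s≤s (ℕ.s≤s (ℕ.s≤s (ℕ.s≤s (ℕ.z≤n {4}))))))
        (ℕₚ.*-mono-≤ {3} h h))))))
  ; nonsquare  = λ (m , e) → square≢square-4 ∣ t ∣ ∣ u * m ∣ h (ℤₚ.+-injective
      (trans (cong (_+ + 4) (sym (square-∣∣ (u * m))))
      (trans (cong (_+ + 4) (trans (lem u m) (trans (cong (u * u *_) (sym e)) eq)))
      (trans (lem′ (t * t)) (square-∣∣ t)))))
  }
  where
  t u : ℤ
  t = trace M
  u = multiplier M h
  eq : u * u * disc (formOf M h) ≡ t * t - + 4
  eq = trans (sym (disc-scale u (formOf M h))) (trans (cong disc (sym (vec-formOf M h))) (disc-vec M))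
  opaque
    lem : ∀ u m → u * m * (u * m) ≡ u * u * (m * m)
    lem = solve-∀
    lem′ : ∀ x → x - + 4 + + 4 ≡ x
    lem′ = solve-∀

-- Modulo 4 the discriminant is b², and `residues` checks that 2 and 3 are not squares there.
disc-mod-4 : ∀ f → disc f %ℕ 4 ≡ 0 ⊎ disc f %ℕ 4 ≡ 1
disc-mod-4 f@(form a b c) = residues (disc f %ℕ 4) (b %ℕ 4) (n%ℕd<d (disc f) 4) (n%ℕd<d b 4)
  (Signed.∣⇒∣ᵤ (Signed.divides k (trans (cong₂ _-_ (lem₀ (disc f) ρ (disc f /ℕ 4) (a≡a%ℕn+[a/ℕn]*n (disc f) 4)) refl)
    (trans (cong (λ β → β * β - + 4 * a * c - (disc f /ℕ 4) * + 4 - r * r) (a≡a%ℕn+[a/ℕn]*n b 4))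
      (lem a c r (b /ℕ 4) (disc f /ℕ 4))))))
  where
  ρ r k : ℤ
  ρ = + (disc f %ℕ 4)
  r = + (b %ℕ 4)
  k = + 2 * r * (b /ℕ 4) + + 4 * (b /ℕ 4) * (b /ℕ 4) - a * c - disc f /ℕ 4
  opaque
    lem₁ : ∀ ρ x → ρ ≡ ρ + x - x
    lem₁ = solve-∀
    lem₀ : ∀ d ρ j → d ≡ ρ + j * + 4 → ρ ≡ d - j * + 4
    lem₀ d ρ j e = trans (lem₁ ρ (j * + 4)) (cong (_- j * + 4) (sym e))
    lem : ∀ a c r j l → (r + j * + 4) * (r + j * + 4) - + 4 * a * c - l * + 4 - r * r ≡
      (+ 2 * r * j + + 4 * j * j - a * c - l) * + 4
    lem = solve-∀
  residues : ∀ ρ r → ρ ℕ.< 4 → r ℕ.< 4 → 4 ℕ∣.∣ ∣ + ρ - + r * + r ∣ → ρ ≡ 0 ⊎ ρ ≡ 1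
  residues 0 _ _ _ _ = inj₁ refl
  residues 1 _ _ _ _ = inj₂ refl
  residues 2 0 _ _ d = ⊥-elim (from-no (4 ℕ∣.∣? 2) d)
  residues 2 1 _ _ d = ⊥-elim (from-no (4 ℕ∣.∣? 1) d)
  residues 2 2 _ _ d = ⊥-elim (from-no (4 ℕ∣.∣? 2) d)
  residues 2 3 _ _ d = ⊥-elim (from-no (4 ℕ∣.∣? 7) d)
  residues 3 0 _ _ d = ⊥-elim (from-no (4 ℕ∣.∣? 3) d)
  residues 3 1 _ _ d = ⊥-elim (from-no (4 ℕ∣.∣? 2) d)
  residues 3 2 _ _ d = ⊥-elim (from-no (4 ℕ∣.∣? 1) d)
  residues 3 3 _ _ d = ⊥-elim (from-no (4 ℕ∣.∣? 6) d)
  residues (suc (suc (suc (suc _)))) _ (ℕ.s≤s (ℕ.s≤s (ℕ.s≤s (ℕ.s≤s ())))) _ _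
  residues _ (suc (suc (suc (suc _)))) _ (ℕ.s≤s (ℕ.s≤s (ℕ.s≤s (ℕ.s≤s ())))) _

FormClass : Set
FormClass = Setoid.Carrier PrimitiveIndefiniteFormClasses

anisotropic⇒class : ∀ f → Anisotropic f → PrimitiveForm f × Indefinite f × 𝒟 (disc f)
anisotropic⇒class f h = unimodular⇒primitive f unimodular , disc>0 , disc>0 , disc-mod-4 f , nonsquare
  where open Anisotropic h

class⇒anisotropic : ((f , _) : FormClass) → Anisotropic f
class⇒anisotropic (f , prim , disc>0 , _ , _ , nonsquare) = record
  { unimodular = primitive⇒unimodular f prim ; disc>0 = disc>0 ; nonsquare = nonsquare }

-- Çarks: turns of the spine

-- For `left` the branch directly follows the entering edge in the cyclic order and the spine leaves
-- by the third edge, hence R²; for `right` the spine leaves by the next edge.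
rotation : Side → SL₂ℤ
rotation left  = R ∙ R
rotation right = R

rotation-S : ∀ x → rotation x ∙ S ≈ letter x
rotation-S left  = opposite (refl , refl , refl , refl)
rotation-S right = opposite (refl , refl , refl , refl)

opaque
  R-· : ∀ a b c → R · form a b c ≡ form (a + b + c) (- (+ 2 * a) - b) a
  R-· a b c = form-cong (e₁ a b c) (e₂ a b c) (e₃ a b c)
    where
    e₁ : ∀ a b c → a * 1ℤ * 1ℤ + b * 1ℤ * 1ℤ + c * 1ℤ * 1ℤ ≡ a + b + c
    e₁ = solve-∀
    e₂ : ∀ a b c → + 2 * a * 1ℤ * -1ℤ + b * (1ℤ * 0ℤ + -1ℤ * 1ℤ) + + 2 * c * 1ℤ * 0ℤ ≡ - (+ 2 * a) - b
    e₂ = solve-∀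
    e₃ : ∀ a b c → a * -1ℤ * -1ℤ + b * -1ℤ * 0ℤ + c * 0ℤ * 0ℤ ≡ a
    e₃ = solve-∀

  RR-· : ∀ a b c → (R ∙ R) · form a b c ≡ form c (- (+ 2 * c) - b) (a + b + c)
  RR-· a b c = trans (·-∙ R R (form a b c)) (trans (cong (R ·_) (R-· a b c))
    (trans (R-· (a + b + c) (- (+ 2 * a) - b) a)
      (form-cong (e₁ a b c) (e₂ a b c) refl)))
    where
    e₁ : ∀ a b c → a + b + c + (- (+ 2 * a) - b) + a ≡ c
    e₁ = solve-∀
    e₂ : ∀ a b c → - (+ 2 * (a + b + c)) - (- (+ 2 * a) - b) ≡ - (+ 2 * c) - b
    e₂ = solve-∀

  S-· : ∀ a b c → S · form a b c ≡ form c (- b) a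
  S-· a b c = form-cong (e₁ a b c) (e₂ a b c) (e₃ a b c)
    where
    e₁ : ∀ a b c → a * 0ℤ * 0ℤ + b * 0ℤ * 1ℤ + c * 1ℤ * 1ℤ ≡ c
    e₁ = solve-∀
    e₂ : ∀ a b c → + 2 * a * 0ℤ * -1ℤ + b * (0ℤ * 0ℤ + -1ℤ * 1ℤ) + + 2 * c * 1ℤ * 0ℤ ≡ - b
    e₂ = solve-∀
    e₃ : ∀ a b c → a * -1ℤ * -1ℤ + b * -1ℤ * 0ℤ + c * 0ℤ * 0ℤ ≡ a
    e₃ = solve-∀

private
  R·≢RR· : ∀ f → Reduced f → ¬ R · f ≡ (R ∙ R) · f
  R·≢RR· (form a b c) (ha , hc) e =
    let e₁ , _ , e₂ = form-injective (trans (sym (R-· a b c)) (trans e (RR-· a b c)))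
    in >0∧neg>0 (>0-resp (trans e₂ e₁) ha) hc

-- Allows a turn to be read off from the forms on the edges into and out of a vertex. Equal values
-- for R and R² would give a = a + b + c = c, against a > 0 > c.
rotation-injective : ∀ x y f → Reduced f → rotation x · f ≡ rotation y · f → x ≡ y
rotation-injective left  left  f h e = refl
rotation-injective right right f h e = refl
rotation-injective left  right f h e = ⊥-elim (R·≢RR· f h (sym e))
rotation-injective right left  f h e = ⊥-elim (R·≢RR· f h e)

module _ (M : SL₂ℤ) where
  open RibbonGraph ⟨ M ⟩\F

  ≈⇒≈ᵉ : ∀ {V W} → V ≈ W → V ≈ᵉ W
  ≈⇒≈ᵉ {V} e = 0ℤ , P.trans (P.identityˡ V) e

  ≈ᵉ-∙ : ∀ {V W} A → V ≈ᵉ W → V ∙ A ≈ᵉ W ∙ A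
  ≈ᵉ-∙ {V} A (k , e) = k , P.trans (P.sym (P.assoc (M ^ k) V A)) (P.∙-congʳ e)

  ≈ᵉ⇒· : ∀ {F V W} → M · F ≡ F → V ≈ᵉ W → V · F ≡ W · F
  ≈ᵉ⇒· {F} {V} h (k , e) = sym (trans (sym (·-cong e F))
    (trans (·-∙ (M ^ k) V F) (cong (V ·_) (·-fixed-^ h k))))

-- The spine of a çark, with the form F of M up to sign

module Spine (ç : DirectedÇark) (w : CyclicWord) (spelling : SpineWord (DirectedÇark.spine ç) w) where
  open DirectedÇark ç
  open RibbonGraph ⟨ M ⟩\F
  open OrientedCircuit spine
  open CyclicWord w renaming (letter to turning) using ()
  private module E = Setoid edge

  out-into : ∀ i → out i ≈ᵉ into i ∙ rotation (turning i)
  out-into i = go (turning i) (proj₂ spelling i)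
    where
    go : ∀ x → Branch spine i x → out i ≈ᵉ into i ∙ rotation x
    go left (b , e₁ , e₂ , _) = E.sym {into i ∙ (R ∙ R)} (E.trans {into i ∙ (R ∙ R)} {into i ∙ R ∙ R}
      (≈⇒≈ᵉ M (P.sym (P.assoc (into i) R R)))
      (E.trans {into i ∙ R ∙ R} {b ∙ R} (≈ᵉ-∙ M {into i ∙ R} {b} R e₁) e₂))
    go right (_ , e , _) = E.sym {into i ∙ R} e

  out-S : ∀ i → out i ∙ S ≈ᵉ into (i + 1ℤ)
  out-S i with at-⊗ i
  ... | k , inj₁ e = ⊥-elim (cross i (k , P.sym e))
  ... | k , inj₂ e = k , P.trans (P.sym (P.assoc (M ^ k) (out i) S)) (P.sym e)

  into-step : ∀ i → into i ∙ letter (turning i) ≈ᵉ into (i + 1ℤ)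
  into-step i = E.trans {into i ∙ letter x} {into i ∙ rotation x ∙ S}
    (≈⇒≈ᵉ M (P.trans (P.∙-congˡ (P.sym (rotation-S x))) (P.sym (P.assoc (into i) (rotation x) S))))
    (E.trans {into i ∙ rotation x ∙ S} {out i ∙ S}
      (≈ᵉ-∙ M S (E.sym {out i} {into i ∙ rotation x} (out-into i))) (out-S i))
    where x = turning i

  into-segment : ∀ m i → into i ∙ word (segment turning i m) ≈ᵉ into (i + + m)
  into-segment zero i = E.trans {into i ∙ ε} {into i} (≈⇒≈ᵉ M (P.identityʳ (into i)))
    (E.reflexive (cong into (sym (ℤₚ.+-identityʳ i))))
  into-segment (suc m) i = E.trans {into i ∙ (x ∙ X)} {into i ∙ x ∙ X}
    (≈⇒≈ᵉ M (P.sym (P.assoc (into i) x X)))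
    (E.trans {into i ∙ x ∙ X} {into (i + 1ℤ) ∙ X} (≈ᵉ-∙ M X (into-step i))
      (E.trans {into (i + 1ℤ) ∙ X} (into-segment m (i + 1ℤ)) (E.reflexive (cong into (ℤₚ.+-assoc i 1ℤ (+ m))))))
    where
    x = letter (turning i)
    X = word (segment turning (i + 1ℤ) m)

-- Reducedness along the spine

leading trailing : Form → ℤ
leading  (form A _ _) = A
trailing (form _ _ C) = C

-- One half of `Reduced`. A letter or its inverse leaves one outer coefficient in place, so this
-- half reaches the neighbouring edge of the spine, where `fixed-reduced` restores the other half.
data Oriented : Form → Set where
  up   : ∀ {f} → 0ℤ < leading f → Oriented f
  down : ∀ {f} → 0ℤ < - trailing f → Oriented f

private
  squeeze : ∀ {q r u a c} → 0ℤ ≤ q → 0ℤ ≤ r → 0ℤ < q + r → r ≡ u * a → - q ≡ u * c →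
    ¬ a ≡ 0ℤ → ¬ c ≡ 0ℤ → 0ℤ < a ⊎ 0ℤ < - c → 0ℤ < a × 0ℤ < - c
  squeeze {q} {r} {u} {a} {c} hq hr hqr er eq a≢0 c≢0 o = a>0 (trichotomy a) , c<0 (trichotomy c)
    where
    negˡ : ∀ x y → - x * y ≡ - (x * y)
    negˡ x y = sym (ℤₚ.neg-distribˡ-* x y)
    negʳ : ∀ x y → x * - y ≡ - (x * y)
    negʳ x y = sym (ℤₚ.neg-distribʳ-* x y)
    r-not : ¬ 0ℤ < - (u * a)
    r-not k = ≥0∧neg>0 hr (>0-resp (cong -_ (sym er)) k)
    q-not : ¬ 0ℤ < u * c
    q-not k = ≥0∧neg>0 hq (>0-resp (sym eq) k)
    positive : Trichotomy u → 0ℤ < a ⊎ 0ℤ < - c → 0ℤ < u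
    positive (pos k)    _        = k
    positive (neg k)    (inj₁ l) = ⊥-elim (r-not (>0-resp (negˡ u a) (k ⟨*⟩ l)))
    positive (neg k)    (inj₂ l) = ⊥-elim (q-not (>0-resp (trans (negˡ u (- c))
      (trans (cong -_ (negʳ u c)) (ℤₚ.neg-involutive (u * c)))) (k ⟨*⟩ l)))
    positive (nul k)    _        = ⊥-elim (>0⇒≢0 hqr (cong₂ _+_
      (trans (sym (ℤₚ.neg-involutive q)) (cong -_ (trans eq (cong (_* c) k)))) (trans er (cong (_* a) k))))
    u>0 : 0ℤ < u
    u>0 = positive (trichotomy u) o
    a>0 : Trichotomy a → 0ℤ < a
    a>0 (pos k) = k
    a>0 (nul k) = ⊥-elim (a≢0 k)
    a>0 (neg k) = ⊥-elim (r-not (>0-resp (negʳ u a) (u>0 ⟨*⟩ k)))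
    c<0 : Trichotomy c → 0ℤ < - c
    c<0 (pos k) = ⊥-elim (q-not (u>0 ⟨*⟩ k))
    c<0 (nul k) = ⊥-elim (c≢0 k)
    c<0 (neg k) = k

  squeeze-form : ∀ M f u → Nonneg M → OffDiagonal>0 M → vec M ≡ scale u f → Anisotropic f →
    Oriented f → Reduced f
  squeeze-form (mat p q r s _) (form a b c) u (_ , hq , hr , _) hqr e h o =
    let er , _ , eq = form-injective e in
    squeeze {u = u} hq hr hqr er eq (anisotropic-A≢0 h) (anisotropic-C≢0 h) (side o)
    where
    side : Oriented (form a b c) → 0ℤ < a ⊎ 0ℤ < - c
    side (up k)   = inj₁ k
    side (down k) = inj₂ k

-- `vec` of a nonempty word has outer coefficients r ≥ 0 and -q ≤ 0, not both zero. The form is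
-- proportional to it and has nonzero outer coefficients, so these have opposite signs, and the sign
-- already known settles which is which.
fixed-reduced : ∀ xs f → 0 ℕ.< length xs → Anisotropic f → word xs · f ≡ f → Oriented f → Reduced f
fixed-reduced (x ∷ xs) f _ h e o = let u , k = ·-fixed⇒vec (word (x ∷ xs)) f (Anisotropic.unimodular h) e in
  squeeze-form (word (x ∷ xs)) f u (nonneg-word (x ∷ xs)) (word-offDiagonal>0 x xs) k h o

letter-oriented : ∀ x f → Reduced f → Oriented (letter x · f)
letter-oriented left  (form a b c) (ha , hc) = subst Oriented (sym (left-· a b c)) (down hc)
letter-oriented right (form a b c) (ha , hc) = subst Oriented (sym (right-· a b c)) (up ha)

unletter-oriented : ∀ x f → Reduced f → Oriented (letter x ⁻¹ · f)
unletter-oriented left  (form a b c) (ha , hc) = subst Oriented (sym (left⁻¹-· a b c)) (down hc)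
unletter-oriented right (form a b c) (ha , hc) = subst Oriented (sym (right⁻¹-· a b c)) (up ha)

scale-neg² : ∀ f → scale -1ℤ (scale -1ℤ f) ≡ f
scale-neg² f = trans (scale-scale -1ℤ -1ℤ f) (scale-1 f)

leading-neg : ∀ f → leading (scale -1ℤ f) ≡ - leading f
leading-neg (form A _ _) = ℤₚ.-1*i≡-i A

-- The sign records the direction of the spine: it is + if the çark is directed
-- by M.
record SpineForm (ç : DirectedÇark) : Set where
  open DirectedÇark ç
  open OrientedCircuit spine using (into)
  field
    signed  : Form
    choice  : signed ≡ formOf M hyperbolic ⊎ signed ≡ scale -1ℤ (formOf M hyperbolic)
    upwards : 0ℤ < leading (into 0ℤ · signed)

  signed-fixed : M · signed ≡ signed
  signed-fixed = go choice
    where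
    F = formOf M hyperbolic
    go : ∀ {f} → f ≡ F ⊎ f ≡ scale -1ℤ F → M · f ≡ f
    go (inj₁ refl) = formOf-fixed M hyperbolic
    go (inj₂ refl) = trans (·-scale M -1ℤ F) (cong (scale -1ℤ) (formOf-fixed M hyperbolic))

  signed-anisotropic : Anisotropic signed
  signed-anisotropic = go choice
    where
    F = formOf M hyperbolic
    go : ∀ {f} → f ≡ F ⊎ f ≡ scale -1ℤ F → Anisotropic f
    go (inj₁ refl) = formOf-anisotropic M hyperbolic
    go (inj₂ refl) = anisotropic-neg F (formOf-anisotropic M hyperbolic)

opaque
  spineForm : ∀ ç → SpineForm ç
  spineForm ç = go (trichotomy (leading (W · F)))
    where
    open DirectedÇark ç
    W : SL₂ℤ
    W = OrientedCircuit.into spine 0ℤ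
    F : Form
    F = formOf M hyperbolic
    leading≢0 : ∀ f → Anisotropic f → ¬ leading f ≡ 0ℤ
    leading≢0 (form _ _ _) k = anisotropic-A≢0 k
    go : Trichotomy (leading (W · F)) → SpineForm ç
    go (pos h) = record { signed = F ; choice = inj₁ refl ; upwards = h }
    go (neg h) = record { signed = scale -1ℤ F ; choice = inj₂ refl
      ; upwards = >0-resp (sym (trans (cong leading (·-scale W -1ℤ F)) (leading-neg (W · F)))) h }
    go (nul h) = ⊥-elim (leading≢0 (W · F) (anisotropic-· W F (formOf-anisotropic M hyperbolic)) h)

-- Left multiplication acts freely on edges, so `K ∙ A` is the identity as soon as it fixes `W`.
fixes-one⇒fixes-all : ∀ {K A W B} → K ∙ (A ∙ W) ≈ W → K ∙ (A ∙ B) ≈ B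
fixes-one⇒fixes-all {K} {A} {W} {B} h =
  P.trans (P.∙-congˡ {K} (P.∙-congˡ {A} (P.sym (G.\\-leftDividesˡ W B))))
  (P.trans (P.∙-congˡ {K} (P.sym (P.assoc A W (W ⁻¹ ∙ B))))
  (P.trans (P.sym (P.assoc K (A ∙ W) (W ⁻¹ ∙ B)))
  (P.trans (P.∙-congʳ {W ⁻¹ ∙ B} h) (G.\\-leftDividesˡ W B))))

module SpineRiver (ç : DirectedÇark) (w : CyclicWord) (spelling : SpineWord (DirectedÇark.spine ç) w) where
  open DirectedÇark ç
  open RibbonGraph ⟨ M ⟩\F
  open OrientedCircuit spine
  open Spine ç w spelling public
  open SpineForm (spineForm ç) public
  open CyclicWord w using () renaming (letter to turning)
  private module E = Setoid edge

  value : ∀ {V W} → V ≈ᵉ W → V · signed ≡ W · signed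
  value = ≈ᵉ⇒· M signed-fixed

  private
    form-at : ℤ → Form
    form-at i = into i · signed

    form-step : ∀ i → letter (turning i) · form-at i ≡ form-at (i + 1ℤ)
    form-step i = trans (sym (·-∙ (into i) (letter (turning i)) signed)) (value (into-step i))

    form-anisotropic : ∀ i → Anisotropic (form-at i)
    form-anisotropic i = anisotropic-· (into i) signed signed-anisotropic

    form-periodic : ∀ i → form-at (i + + size) ≡ form-at i
    form-periodic i = value (into-periodic i)

    oriented⇒reduced : ∀ i → Oriented (form-at i) → Reduced (form-at i)
    oriented⇒reduced i = fixed-reduced (segment turning i size) (form-at i)
      (subst (0 ℕ.<_) (sym (length-segment turning i size)) size>0) (form-anisotropic i)
      (trans (segment-· form-at turning form-step size i) (form-periodic i))

    form-reduced : ∀ i → Reduced (form-at i)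
    form-reduced = ℤ-induction _ (oriented⇒reduced 0ℤ (up upwards))
      (λ i h → oriented⇒reduced (i + 1ℤ) (subst Oriented (form-step i) (letter-oriented (turning i) (form-at i) h)))
      (λ i h → oriented⇒reduced i (subst Oriented (·-transpose (letter (turning i)) (form-step i))
        (unletter-oriented (turning i) (form-at (i + 1ℤ)) h)))

  river : River
  river = record
    { at = form-at ; turn = turning ; step = form-step ; reduced = form-reduced
    ; anisotropic = form-anisotropic }

  river-periodic : Periodic river
  river-periodic = record { period = size ; period>0 = size>0 ; periodic = form-periodic }

  value-out : ∀ i → out i · signed ≡ rotation (turning i) · form-at i
  value-out i = trans (value (out-into i)) (·-∙ (into i) (rotation (turning i)) signed)

  module _ (aperiodic : Aperiodic w) where
    -- A return of the form makes the turns m-periodic. Aperiodicity makes m a multiple of the size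
    -- of the circuit, and then the edge returns too.
    into-return : ∀ m → form-at (+ m) ≡ form-at 0ℤ → into (+ m) ≈ᵉ into 0ℤ
    into-return m e with subst (ℕ∣._∣ m) (proj₁ spelling)
      (aperiodic⇒∣ w (subst (0 ℕ.<_) (sym (proj₁ spelling)) size>0) aperiodic m
        (λ i → sym (rivers-turns-agree river river (+ m) (sym e) i)))
    ... | ℕ∣.divides q refl = E.trans {into (+ (q ℕ.* size))} {into (0ℤ + + q * + size)}
      (E.reflexive (cong into (trans (ℤₚ.pos-* q size) (sym (ℤₚ.+-identityˡ (+ q * + size))))))
      (period-multiple edge into (+ size) into-periodic (+ q) 0ℤ)

    -- In other words, M generates the stabiliser of the form.
    separation : ∀ {V V′} → V · signed ≡ V′ · signed → V ≈ᵉ V′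
    separation {V} {V′} e = go (equivalence-segment river river U fixed)
      where
      W N U : SL₂ℤ
      W = into 0ℤ
      N = V′ ∙ V ⁻¹
      U = W ⁻¹ ∙ (N ∙ W)
      WU : W ∙ U ≈ N ∙ W
      WU = P.trans (P.sym (P.assoc W (W ⁻¹) (N ∙ W)))
        (P.trans (P.∙-congʳ {N ∙ W} (P.inverseʳ W)) (P.identityˡ (N ∙ W)))
      NV : N ∙ V ≈ V′
      NV = P.trans (P.assoc V′ (V ⁻¹) V) (P.trans (P.∙-congˡ {V′} (P.inverseˡ V)) (P.identityʳ V′))
      N-fixed : N · signed ≡ signed
      N-fixed = trans (·-∙ V′ (V ⁻¹) signed) (trans (cong (V ⁻¹ ·_) (sym e)) (·-⁻¹ˡ V signed))
      fixed : U · form-at 0ℤ ≡ form-at 0ℤ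
      fixed = trans (sym (·-∙ W U signed)) (trans (·-cong WU signed)
        (trans (·-∙ N W signed) (cong (W ·_) N-fixed)))
      -- W ∙ X ≈ᵉ W says that X lies in the conjugate of ⟨M⟩ by W.
      path : ∀ {X} m → X ≈ word (segment turning 0ℤ m) → form-at (+ m) ≡ form-at 0ℤ → W ∙ X ≈ᵉ W
      path {X} m h k = E.trans {W ∙ X} {W ∙ word (segment turning 0ℤ m)} (≈⇒≈ᵉ M (P.∙-congˡ {W} h))
        (E.trans {W ∙ word (segment turning 0ℤ m)} {into (0ℤ + + m)} (into-segment m 0ℤ)
          (into-return m k))
      go : _ → V ≈ᵉ V′
      go (inj₁ (m , h , k)) = E.sym {V′} {V} (let (j , l) = path m h k in
        j , P.trans (P.∙-congˡ {M ^ j} (P.sym NV))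
          (fixes-one⇒fixes-all {M ^ j} {N} {W} {V} (P.trans (P.∙-congˡ {M ^ j} (P.sym WU)) l)))
      go (inj₂ (m , h , k)) = let (j , l) = path m h k in
        j , P.trans (P.∙-congˡ {M ^ j} (P.trans (P.sym (G.\\-leftDividesʳ N V)) (P.∙-congˡ {N ⁻¹} NV)))
          (fixes-one⇒fixes-all {M ^ j} {N ⁻¹} {W} {V′} (P.trans (P.∙-congˡ {M ^ j} WU⁻¹) l))
        where
        WU⁻¹ : N ⁻¹ ∙ W ≈ W ∙ U ⁻¹
        WU⁻¹ = P.trans (P.∙-congˡ {N ⁻¹} (P.trans (P.sym (G.//-rightDividesʳ U W)) (P.trans
          (P.∙-congʳ {U ⁻¹} WU) (P.assoc N W (U ⁻¹))))) (G.\\-leftDividesʳ N (W ∙ U ⁻¹))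

-- The map from çarks to forms

çarkForm : DirectedÇark → Form
çarkForm ç = OrientedCircuit.into (DirectedÇark.spine ç) 0ℤ · SpineForm.signed (spineForm ç)

çarkForm-anisotropic : ∀ ç → Anisotropic (çarkForm ç)
çarkForm-anisotropic ç = anisotropic-· (OrientedCircuit.into (DirectedÇark.spine ç) 0ℤ)
  (SpineForm.signed (spineForm ç)) (SpineForm.signed-anisotropic (spineForm ç))

çarkClass : Σ DirectedÇark PrimitiveÇark → FormClass
çarkClass (ç , _) = çarkForm ç , anisotropic⇒class (çarkForm ç) (çarkForm-anisotropic ç)

·-∼ : ∀ V W f → V · f ∼ W · f
·-∼ V W f = ∼-trans {V · f} {f} (∼-sym {f} (V , refl)) (W , refl)

-- An isomorphism commutes with `•-next` and hence transports the turns, so the forms at `c.into 0ℤ`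
-- and `c′.into k` are equal. What remains is a change of base edge.
çarkForm-cong : ∀ {ç ç′} → PrimitiveÇark ç → PrimitiveÇark ç′ → ç ≅ ç′ → çarkForm ç ∼ çarkForm ç′
çarkForm-cong {ç} {ç′} (w , spelling , _) (w′ , spelling′ , _) (φ , k , carries) =
  subst (_∼ çarkForm ç′) (sym (turns-determine A.river B.river A.river-periodic B.river-periodic k same-turns))
    (·-∼ (c′.into k) (c′.into 0ℤ) B.signed)
  where
  module A = SpineRiver ç w spelling
  module B = SpineRiver ç′ w′ spelling′
  module c = OrientedCircuit (DirectedÇark.spine ç)
  module c′ = OrientedCircuit (DirectedÇark.spine ç′)
  module H = RibbonGraph ⟨ DirectedÇark.M ç′ ⟩\F
  module E = Setoid H.edge
  open RibbonIso φ
  M′ = DirectedÇark.M ç′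

  onEdge-rotation : ∀ x V → onEdge (V ∙ rotation x) H.≈ᵉ onEdge V ∙ rotation x
  onEdge-rotation right V = E.sym {onEdge V ∙ R} (•-next-comm V)
  onEdge-rotation left  V = E.sym {onEdge V ∙ (R ∙ R)}
    (E.trans {onEdge V ∙ (R ∙ R)} {onEdge V ∙ R ∙ R} (≈⇒≈ᵉ M′ (P.sym (P.assoc (onEdge V) R R)))
    (E.trans {onEdge V ∙ R ∙ R} {onEdge (V ∙ R) ∙ R} (≈ᵉ-∙ M′ R (•-next-comm V))
    (E.trans {onEdge (V ∙ R) ∙ R} {onEdge (V ∙ R ∙ R)} (•-next-comm (V ∙ R))
      (Inverse.to-cong edge-inverse (≈⇒≈ᵉ (DirectedÇark.M ç) (P.assoc V R R))))))

  same-turns : ∀ i → CyclicWord.letter w i ≡ CyclicWord.letter w′ (i + k)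
  same-turns i = rotation-injective x (CyclicWord.letter w′ (i + k)) (c′.into (i + k) · B.signed)
    (River.reduced B.river (i + k))
    (trans (sym (trans (B.value out≈) (·-∙ (c′.into (i + k)) (rotation x) B.signed))) (B.value-out (i + k)))
    where
    x = CyclicWord.letter w i
    out≈ : c′.out (i + k) H.≈ᵉ c′.into (i + k) ∙ rotation x
    out≈ = E.trans {c′.out (i + k)} {onEdge (c.out i)} (E.sym {onEdge (c.out i)} (proj₂ (carries i)))
      (E.trans {onEdge (c.out i)} {onEdge (c.into i ∙ rotation x)} (Inverse.to-cong edge-inverse (A.out-into i))
      (E.trans {onEdge (c.into i ∙ rotation x)} {onEdge (c.into i) ∙ rotation x} (onEdge-rotation x (c.into i))
        (≈ᵉ-∙ M′ (rotation x) (proj₁ (carries i)))))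

-- Isomorphisms of quotients given by left translation

module _ {_~_ _~′_ : SL₂ℤ → SL₂ℤ → Set} (H : SL₂ℤ)
  (eq : IsEquivalence _~_) (eq′ : IsEquivalence _~′_)
  (reflexive : ∀ {V W} → V ≈ W → V ~ W) (reflexive′ : ∀ {V W} → V ≈ W → V ~′ W)
  (H-cong : ∀ {V W} → V ~ W → (H ∙ V) ~′ (H ∙ W))
  (H⁻¹-cong : ∀ {V W} → V ~′ W → (H ⁻¹ ∙ V) ~ (H ⁻¹ ∙ W)) where
  private
    module E = IsEquivalence eq
    module E′ = IsEquivalence eq′

  left-inverse : Inverse (record { isEquivalence = eq }) (record { isEquivalence = eq′ })
  left-inverse = record
    { to = H ∙_ ; from = H ⁻¹ ∙_ ; to-cong = H-cong ; from-cong = H⁻¹-cong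
    ; inverse = (λ {x} e → E′.trans (H-cong e) (reflexive′ (G.\\-leftDividesˡ H x)))
              , (λ {x} e → E.trans (H⁻¹-cong e) (reflexive (G.\\-leftDividesʳ H x)))
    }

module _ (M M′ H : SL₂ℤ) where
  private
    module A = RibbonGraph ⟨ M ⟩\F
    module B = RibbonGraph ⟨ M′ ⟩\F

    fold-left : ∀ A V n → fold (H ∙ V) (_∙ A) n ≈ H ∙ fold V (_∙ A) n
    fold-left A V zero    = P.refl {H ∙ V}
    fold-left A V (suc n) = P.trans (P.∙-congʳ {A} (fold-left A V n)) (P.assoc H (fold V (_∙ A) n) A)

  module _ (H-cong : ∀ {V W} → V A.≈ᵉ W → (H ∙ V) B.≈ᵉ (H ∙ W)) where
    -- A vertex is a cycle of edges, and left multiplication commutes with the cyclic orders, so the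
    -- condition on edges suffices.
    ⊗-translate : ∀ {V W} → V A.≈⊗ W → (H ∙ V) B.≈⊗ (H ∙ W)
    ⊗-translate {V} {W} e = let (n , f) = Equivalence.to (A.⊗-cyclic V W) e in
      Equivalence.from (B.⊗-cyclic (H ∙ V) (H ∙ W)) (n ,
        Setoid.trans B.edge {fold (H ∙ V) (_∙ S) n} {H ∙ fold V (_∙ S) n} {H ∙ W}
          (≈⇒≈ᵉ M′ (fold-left S V n)) (H-cong f))

    •-translate : ∀ {V W} → V A.≈• W → (H ∙ V) B.≈• (H ∙ W)
    •-translate {V} {W} e = let (n , f) = Equivalence.to (A.•-cyclic V W) e in
      Equivalence.from (B.•-cyclic (H ∙ V) (H ∙ W)) (n ,
        Setoid.trans B.edge {fold (H ∙ V) (_∙ R) n} {H ∙ fold V (_∙ R) n} {H ∙ W}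
          (≈⇒≈ᵉ M′ (fold-left R V n)) (H-cong f))

translation : ∀ M M′ H →
  (∀ {V W} → RibbonGraph._≈ᵉ_ ⟨ M ⟩\F V W → RibbonGraph._≈ᵉ_ ⟨ M′ ⟩\F (H ∙ V) (H ∙ W)) →
  (∀ {V W} → RibbonGraph._≈ᵉ_ ⟨ M′ ⟩\F V W → RibbonGraph._≈ᵉ_ ⟨ M ⟩\F (H ⁻¹ ∙ V) (H ⁻¹ ∙ W)) →
  RibbonIso ⟨ M ⟩\F ⟨ M′ ⟩\F
translation M M′ H H-cong H⁻¹-cong = record
  { edge-inverse = left-inverse H (Setoid.isEquivalence A.edge) (Setoid.isEquivalence B.edge)
      (≈⇒≈ᵉ M) (≈⇒≈ᵉ M′) H-cong H⁻¹-cong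
  ; ⊗-inverse = left-inverse H (Setoid.isEquivalence A.⊗-vertex) (Setoid.isEquivalence B.⊗-vertex)
      (λ {V} {W} e → A.⊗-end-cong {V} {W} (≈⇒≈ᵉ M e)) (λ {V} {W} e → B.⊗-end-cong {V} {W} (≈⇒≈ᵉ M′ e))
      (λ {V} {W} → ⊗-translate M M′ H H-cong {V} {W}) (λ {V} {W} → ⊗-translate M′ M (H ⁻¹) H⁻¹-cong {V} {W})
  ; •-inverse = left-inverse H (Setoid.isEquivalence A.•-vertex) (Setoid.isEquivalence B.•-vertex)
      (λ {V} {W} e → A.•-end-cong {V} {W} (≈⇒≈ᵉ M e)) (λ {V} {W} e → B.•-end-cong {V} {W} (≈⇒≈ᵉ M′ e))
      (λ {V} {W} → •-translate M M′ H H-cong {V} {W}) (λ {V} {W} → •-translate M′ M (H ⁻¹) H⁻¹-cong {V} {W})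
  ; ⊗-end-comm = λ V → Setoid.refl B.⊗-vertex {H ∙ V}
  ; •-end-comm = λ V → Setoid.refl B.•-vertex {H ∙ V}
  ; ⊗-next-comm = λ V → ≈⇒≈ᵉ M′ (P.assoc H V S)
  ; •-next-comm = λ V → ≈⇒≈ᵉ M′ (P.assoc H V R)
  }
  where
  module A = RibbonGraph ⟨ M ⟩\F
  module B = RibbonGraph ⟨ M′ ⟩\F

-- Left multiplication by a matrix carrying one form to the other is well defined on orbits in both
-- directions: forms are constant on orbits by `value` and distinguish them by `separation`.
çarkForm-injective : ∀ {ç ç′} → PrimitiveÇark ç → PrimitiveÇark ç′ → çarkForm ç ∼ çarkForm ç′ → ç ≅ ç′
çarkForm-injective {ç} {ç′} (w , spelling , aperiodic) (w′ , spelling′ , aperiodic′) (U , e) =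
  translation (DirectedÇark.M ç) (DirectedÇark.M ç′) H
    (λ {V} {V′} k → B.separation aperiodic′ {H ∙ V} {H ∙ V′}
      (trans (H-value V) (trans (A.value k) (sym (H-value V′)))))
    (λ {V} {V′} k → A.separation aperiodic {H ⁻¹ ∙ V} {H ⁻¹ ∙ V′}
      (trans (H⁻¹-value V) (trans (B.value k) (sym (H⁻¹-value V′))))) ,
  j , λ i → B.separation aperiodic′ {H ∙ c.into i} {c′.into (i + j)} (trans (H-value (c.into i)) (agree i)) ,
            B.separation aperiodic′ {H ∙ c.out i} {c′.out (i + j)} (trans (H-value (c.out i)) (agree-out i))
  where
  module A = SpineRiver ç w spelling
  module B = SpineRiver ç′ w′ spelling′
  module c = OrientedCircuit (DirectedÇark.spine ç)
  module c′ = OrientedCircuit (DirectedÇark.spine ç′)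
  W = c.into 0ℤ
  W′ = c′.into 0ℤ
  -- Products act from left to right: this takes `B.signed` to the form at `W′`, then by `U ⁻¹` to
  -- the form at `W`, then back to `A.signed`.
  H = W′ ∙ (U ⁻¹ ∙ W ⁻¹)
  H-form : H · B.signed ≡ A.signed
  H-form = trans (·-∙ W′ (U ⁻¹ ∙ W ⁻¹) B.signed) (trans (·-∙ (U ⁻¹) (W ⁻¹) (W′ · B.signed))
    (trans (cong (W ⁻¹ ·_) (·-transpose U e)) (·-⁻¹ˡ W A.signed)))
  H-value : ∀ V → (H ∙ V) · B.signed ≡ V · A.signed
  H-value V = trans (·-∙ H V B.signed) (cong (V ·_) H-form)
  H⁻¹-value : ∀ V → (H ⁻¹ ∙ V) · A.signed ≡ V · B.signed
  H⁻¹-value V = trans (·-∙ (H ⁻¹) V A.signed) (cong (V ·_) (·-transpose H H-form))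
  shift = equivalent⇒shift A.river B.river U e
  j = proj₁ shift
  agree : ∀ i → c.into i · A.signed ≡ c′.into (i + j) · B.signed
  agree = rivers-agree A.river B.river j (proj₂ shift)
  agree-out : ∀ i → c.out i · A.signed ≡ c′.out (i + j) · B.signed
  agree-out i = trans (A.value-out i) (trans
    (cong₂ (λ x f → rotation x · f) (rivers-turns-agree A.river B.river j (proj₂ shift) i) (agree i))
    (sym (B.value-out (i + j))))

-- The direction of translation

farey-step : (l : Line Farey) → let open Line l in ∀ i → ∃ λ x → into (i + 1ℤ) ≈ into i ∙ letter x
farey-step l i = go (at-• i) (at-⊗ i)
  where
  open Line l hiding (turn)
  through : ∀ x → out i ≈ into i ∙ rotation x → into (i + 1ℤ) ≈ out i ∙ S → into (i + 1ℤ) ≈ into i ∙ letter x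
  through x e f = P.trans f (P.trans (P.∙-congʳ {S} e)
    (P.trans (P.assoc (into i) (rotation x) S) (P.∙-congˡ {into i} (rotation-S x))))
  go : RibbonGraph._≈•_ Farey (into i) (out i) → RibbonGraph._≈⊗_ Farey (out i) (into (i + 1ℤ)) →
       ∃ λ x → into (i + 1ℤ) ≈ into i ∙ letter x
  go (inj₁ e)        _        = ⊥-elim (Line.turn l i (P.sym e))
  go (inj₂ _)        (inj₁ f) = ⊥-elim (cross i (P.sym f))
  go (inj₂ (inj₁ e)) (inj₂ f) = right , through right e f
  go (inj₂ (inj₂ e)) (inj₂ f) = left , through left (P.trans e (P.assoc (into i) R R)) f

farey-word : (l : Line Farey) → let open Line l in
  ∀ m i → ∃ λ xs → length xs ≡ m × into (i + + m) ≈ into i ∙ word xs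
farey-word l zero i = [] , refl , P.trans (P.reflexive (cong into (ℤₚ.+-identityʳ i))) (P.sym (P.identityʳ (into i)))
  where open Line l
farey-word l (suc m) i =
  let x , e = farey-step l i
      xs , k , f = farey-word l m (i + 1ℤ)
  in x ∷ xs , cong suc k , P.trans (P.reflexive (cong into (sym (ℤₚ.+-assoc i 1ℤ (+ m)))))
    (P.trans f (P.trans (P.∙-congʳ {word xs} e) (P.assoc (into i) (letter x) (word xs))))
  where open Line l

-- A word has nonnegative entries and positive trace, so u > 0 and ua = r ≥ 0.
translates-word⇒leading≥0 : ∀ xs f → Translates f (word xs) → 0ℤ ≤ leading f
translates-word⇒leading≥0 xs f = go (word xs) f (nonneg-word xs)
  where
  go : ∀ M f → Nonneg M → Translates f M → 0ℤ ≤ leading f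
  go M@(mat p q r s _) (form a b c) h@(_ , _ , hr , _) (u , e , k) =
    nonneg (trichotomy a)
    where
    u>0 : 0ℤ < u
    u>0 = >0-cancelˡ (ℤₚ.<⇒≤ (nonneg-trace>0 M h)) k
    nonneg : Trichotomy a → 0ℤ ≤ a
    nonneg (pos l) = ℤₚ.<⇒≤ l
    nonneg (nul l) = ℤₚ.≤-reflexive (sym l)
    nonneg (neg l) = ⊥-elim (≥0∧neg>0 hr (>0-resp (trans (sym (ℤₚ.neg-distribʳ-* u a))
      (cong -_ (sym (proj₁ (form-injective e))))) (u>0 ⟨*⟩ l)))

-- For an edge V on the axis, V⁻¹MV is the word of the turns met during one translation, so `V · F`
-- has no negative leading coefficient. This excludes the choice -F.
çarkForm-directed : ∀ ç → DirectedByM ç → çarkForm ç ∼ formOf (DirectedÇark.M ç) (DirectedÇark.hyperbolic ç)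
çarkForm-directed ç (axis , along) = go choice
  where
  open DirectedÇark ç
  open SpineForm (spineForm ç)
  module A = Axis axis
  F = formOf M hyperbolic
  V = A.into 0ℤ
  W = OrientedCircuit.into spine 0ℤ
  V·F≡W·F : V · F ≡ W · F
  V·F≡W·F = ≈ᵉ⇒· M (formOf-fixed M hyperbolic) (proj₁ (along 0ℤ))
  W·F-leading≥0 : 0ℤ ≤ leading (W · F)
  W·F-leading≥0 = let xs , _ , e = farey-word A.line A.shift 0ℤ in
    subst (λ f → 0ℤ ≤ leading f) V·F≡W·F (translates-word⇒leading≥0 xs (V · F)
      (translates-resp (P.trans (P.∙-congˡ {V ⁻¹} (P.trans (A.into-translate 0ℤ) e)) (G.\\-leftDividesʳ V (word xs)))
        (translates-conj V (translates-formOf M hyperbolic))))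
  go : signed ≡ F ⊎ signed ≡ scale -1ℤ F → W · signed ∼ F
  go (inj₁ e) = ∼-sym {F} (W , cong (W ·_) (sym e))
  go (inj₂ e) = ⊥-elim (≥0∧neg>0 W·F-leading≥0 (>0-resp (trans (cong (λ f → leading (W · f)) e)
    (trans (cong leading (·-scale W -1ℤ F)) (leading-neg (W · F)))) upwards))

-- Reduction of indefinite forms

Reducible : Form → Set
Reducible f = ∃ λ g → Reduced g × f ∼ g

reduced⇒reducible : ∀ {f} → Reduced f → Reducible f
reduced⇒reducible {f} h = f , h , ε , ·-ε f

reducible-pullback : ∀ U {f g} → U · f ≡ g → Reducible g → Reducible f
reducible-pullback U {f} {g} e (k , h , d) = k , h , ∼-trans {f} {g} {k} (U , e) d

private
  -- If -b ≤ a ≤ c, then b² ≤ a² ≤ ac < 4ac and the discriminant is negative.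
  middle>outer : ∀ {a b c} → 0ℤ < a → 0ℤ < - b → a ≤ c → 0ℤ < b * b - + 4 * a * c → 0ℤ < - b - a
  middle>outer {a} {b} {c} ha hb a≤c hd with ≤⊎> (- b) a
  ... | inj₂ k = diff>0 k
  ... | inj₁ k = ⊥-elim (>0∧neg>0 hd (>0-resp (e a b c)
    (_⟨*⟩_ {+ 3} (+<+ (ℕ.s≤s ℕ.z≤n)) ha ⟨*⟩ c>0 ⟨+⟩₀
      +-≥0 (ℤₚ.<⇒≤ ha ⟨*⟩₀ ≤⇒diff≥0 a≤c) (≤⇒diff≥0 k ⟨*⟩₀ ℤₚ.<⇒≤ (ha ⟨+⟩ hb)))))
    where
    c>0 : 0ℤ < c
    c>0 = ℤₚ.<-≤-trans ha a≤c
    opaque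
      e : ∀ a b c → + 3 * a * c + (a * (c - a) + (a - - b) * (a + - b)) ≡ - (b * b - + 4 * a * c)
      e = solve-∀

  Smaller : ℕ → Set
  Smaller n = ∀ a b c → 0ℤ < a → 0ℤ < c → 0ℤ ≤ + n - (a + c) → Anisotropic (form a b c) →
              Reducible (form a b c)

  opaque
    disc-swap : ∀ a b c → b * b - + 4 * a * c ≡ b * b - + 4 * c * a
    disc-swap = solve-∀

  -- The larger outer coefficient is replaced by a + b + c, which is smaller by `middle>outer`.
  -- Either the new coefficient is negative and the form reduced, or the sum of the outer
  -- coefficients has dropped.
  lower : ∀ n → Smaller n → ∀ a b c → 0ℤ < a → 0ℤ < - b → 0ℤ < c → 0ℤ ≤ + suc n - (a + c) →
    Anisotropic (form a b c) → Reducible (form a b c)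
  lower n smaller a b c ha hb hc size h = go (trichotomy (a + b + c)) (≤⊎> a c)
    where
    f = form a b c
    after-right : Anisotropic (form a (+ 2 * a + b) (a + b + c))
    after-right = subst Anisotropic (right-· a b c) (anisotropic-· (letter right) f h)
    after-left : Anisotropic (form (a + b + c) (b + + 2 * c) c)
    after-left = subst Anisotropic (left-· a b c) (anisotropic-· (letter left) f h)
    opaque
      e : ∀ n a b c → 1ℤ + n - (a + c) + (- b - a - 1ℤ) ≡ n - (a + (a + b + c))
      e = solve-∀
      e′ : ∀ n a b c → 1ℤ + n - (a + c) + (- b - c - 1ℤ) ≡ n - (a + b + c + c)
      e′ = solve-∀
    go : Trichotomy (a + b + c) → a ≤ c ⊎ c < a → Reducible f
    go (neg k) _ = reducible-pullback (letter right) (right-· a b c) (reduced⇒reducible (ha , k))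
    go (nul k) _ = ⊥-elim (anisotropic-C≢0 after-right k)
    go (pos k) (inj₁ a≤c) = reducible-pullback (letter right) (right-· a b c)
      (smaller a (+ 2 * a + b) (a + b + c) ha k
        (≥0-resp (e (+ n) a b c) (+-≥0 size (>0⇒pred≥0 (middle>outer {a} {b} {c} ha hb a≤c (Anisotropic.disc>0 h)))))
        after-right)
    go (pos k) (inj₂ c<a) = reducible-pullback (letter left) (left-· a b c)
      (smaller (a + b + c) (b + + 2 * c) c k hc
        (≥0-resp (e′ (+ n) a b c) (+-≥0 size (>0⇒pred≥0 (middle>outer {c} {b} {a} hc hb (ℤₚ.<⇒≤ c<a)
          (>0-resp (disc-swap a b c) (Anisotropic.disc>0 h))))))
        after-left)

  positive-reducible : ∀ n → Smaller n
  positive-reducible zero a b c ha hc size h =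
    ⊥-elim (≥0∧neg>0 size (>0-resp (lem a c) (ha ⟨+⟩ hc)))
    where
    opaque
      lem : ∀ a c → a + c ≡ - (0ℤ - (a + c))
      lem = solve-∀
  positive-reducible (suc n) a b c ha hc size h = go (trichotomy b)
    where
    f = form a b c
    opaque
      lem : ∀ a c → + 4 * a * c ≡ - (0ℤ - + 4 * a * c)
      lem = solve-∀
    go : Trichotomy b → Reducible f
    go (neg k) = lower n (positive-reducible n) a b c ha k hc size h
    go (nul k) = ⊥-elim (>0∧neg>0 (Anisotropic.disc>0 h)
      (>0-resp (trans (lem a c) (cong (λ x → - (x * x - + 4 * a * c)) (sym k)))
        (_⟨*⟩_ {+ 4} (+<+ (ℕ.s≤s ℕ.z≤n)) ha ⟨*⟩ hc)))
    -- `S` makes the middle coefficient negative and keeps the sum of the outer ones.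
    go (pos k) = reducible-pullback S (S-· a b c)
      (lower n (positive-reducible n) c (- b) a hc (>0-resp (sym (ℤₚ.neg-involutive b)) k) ha
        (≥0-resp (cong (λ x → + suc n - x) (ℤₚ.+-comm a c)) size)
        (subst Anisotropic (S-· a b c) (anisotropic-· S f h)))

  outer-positive-reducible : ∀ a b c → 0ℤ < a → 0ℤ < c → Anisotropic (form a b c) → Reducible (form a b c)
  outer-positive-reducible a b c ha hc = positive-reducible ∣ a + c ∣ a b c ha hc
    (≥0-resp (sym (trans (cong (_- (a + c)) (ℤₚ.0≤i⇒+∣i∣≡i (ℤₚ.<⇒≤ (ha ⟨+⟩ hc)))) (ℤₚ.+-inverseʳ (a + c)))) ℤₚ.≤-refl)

  mixed : ∀ a b c → 0ℤ < - a → 0ℤ < c → Reducible (form a b c)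
  mixed a b c ha hc = reducible-pullback S (S-· a b c) (reduced⇒reducible (hc , ha))

  -- If g is reduced, the outer coefficients of -g have the right signs in the wrong order, which
  -- `S` corrects.
  negated : ∀ f → Reducible (scale -1ℤ f) → Reducible f
  negated f (g , h , U , e) = reducible-pullback U
    (trans (cong (U ·_) (sym (scale-neg² f))) (trans (·-scale U -1ℤ (scale -1ℤ f)) (cong (scale -1ℤ) e))) (flip g h)
    where
    flip : ∀ g → Reduced g → Reducible (scale -1ℤ g)
    flip (form a b c) (ha , hc) = mixed (-1ℤ * a) (-1ℤ * b) (-1ℤ * c)
      (>0-resp (sym (trans (cong -_ (ℤₚ.-1*i≡-i a)) (ℤₚ.neg-involutive a))) ha)
      (>0-resp (sym (ℤₚ.-1*i≡-i c)) hc)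

reducible : ∀ f → Anisotropic f → Reducible f
reducible f@(form a b c) h = go (trichotomy a) (trichotomy c)
  where
  go : Trichotomy a → Trichotomy c → Reducible f
  go (nul k) _       = ⊥-elim (anisotropic-A≢0 h k)
  go _       (nul k) = ⊥-elim (anisotropic-C≢0 h k)
  go (pos k) (pos l) = outer-positive-reducible a b c k l h
  go (pos k) (neg l) = reduced⇒reducible (k , l)
  go (neg k) (pos l) = mixed a b c k l
  go (neg k) (neg l) = negated f (outer-positive-reducible (-1ℤ * a) (-1ℤ * b) (-1ℤ * c)
    (>0-resp (sym (ℤₚ.-1*i≡-i a)) k) (>0-resp (sym (ℤₚ.-1*i≡-i c)) l) (anisotropic-neg f h))

-- There are finitely many reduced forms of a given discriminant

disc-reduced : ∀ a b c → disc (form (+ suc a) b -[1+ c ]) ≡ + (∣ b ∣ ℕ.* ∣ b ∣ ℕ.+ 4 ℕ.* (suc a ℕ.* suc c))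
disc-reduced a b c = trans (lem b (+ suc a) (+ suc c)) (trans
  (cong₂ _+_ (square-∣∣ b) (trans (cong (λ x → + 4 * x) (sym (ℤₚ.pos-* (suc a) (suc c)))) (sym (ℤₚ.pos-* 4 (suc a ℕ.* suc c)))))
  (sym (ℤₚ.pos-+ (∣ b ∣ ℕ.* ∣ b ∣) (4 ℕ.* (suc a ℕ.* suc c)))))
  where
  opaque
    lem : ∀ b x y → b * b - + 4 * x * - y ≡ b * b + + 4 * (x * y)
    lem = solve-∀

Bounded : ℕ → Form → Set
Bounded n (form A B C) = ∣ A ∣ ℕ.< n × ∣ B ∣ ℕ.< n × ∣ C ∣ ℕ.< n

-- For A > 0 > C the discriminant is B² + 4|A||C|, a sum without cancellation, so it bounds each
-- coefficient.
reduced-bounded : ∀ f → Reduced f → Bounded (suc ∣ disc f ∣) f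
reduced-bounded (form (+ suc a) b -[1+ c ]) _ rewrite disc-reduced a b c =
  ℕ.s≤s (ℕₚ.≤-trans (ℕₚ.m≤m*n (suc a) (suc c)) outer) ,
  ℕ.s≤s (ℕₚ.≤-trans (square ∣ b ∣) (ℕₚ.m≤m+n _ _)) ,
  ℕ.s≤s (ℕₚ.≤-trans (ℕₚ.m≤n*m (suc c) (suc a)) outer)
  where
  outer : suc a ℕ.* suc c ℕ.≤ ∣ b ∣ ℕ.* ∣ b ∣ ℕ.+ 4 ℕ.* (suc a ℕ.* suc c)
  outer = ℕₚ.≤-trans (ℕₚ.m≤n*m (suc a ℕ.* suc c) 4) (ℕₚ.m≤n+m _ _)
  square : ∀ n → n ℕ.≤ n ℕ.* n
  square zero    = ℕ.z≤n
  square (suc n) = ℕₚ.m≤m*n (suc n) (suc n)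
reduced-bounded (form (+ 0) _ _) (+<+ () , _)
reduced-bounded (form (+ suc _) _ (+ 0)) (_ , +<+ ())

signCode : ℤ → Fin 2
signCode (+ _)    = fzero
signCode -[1+ _ ] = fsuc fzero

∣∣-signCode-injective : ∀ x y → ∣ x ∣ ≡ ∣ y ∣ → signCode x ≡ signCode y → x ≡ y
∣∣-signCode-injective (+ _)    (+ _)    e _ = cong +_ e
∣∣-signCode-injective -[1+ _ ] -[1+ _ ] e _ = cong -[1+_] (ℕₚ.suc-injective e)
∣∣-signCode-injective (+ _)    -[1+ _ ] _ ()
∣∣-signCode-injective -[1+ _ ] (+ _)    _ ()

-- Reducedness fixes the signs of A and C, so the absolute values and the sign of B determine the
-- form.
code : ∀ {n} f → Bounded n f → Fin (n ℕ.* (n ℕ.* (n ℕ.* 2)))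
code (form A B C) (a , b , c) = combine (fromℕ< a) (combine (fromℕ< b) (combine (fromℕ< c) (signCode B)))

code-injective : ∀ {n} f g (p : Bounded n f) (q : Bounded n g) → Reduced f → Reduced g →
  code f p ≡ code g q → f ≡ g
code-injective (form (+ suc a) b -[1+ c ]) (form (+ suc a′) b′ -[1+ c′ ]) (p , q , r) (p′ , q′ , r′) _ _ e =
  let ea , e₁ = Finₚ.combine-injective (fromℕ< p) _ (fromℕ< p′) _ e
      eb , e₂ = Finₚ.combine-injective (fromℕ< q) _ (fromℕ< q′) _ e₁
      ec , es = Finₚ.combine-injective (fromℕ< r) (signCode b) (fromℕ< r′) (signCode b′) e₂
  in form-cong (cong +_ (Finₚ.fromℕ<-injective _ _ p p′ ea))
       (∣∣-signCode-injective b b′ (Finₚ.fromℕ<-injective _ _ q q′ eb) es)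
       (cong -[1+_] (ℕₚ.suc-injective (Finₚ.fromℕ<-injective _ _ r r′ ec)))
code-injective (form (+ 0) _ _) _ _ _ (+<+ () , _) _ _
code-injective (form (+ suc _) _ (+ 0)) _ _ _ (_ , +<+ ()) _ _
code-injective (form (+ suc _) _ -[1+ _ ]) (form (+ 0) _ _) _ _ _ (+<+ () , _) _
code-injective (form (+ suc _) _ -[1+ _ ]) (form (+ suc _) _ (+ 0)) _ _ _ (_ , +<+ ()) _

reduced-repetition : (f : ℕ → Form) (d : ℤ) → (∀ i → Reduced (f i)) → (∀ i → disc (f i) ≡ d) →
  ∃₂ λ i j → i ℕ.< j × f i ≡ f j
reduced-repetition f d reduced disc≡ =
  let i , j , i<j , e = Finₚ.pigeonhole (ℕₚ.n<1+n _) (λ k → code (f (toℕ k)) (bounded (toℕ k)))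
  in toℕ i , toℕ j , i<j , code-injective (f (toℕ i)) (f (toℕ j)) (bounded (toℕ i)) (bounded (toℕ j))
       (reduced (toℕ i)) (reduced (toℕ j)) e
  where
  bounded : ∀ i → Bounded (suc ∣ d ∣) (f i)
  bounded i = subst (λ x → Bounded (suc ∣ x ∣) (f i)) (disc≡ i) (reduced-bounded (f i) (reduced i))

least : {P : ℕ → Set} → (∀ n → Dec (P n)) → ∀ n → P n → ∃ λ m → P m × (∀ k → k ℕ.< m → ¬ P k)
least {P} P? = <-rec (λ n → P n → ∃ λ m → P m × (∀ k → k ℕ.< m → ¬ P k)) go
  where
  go : ∀ n → (∀ {k} → k ℕ.< n → P k → ∃ λ m → P m × (∀ k → k ℕ.< m → ¬ P k)) →
       P n → ∃ λ m → P m × (∀ k → k ℕ.< m → ¬ P k)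
  go n rec p with ℕₚ.anyUpTo? P? n
  ... | yes (k , k<n , q) = rec k<n q
  ... | no ¬q = n , p , λ k k<n q → ¬q (k , k<n , q)

infix 4 _≟ᶠ_
_≟ᶠ_ : (f g : Form) → Dec (f ≡ g)
form A B C ≟ᶠ form A′ B′ C′ = map′ (λ (a , b , c) → form-cong a b c) form-injective
  ((A ℤₚ.≟ A′) ×-dec (B ℤₚ.≟ B′) ×-dec (C ℤₚ.≟ C′))

-- The river through a reduced form, and its çark

-- At a •-vertex of the river only the entering edge carries a reduced form. This excludes
-- backtracking and repeated vertices on the circuit built below.
rotation-unreduced : ∀ x f → Reduced f → ¬ Reduced (rotation x · f)
rotation-unreduced right (form a b c) (ha , _) h = >0∧neg>0 ha (proj₂ (subst Reduced (R-· a b c) h))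
rotation-unreduced left  (form a b c) (_ , hc) h = >0∧neg>0 (proj₁ (subst Reduced (RR-· a b c) h)) hc

upwards-value : ∀ {F f g} W → g ≡ F ⊎ g ≡ scale -1ℤ F → 0ℤ < leading (W · g) → F ≡ f →
  Reduced (W · f) → W · g ≡ W · f
upwards-value {F} W (inj₁ refl) _ refl _ = refl
upwards-value {F} W (inj₂ refl) h refl k = ⊥-elim (go (W · F) k
  (>0-resp (trans (cong leading (·-scale W -1ℤ F)) (leading-neg (W · F))) h))
  where
  go : ∀ f → Reduced f → ¬ 0ℤ < - leading f
  go (form _ _ _) (l , _) = >0∧neg>0 l

module Flow (f : Form) (f-anisotropic : Anisotropic f) (f-reduced : Reduced f) where

  -- The river is followed by matrices rather than by forms, so that its places are edges of the
  -- Farey tree.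
  Place : Set
  Place = Σ SL₂ℤ λ V → Reduced (V · f)

  place-anisotropic : ∀ V → Anisotropic (V · f)
  place-anisotropic V = anisotropic-· V f f-anisotropic

  ahead : ((V , h) : Place) → ∃ λ x → Reduced (letter x · V · f)
  ahead (V , h) = next-reduced (V · f) (place-anisotropic V) h

  behind : ((V , h) : Place) → ∃ λ x → Reduced (letter x ⁻¹ · V · f)
  behind (V , h) = previous-reduced (V · f) (place-anisotropic V) h

  forth back : Place → Place
  forth v@(V , h) = let x , k = ahead v in V ∙ letter x , subst Reduced (sym (·-∙ V (letter x) f)) k
  back  v@(V , h) = let x , k = behind v in V ∙ letter x ⁻¹ , subst Reduced (sym (·-∙ V (letter x ⁻¹) f)) k

  place : ℤ → Place
  place (+ 0)        = ε , subst Reduced (sym (·-ε f)) f-reduced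
  place (+ suc n)    = forth (place (+ n))
  place -[1+ 0 ]     = back (place (+ 0))
  place -[1+ suc n ] = back (place -[1+ n ])

  into : ℤ → SL₂ℤ
  into i = proj₁ (place i)

  turning : ℤ → Side
  turning (+ n)    = proj₁ (ahead (place (+ n)))
  -- At a negative index the turn is the letter that was removed in stepping back from the next
  -- place.
  turning -[1+ n ] = proj₁ (behind (place (-[1+ n ] + 1ℤ)))

  into-step : ∀ i → into (i + 1ℤ) ≈ into i ∙ letter (turning i)
  into-step (+ n)        = P.reflexive (cong into (ℤₚ.+-comm (+ n) 1ℤ))
  into-step -[1+ 0 ]     = P.sym (G.//-rightDividesˡ (letter (turning -[1+ 0 ])) (into (+ 0)))
  into-step -[1+ suc n ] = P.sym (G.//-rightDividesˡ (letter (turning -[1+ suc n ])) (into -[1+ n ]))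

  form-at : ℤ → Form
  form-at i = into i · f

  river : River
  river = record
    { at = form-at ; turn = turning
    ; step = λ i → sym (trans (·-cong (into-step i) f) (·-∙ (into i) (letter (turning i)) f))
    ; reduced = λ i → proj₂ (place i) ; anisotropic = λ i → place-anisotropic (into i) }

  into-segment : ∀ m i → into (i + + m) ≈ into i ∙ word (segment turning i m)
  into-segment zero    i = P.trans (P.reflexive (cong into (ℤₚ.+-identityʳ i))) (P.sym (P.identityʳ (into i)))
  into-segment (suc m) i = P.trans (P.reflexive (cong into (sym (ℤₚ.+-assoc i 1ℤ (+ m)))))
    (P.trans (into-segment m (i + 1ℤ)) (P.trans (P.∙-congʳ {X} (into-step i)) (P.assoc (into i) (letter (turning i)) X)))
    where X = word (segment turning (i + 1ℤ) m)

  Return : ℕ → Set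
  Return n = 0 ℕ.< n × form-at (+ n) ≡ form-at 0ℤ

  returns : ∃ Return
  returns = let i , j , i<j , e = reduced-repetition (λ n → form-at (+ n)) (disc f)
                  (λ n → proj₂ (place (+ n))) (λ n → disc-· (into (+ n)) f)
            in j ℕ.∸ i , ℕₚ.m<n⇒0<n∸m i<j , sym (shifted i j i<j e)
    where
    shifted : ∀ i j → i ℕ.< j → form-at (+ i) ≡ form-at (+ j) → form-at 0ℤ ≡ form-at (+ (j ℕ.∸ i))
    shifted i j i<j e = trans (cong form-at (sym (ℤₚ.+-inverseˡ (+ i))))
      (trans (rivers-agree-from river river (+ i) (+ j) e (- + i))
        (cong form-at (trans (ℤₚ.+-comm (- + i) (+ j)) (trans (ℤₚ.m-n≡m⊖n j i) (ℤₚ.⊖-≥ (ℕₚ.<⇒≤ i<j))))))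

  opaque
    -- A later return could run through the river several times; minimality yields both the
    -- simplicity of the circuit and the aperiodicity of its word.
    minimal : ∃ λ n → Return n × (∀ k → k ℕ.< n → ¬ Return k)
    minimal = least (λ n → (0 ℕₚ.<? n) ×-dec (form-at (+ n) ≟ᶠ form-at 0ℤ)) (proj₁ returns) (proj₂ returns)

  n : ℕ
  n = proj₁ minimal

  n>0 : 0 ℕ.< n
  n>0 = proj₁ (proj₁ (proj₂ minimal))

  form-periodic : ∀ i → form-at (i + + n) ≡ form-at i
  form-periodic i = sym (rivers-agree river river (+ n) (sym (proj₂ (proj₁ (proj₂ minimal)))) i)

  turning-periodic : ∀ i → turning (i + + n) ≡ turning i
  turning-periodic i = turn-unique river river (i + + n) i (form-periodic i)

  river-periodic : Periodic river
  river-periodic = record { period = n ; period>0 = n>0 ; periodic = form-periodic }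

  no-early-return : ∀ k → k ℕ.< n → form-at (+ k) ≡ form-at 0ℤ → k ≡ 0
  no-early-return zero    _   _ = refl
  no-early-return (suc k) k<n e = ⊥-elim (proj₂ (proj₂ minimal) (suc k) k<n (ℕ.s≤s ℕ.z≤n , e))

  -- For the remainder r of i - j modulo n the form returns already after r steps, and r < n forces
  -- r = 0.
  form-at-injective : ∀ i j → form-at i ≡ form-at j → + n ℤ∣.∣ i - j
  form-at-injective i j e = Signed.∣⇒∣ᵤ (Signed.divides q (trans split (trans (cong (λ r → + r + q * + n) r≡0)
    (ℤₚ.+-identityˡ (q * + n)))))
    where
    instance _ = ℕ.>-nonZero n>0
    r = (i - j) %ℕ n
    q = (i - j) /ℕ n
    split : i - j ≡ + r + q * + n
    split = a≡a%ℕn+[a/ℕn]*n (i - j) n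
    r≡0 : r ≡ 0
    r≡0 = no-early-return r (n%ℕd<d (i - j) n) (trans
      (sym (trans (cong form-at split) (period-multiple-≡ form-at (+ n) form-periodic q (+ r))))
      (trans (cong form-at (ℤₚ.+-comm i (- j))) (trans (rivers-agree-from river river i j e (- j))
        (cong form-at (ℤₚ.+-inverseˡ j)))))

  xs : List Side
  xs = segment turning 0ℤ n

  M : SL₂ℤ
  M = word xs

  form-0 : form-at 0ℤ ≡ f
  form-0 = ·-ε f

  M-fixed : M · f ≡ f
  M-fixed = trans (cong (M ·_) (sym form-0)) (trans (segment-· form-at turning (River.step river) n 0ℤ)
    (trans (form-periodic 0ℤ) form-0))

  M-multiplier : ∃ λ u → vec M ≡ scale u f × 0ℤ < u
  M-multiplier = let u , e = ·-fixed⇒vec M f (Anisotropic.unimodular f-anisotropic) M-fixed in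
    u , e , go xs (subst (0 ℕ.<_) (sym (length-segment turning 0ℤ n)) n>0) e
    where
    go : ∀ ys {u} → 0 ℕ.< length ys → vec (word ys) ≡ scale u f → 0ℤ < u
    go (y ∷ ys) _ e = multiplier>0 y ys f-reduced e

  -- t² - 4 is the discriminant of `vec M`, which is a nonzero multiple u of f; so it equals u²
  -- times the positive discriminant of f.
  M-hyperbolic : Hyperbolic M
  M-hyperbolic = let u , e , u>0 = M-multiplier in ℕₚ.≰⇒> λ small →
    ≥0∧neg>0 {+ 4 - trace M * trace M}
      (≥0-resp (cong (λ x → + 4 - x) (sym (square-∣∣ (trace M)))) (≤⇒diff≥0 (+≤+ (ℕₚ.*-mono-≤ small small))))
      (>0-resp (trans (sym (disc-scale u f)) (trans (cong disc (sym e)) (trans (disc-vec M) (lem (trace M)))))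
        (u>0 ⟨*⟩ u>0 ⟨*⟩ Anisotropic.disc>0 f-anisotropic))
    where
    opaque
      lem : ∀ t → t * t - + 4 ≡ - (+ 4 - t * t)
      lem = solve-∀

  formOf-M : formOf M M-hyperbolic ≡ f
  formOf-M = let u , e , u>0 = M-multiplier in
    proportional-unimodular-≡ (formOf-unimodular M M-hyperbolic) (Anisotropic.unimodular f-anisotropic)
      (>0-cancelˡ (ℤₚ.<⇒≤ (nonneg-trace>0 M (nonneg-word xs))) (trace-multiplier>0 M M-hyperbolic)) u>0
      (trans (sym (vec-formOf M M-hyperbolic)) e)

  open RibbonGraph ⟨ M ⟩\F
  private module E = Setoid edge

  -- `into 0ℤ` is the identity, so `M` itself is the edge reached after n steps. Periodicity of the
  -- turns carries this to every i.
  into-translate : ∀ i → M ∙ into i ≈ into (i + + n)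
  into-translate = ℤ-induction _
    (P.trans (P.identityʳ M) (P.trans (P.sym (P.identityˡ M)) (P.sym (into-segment n 0ℤ))))
    (λ i h → P.trans (P.∙-congˡ {M} (into-step i)) (P.trans (P.sym (P.assoc M (into i) (letter (turning i))))
      (P.trans (P.∙-congʳ {letter (turning i)} h) (P.sym (shifted i)))))
    (λ i h → P.trans (P.∙-congˡ {M} (unstep i)) (P.trans (P.sym (P.assoc M (into (i + 1ℤ)) (letter (turning i) ⁻¹)))
      (P.trans (P.∙-congʳ {letter (turning i) ⁻¹} (P.trans h (shifted i)))
        (G.//-rightDividesʳ (letter (turning i)) (into (i + + n))))))
    where
    shifted : ∀ i → into (i + 1ℤ + + n) ≈ into (i + + n) ∙ letter (turning i)
    shifted i = P.trans (P.reflexive (cong into (+-swap i 1ℤ (+ n)))) (P.trans (into-step (i + + n))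
      (P.reflexive (cong (λ x → into (i + + n) ∙ letter x) (turning-periodic i))))
    unstep : ∀ i → into i ≈ into (i + 1ℤ) ∙ letter (turning i) ⁻¹
    unstep i = P.trans (P.sym (G.//-rightDividesʳ (letter (turning i)) (into i)))
      (P.∙-congʳ {letter (turning i) ⁻¹} (P.sym (into-step i)))

  out : ℤ → SL₂ℤ
  out i = into i ∙ rotation (turning i)

  value : ∀ {V W} → V ≈ᵉ W → V · f ≡ W · f
  value = ≈ᵉ⇒· M M-fixed

  value-out : ∀ i → out i · f ≡ rotation (turning i) · form-at i
  value-out i = ·-∙ (into i) (rotation (turning i)) f

  out-unreduced : ∀ i → ¬ Reduced (out i · f)
  out-unreduced i h = rotation-unreduced (turning i) (form-at i) (River.reduced river i)
    (subst Reduced (value-out i) h)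

  into-periodic : ∀ i → into (i + + n) ≈ᵉ into i
  into-periodic i = E.sym {into i} {into (i + + n)} (1ℤ ,
    P.trans (P.∙-congʳ {into i} (P.identityʳ M)) (into-translate i))

  at-•ʳ : ∀ i x → RibbonGraph._≈•_ ⟨ M ⟩\F (into i) (into i ∙ rotation x)
  at-•ʳ i x = 0ℤ , go x
    where
    go : ∀ x → (into i ∙ rotation x ≈ ε ∙ into i) ⊎ (into i ∙ rotation x ≈ ε ∙ into i ∙ R) ⊎
               (into i ∙ rotation x ≈ ε ∙ into i ∙ R ∙ R)
    go right = inj₂ (inj₁ (P.∙-congʳ {R} (P.sym (P.identityˡ (into i)))))
    go left  = inj₂ (inj₂ (P.trans (P.sym (P.assoc (into i) R R))
      (P.∙-congʳ {R} (P.∙-congʳ {R} (P.sym (P.identityˡ (into i)))))))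

  out-S : ∀ i → into (i + 1ℤ) ≈ out i ∙ S
  out-S i = P.trans (into-step i) (P.trans (P.∙-congˡ {into i} (P.sym (rotation-S (turning i))))
    (P.sym (P.assoc (into i) (rotation (turning i)) S)))

  line : Line ⟨ M ⟩\F
  line = record
    { into = into ; out = out
    ; at-• = λ i → at-•ʳ i (turning i)
    ; turn = λ i e → out-unreduced i (subst Reduced (value {into i} {out i} e) (River.reduced river i))
    ; at-⊗ = λ i → 0ℤ , inj₂ (P.trans (out-S i) (P.∙-congʳ {S} (P.sym (P.identityˡ (out i)))))
    ; cross = λ i e → out-unreduced i (subst Reduced (sym (value {out i} {into (i + 1ℤ)} e)) (River.reduced river (i + 1ℤ)))
    }

  •-simple : ∀ i j → into i ≈• into j → + n ℤ∣.∣ i - j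
  •-simple i j (k , e) = form-at-injective i j (go e)
    where
    base : form-at i ≡ (M ^ k ∙ into i) · f
    base = sym (trans (·-∙ (M ^ k) (into i) f) (cong (into i ·_) (·-fixed-^ {M} M-fixed k)))
    rotated : ∀ x V → into j ≈ V ∙ rotation x → form-at i ≡ V · f → ⊥
    rotated x V h b = rotation-unreduced x (form-at i) (River.reduced river i)
      (subst Reduced (trans (·-cong h f) (trans (·-∙ V (rotation x) f) (cong (rotation x ·_) (sym b)))) (River.reduced river j))
    go : _ → form-at i ≡ form-at j
    go (inj₁ h)        = trans base (sym (·-cong h f))
    go (inj₂ (inj₁ h)) = ⊥-elim (rotated right (M ^ k ∙ into i) h base)
    go (inj₂ (inj₂ h)) = ⊥-elim (rotated left (M ^ k ∙ into i) (P.trans h (P.assoc (M ^ k ∙ into i) R R)) base)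

  -- `S` takes the form on an outgoing edge to the reduced form on the next incoming one, which
  -- shifts the question to i + 1 and j + 1. If the two edges were exchanged by `S`, the form on
  -- `out j` would be reduced.
  ⊗-simple : ∀ i j → out i ≈⊗ out j → + n ℤ∣.∣ i - j
  ⊗-simple i j (k , e) = subst (+ n ℤ∣.∣_) (lem i j) (form-at-injective (i + 1ℤ) (j + 1ℤ) (go e))
    where
    opaque
      lem : ∀ i j → i + 1ℤ - (j + 1ℤ) ≡ i - j
      lem = solve-∀
    next : ∀ i → S · out i · f ≡ form-at (i + 1ℤ)
    next i = trans (sym (·-∙ (out i) S f)) (sym (·-cong (out-S i) f))
    base : out i · f ≡ (M ^ k ∙ out i) · f
    base = sym (trans (·-∙ (M ^ k) (out i) f) (cong (out i ·_) (·-fixed-^ {M} M-fixed k)))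
    go : _ → form-at (i + 1ℤ) ≡ form-at (j + 1ℤ)
    go (inj₁ h) = trans (sym (next i)) (trans (cong (S ·_) (trans base (sym (·-cong h f)))) (next j))
    go (inj₂ h) = ⊥-elim (out-unreduced j (subst Reduced
      (trans (sym (next i)) (trans (cong (S ·_) base) (trans (sym (·-∙ (M ^ k ∙ out i) S f)) (sym (·-cong h f)))))
      (River.reduced river (i + 1ℤ))))

  circuit : OrientedCircuit ⟨ M ⟩\F
  circuit = record
    { line = line ; size = n ; size>0 = n>0
    ; into-periodic = into-periodic
    ; out-periodic = λ i → E.trans {out (i + + n)} {into (i + + n) ∙ rotation (turning i)}
        (E.reflexive (cong (λ x → into (i + + n) ∙ rotation x) (turning-periodic i)))
        (≈ᵉ-∙ M (rotation (turning i)) (into-periodic i))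
    ; •-simple = •-simple ; ⊗-simple = ⊗-simple
    }

  çark : DirectedÇark
  çark = record { M = M ; hyperbolic = M-hyperbolic ; spine = circuit }

  spineWord : CyclicWord
  spineWord = record { length = n ; letter = turning ; periodic = turning-periodic }

  branch : ∀ i x → turning i ≡ x → Branch circuit i x
  branch i left e = into i ∙ R , E.refl {into i ∙ R} ,
    ≈⇒≈ᵉ M (P.trans (P.assoc (into i) R R) (P.reflexive (cong (λ x → into i ∙ rotation x) (sym e)))) ,
    ≈⇒≈ᵉ M (P.trans (P.reflexive (cong (λ x → into i ∙ rotation x ∙ R) e)) (P.trans (P.assoc (into i) (R ∙ R) R)
      (P.trans (P.∙-congˡ {into i} (opposite (refl , refl , refl , refl))) (P.identityʳ (into i)))))
  branch i right e = into i ∙ (R ∙ R) ,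
    ≈⇒≈ᵉ M (P.reflexive (cong (λ x → into i ∙ rotation x) (sym e))) ,
    ≈⇒≈ᵉ M (P.trans (P.reflexive (cong (λ x → into i ∙ rotation x ∙ R) e)) (P.assoc (into i) R R)) ,
    ≈⇒≈ᵉ M (P.trans (P.assoc (into i) (R ∙ R) R)
      (P.trans (P.∙-congˡ {into i} (opposite (refl , refl , refl , refl))) (P.identityʳ (into i))))

  -- If the word were a proper power, its turns would have a period d with 0 < d < n. Turns
  -- determine forms, so the form would return after d steps, before the first return.
  primitive-çark : PrimitiveÇark çark
  primitive-çark = spineWord , (refl , λ i → branch i (turning i) refl) , aperiodic
    where
    aperiodic : Aperiodic spineWord
    aperiodic (k , u , k≥2 , n≡kd , same-letters) = contradiction d n≡kd u-periodic
      where
      d = CyclicWord.length u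
      u-periodic : ∀ i → turning i ≡ turning (i + + d)
      u-periodic i = trans (same-letters i) (trans (sym (CyclicWord.periodic u i)) (sym (same-letters (i + + d))))
      contradiction : ∀ d → n ≡ k ℕ.* d → (∀ i → turning i ≡ turning (i + + d)) → ⊥
      contradiction zero    e _ = ℕₚ.<-irrefl (sym (trans e (ℕₚ.*-zeroʳ k))) n>0
      contradiction (suc d) e h with no-early-return (suc d)
        (subst (suc d ℕ.<_) (sym e) (ℕₚ.<-≤-trans (ℕₚ.m<m+n (suc d) (ℕ.s≤s ℕ.z≤n))
          (ℕₚ.≤-trans (ℕₚ.≤-reflexive (cong (suc d ℕ.+_) (sym (ℕₚ.+-identityʳ (suc d))))) (ℕₚ.*-monoˡ-≤ (suc d) k≥2))))
        (sym (turns-determine river river river-periodic river-periodic (+ suc d) h))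
      ... | ()

  çarkForm-çark : çarkForm çark ≡ f
  çarkForm-çark = trans (upwards-value (into 0ℤ) choice upwards formOf-M (proj₂ (place 0ℤ))) form-0
    where open SpineForm (spineForm çark)

corollary4p8 : Σ (Bijection PrimitiveDirectedÇarks PrimitiveIndefiniteFormClasses) λ Φ →
    ∀ (ç : DirectedÇark) (prim : PrimitiveÇark ç) → DirectedByM ç →
    proj₁ (Bijection.to Φ (ç , prim)) ∼ formOf (DirectedÇark.M ç) (DirectedÇark.hyperbolic ç)
corollary4p8 = record
  { to        = çarkClass
  ; cong      = λ {(_ , prim)} {(_ , prim′)} → çarkForm-cong prim prim′
  ; bijective = (λ {(_ , prim)} {(_ , prim′)} → çarkForm-injective prim prim′) , surjective
  } , λ ç _ → çarkForm-directed ç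
  where
  -- Surjectivity of setoids speaks of every z isomorphic to the constructed çark, whence the use of
  -- `çarkForm-cong`.
  surjective : ∀ (y : FormClass) → ∃ λ x → ∀ {z} → proj₁ z ≅ proj₁ x → proj₁ (çarkClass z) ∼ proj₁ y
  surjective y@(g , _) = (çark , primitive-çark) , λ {(ç , prim)} e →
    ∼-trans {çarkForm ç} {f} {g} (subst (çarkForm ç ∼_) çarkForm-çark (çarkForm-cong prim primitive-çark e))
      (∼-sym {g} {f} g∼f)
    where
    g-reducible = reducible g (class⇒anisotropic y)
    f = proj₁ g-reducible
    g∼f = proj₂ (proj₂ g-reducible)
    f-anisotropic : Anisotropic f
    f-anisotropic = subst Anisotropic (proj₂ g∼f) (anisotropic-· (proj₁ g∼f) g (class⇒anisotropic y))
    open Flow f f-anisotropic (proj₁ (proj₂ g-reducible))
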